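{- Let $\pi\in S_n$ be such that $G=G(\pi)$ is a cograph, and let $D=D(\pi)$ be the corresponding permutation digraph. Suppose the internal nodes of the modular decomposition tree of $G$ consist of degenerate $1$-nodes $N_1,\dots,N_t$ and degenerate $0$-nodes $M_1,\dots,M_r$. Suppose further that $M_i$ has $k_i$ children, which are divided into isomorphism classes according to the directed subgraphs they induce in $D$: $n_{i1}$ children of isomorphism type $1$, $n_{i2}$ children of isomorphism type $2$, $\dots$, and $n_{it_i}$ children of isomorphism type $t_i$. Then the number of permutations represented by $D$ is \[ n(D)=\prod_{i=1}^{r}\frac{k_i!}{n_{i1}!\,n_{i2}!\cdots n_{it_i}!}. \] The size of the geo-equivalence class $[\pi]$ is $2n(D)$, unless $D\cong -D$, in which case it is $n(D)$.
   Context: Inversion set: $E(\pi)=\{(i,j):1\le i<j\le n,\ \pi^{ -1}(i)>\pi^{ -1}(j)\}$. $G(\pi)$ is the graph on $\{1,\dots,n\}$ in which $i<j$ are adjacent iff $(i,j)\in E(\pi)$; $D(\pi)$ is the digraph on $\{1,\dots,n\}$ with arc set $E(\pi)$. $-D$ is the digraph obtained from $D$ by reversing all arcs. A digraph $D$ represents a permutation $\sigma\in S_n$ if $D\cong D(\sigma)$. Modular decomposition: a module of $G=(V,E)$ is a set $M\subseteq V$ such that each vertex outside $M$ is adjacent to all or to none of the vertices of $M$. Two modules overlap if $M\cap N$, $M\setminus N$, $N\setminus M$ are all non-empty; a module is strong if it overlaps no other module. The modular decomposition tree of $G$ has the (non-empty) strong modules of $G$ as nodes and $V$ as root; the internal nodes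 are those with more than one element, and the children of an internal node $M$ are: the connected components of $G|M$ if $G|M$ is disconnected ($M$ is then a degenerate $0$-node); the connected components of the complement $G^c|M$ if $G|M$ is connected and $G^c|M$ is disconnected (degenerate $1$-node); the maximal proper submodules of $M$ if both $G|M$ and $G^c|M$ are connected (prime node). A cograph is a graph whose modular decomposition tree contains no prime nodes. Geo-equivalence: a geometric graph is a simple graph together with a straight-line drawing in the plane with vertices in general position (no three vertices collinear, no three edges crossing at a single point); two edges cross if they meet at a point interior to both. A geo-isomorphism is a vertex bijection preserving adjacency, non-adjacency, crossings and non-crossings of edges. $K_{2,n}$ has vertex set $\{a,b\}\cup\{1,\dots,n\}$. For $\pi\in S_n$, the realization $\overline{K}_{2,n}(\pi)$ is built thus: from each of two points $a,b\in\mathbb{R}^2$ draw $n$ rays, all on the same side of the line $ab$, each ray from $a$ meeting each ray from $b$ (generically, so that general position holds); label the rays from $b$ as $1,\dots,n$ in increasing order of angle with the segment $ba$, and the rays from $a$ as $\pi(1),\dots,\pi(n)$ in increasing order of angle with the segment $ab$; place vertex $i$ at the intersection of the two rays labeled $i$ and draw the segments $ai,bi$. Then $\sigma\sim\pi$ iff $\overline{K}_{2,n}(\sigma)$ and $\overline{K}_{2,n}(\pi)$ are geo-isomorphic, and $[\pi]\subseteq S_n$ is the equivalence class of $\pi$. -}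

module Defs where

open import Level using (Level; 0ℓ; _⊔_) renaming (suc to lsuc)
open import Algebra.Apartness.Bundles using (HeytingField)
open import Data.Empty using (⊥)
open import Data.Fin.Base as Fin using (Fin; zero; suc)
open import Data.Fin.Permutation as Perm using (Permutation′; _⟨$⟩ʳ_; _⟨$⟩ˡ_)
open import Data.Fin.Subset
  using (Subset; _∈_; _∉_; _⊂_; _⊆_; _∩_; _─_; Nonempty; ∣_∣)
open import Data.Nat.Base as ℕ using (ℕ; NonZero; _!; _/_)
open import Data.Nat.Properties using (_!≢0; m*n≢0)
open import Data.Product.Base using (Σ; Σ-syntax; ∃; ∃-syntax; _×_; _,_; proj₁; proj₂)
open import Data.Sum.Base using (_⊎_; [_,_]′)
open import Data.Unit.Base using (⊤; tt)
open import Data.Vec.Functional using (foldr)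
open import Function.Base using (_on_; flip)
open import Function.Bundles using (Bijection; _⇔_)
open import Relation.Binary.Bundles using (Setoid)
open import Relation.Binary.Construct.Closure.ReflexiveTransitive using (Star)
open import Relation.Binary.Construct.Closure.Symmetric using (SymClosure)
import Relation.Binary.Construct.On as On
open import Relation.Binary.Core using (Rel)
open import Relation.Binary.Definitions using (Symmetric)
open import Relation.Binary.Morphism.Structures using (IsOrderIsomorphism)
open import Relation.Binary.PropositionalEquality
  using (_≡_; _≢_; refl; sym; trans; setoid)
open import Relation.Binary.Structures using (IsStrictPartialOrder)
open import Relation.Nullary.Negation using (¬_)
open import Relation.Unary using (Pred)

-- A listing, without repetition (up to the equality of S), of exactly
-- the elements of S that satisfy P; so P has N elements.
Enumeration : ∀ {a ℓ p} (S : Setoid a ℓ) → Pred (Setoid.Carrier S) p → ℕ → Set _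
Enumeration S P N =
  Bijection (setoid (Fin N)) (On.setoid {B = Σ (Setoid.Carrier S) P} S proj₁)

Subsets : ℕ → Setoid 0ℓ 0ℓ
Subsets n = setoid (Subset n)

Sym : ℕ → Setoid 0ℓ 0ℓ
Sym n = record
  { Carrier       = Permutation′ n
  ; _≈_           = Perm._≈_
  ; isEquivalence = record
    { refl  = λ _ → refl
    ; sym   = λ p i → sym (p i)
    ; trans = λ p q i → trans (p i) (q i)
    }
  }

∏ : ∀ {n} → (Fin n → ℕ) → ℕ
∏ = foldr ℕ._*_ 1

∏!≢0 : ∀ {n} (m : Fin n → ℕ) → NonZero (∏ (λ j → m j !))
∏!≢0 {ℕ.zero}  m = _
∏!≢0 {ℕ.suc n} m =
  m*n≢0 (m zero !) _ {{m zero !≢0}} {{∏!≢0 (λ j → m (suc j))}}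

-- k! / (m₀! m₁! ⋯).  It is only used when k is the sum of the m j, and
-- then the division is exact.
multinomial : ∀ {t} → ℕ → (Fin t → ℕ) → ℕ
multinomial k m = _/_ (k !) (∏ (λ j → m j !)) {{∏!≢0 m}}

infix 4 _≅_
_≅_ : {A B : Set} → Rel A 0ℓ → Rel B 0ℓ → Set
R ≅ S = ∃[ f ] IsOrderIsomorphism _≡_ _≡_ R S f

infix 8 -_
-_ : {A : Set} → Rel A 0ℓ → Rel A 0ℓ
- D = flip D

infixl 7 _↾_
_↾_ : ∀ {n} → Rel (Fin n) 0ℓ → (M : Subset n) → Rel (∃ (_∈ M)) 0ℓ
R ↾ M = R on proj₁

infix 9 _ᶜ
_ᶜ : {A : Set} → Rel A 0ℓ → Rel A 0ℓ
(G ᶜ) x y = x ≢ y × ¬ G x y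

Connected : {A : Set} → Rel A 0ℓ → Set
Connected G = ∀ x y → Star G x y

IsComponent : ∀ {n} → Rel (Fin n) 0ℓ → Subset n → Subset n → Set
IsComponent G M C =
  ∃[ u ] ∀ v → v ∈ C ⇔ (Σ[ v∈M ∈ v ∈ M ] Star (G ↾ M) u (v , v∈M))

-- The inversion set E(π), which is also the arc relation of D(π).
D[_] : ∀ {n} → Permutation′ n → Rel (Fin n) 0ℓ
D[ π ] i j = i Fin.< j × (π ⟨$⟩ˡ j) Fin.< (π ⟨$⟩ˡ i)

G[_] : ∀ {n} → Permutation′ n → Rel (Fin n) 0ℓ
G[ π ] = SymClosure D[ π ]

Represents : ∀ {n} → Rel (Fin n) 0ℓ → Pred (Permutation′ n) 0ℓ
Represents D σ = D ≅ D[ σ ]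

module _ {n : ℕ} (G : Rel (Fin n) 0ℓ) where

  IsModule : Pred (Subset n) 0ℓ
  IsModule M = ∀ v → v ∉ M →
    (∀ m → m ∈ M → G v m) ⊎ (∀ m → m ∈ M → ¬ G v m)

  Overlap : Rel (Subset n) 0ℓ
  Overlap M N = Nonempty (M ∩ N) × Nonempty (M ─ N) × Nonempty (N ─ M)

  IsStrong : Pred (Subset n) 0ℓ
  IsStrong M = IsModule M × (∀ N → IsModule N → ¬ Overlap M N)

  IsNode : Pred (Subset n) 0ℓ
  IsNode M = Nonempty M × IsStrong M

  IsInternal : Pred (Subset n) 0ℓ
  IsInternal M = IsNode M × 1 ℕ.< ∣ M ∣

  ZeroNode : Pred (Subset n) 0ℓ
  ZeroNode M = IsInternal M × ¬ Connected (G ↾ M)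

  OneNode : Pred (Subset n) 0ℓ
  OneNode M = IsInternal M × Connected (G ↾ M) × ¬ Connected (G ᶜ ↾ M)

  PrimeNode : Pred (Subset n) 0ℓ
  PrimeNode M = IsInternal M × Connected (G ↾ M) × Connected (G ᶜ ↾ M)

  IsProperSubmodule : Subset n → Pred (Subset n) 0ℓ
  IsProperSubmodule M C = Nonempty C × IsModule C × C ⊂ M

  data Child (M C : Subset n) : Set where
    ofZero  : ZeroNode M → IsComponent G M C → Child M C
    ofOne   : OneNode M → IsComponent (G ᶜ) M C → Child M C
    ofPrime : PrimeNode M → IsProperSubmodule M C →
              (∀ C′ → IsProperSubmodule M C′ → C ⊆ C′ → C ≡ C′) → Child M C

  IsCograph : Set
  IsCograph = ∀ M → ¬ PrimeNode M

-- The vertex sets satisfying P fall into exactly t classes according to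
-- the isomorphism type of the subdigraph of D they induce, and the j-th
-- class has m j members.
record IsoClasses {n : ℕ} (D : Rel (Fin n) 0ℓ) (P : Pred (Subset n) 0ℓ)
                  (t : ℕ) (m : Fin t → ℕ) : Set where
  field
    type      : ∃ P → Fin t
    same-type : ∀ C C′ → type C ≡ type C′ ⇔ (D ↾ proj₁ C ≅ D ↾ proj₁ C′)
    inhabited : ∀ j → ∃[ C ] type C ≡ j
    size      : ∀ j → Enumeration (Subsets n)
                        (λ C → Σ[ p ∈ P C ] type (C , p) ≡ j) (m j)

-- The plane is coordinatized by an arbitrary ordered field in place of ℝ.
-- The real numbers are an instance, whether developed classically or
-- constructively; so is ℚ.  That 0 # 1 and 0 < 1 follows from the fields.
record OrderedField c ℓ₁ ℓ₂ ℓ₃ : Set (lsuc (c ⊔ ℓ₁ ⊔ ℓ₂ ⊔ ℓ₃)) where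
  field
    heytingField : HeytingField c ℓ₁ ℓ₂
  open HeytingField heytingField public
  infix 4 _<_
  field
    _<_                  : Rel Carrier ℓ₃
    isStrictPartialOrder : IsStrictPartialOrder _≈_ _<_
    #⇔<⊎>                : ∀ x y → x # y ⇔ (x < y ⊎ y < x)
    +-monoˡ-<            : ∀ {x y} z → x < y → (x + z) < (y + z)
    *-pos                : ∀ {x y} → 0# < x → 0# < y → 0# < (x * y)

data Vertex (n : ℕ) : Set where
  a b  : Vertex n
  leaf : Fin n → Vertex n

K₂ : ∀ n → Rel (Vertex n) 0ℓ
K₂ n a        (leaf _) = ⊤
K₂ n b        (leaf _) = ⊤
K₂ n (leaf _) a        = ⊤
K₂ n (leaf _) b        = ⊤
K₂ n _        _        = ⊥

K₂-sym : ∀ {n} → Symmetric (K₂ n)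
K₂-sym {x = a}      {leaf _} _ = tt
K₂-sym {x = b}      {leaf _} _ = tt
K₂-sym {x = leaf _} {a}      _ = tt
K₂-sym {x = leaf _} {b}      _ = tt

K₂-irrefl : ∀ {n} (x : Vertex n) → ¬ K₂ n x x
K₂-irrefl a        ()
K₂-irrefl b        ()
K₂-irrefl (leaf _) ()

module Geometry {c ℓ₁ ℓ₂ ℓ₃} (K : OrderedField c ℓ₁ ℓ₂ ℓ₃) where

  open OrderedField K hiding (sym; -_)

  Point : Set c
  Point = Carrier × Carrier

  infix 4 _≈ₚ_
  _≈ₚ_ : Rel Point ℓ₁
  (x , y) ≈ₚ (x′ , y′) = x ≈ x′ × y ≈ y′

  infixl 6 _⊕_ _⊖_
  infixl 7 _⊙_
  _⊕_ _⊖_ : Point → Point → Point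
  (x , y) ⊕ (x′ , y′) = (x + x′ , y + y′)
  (x , y) ⊖ (x′ , y′) = (x - x′ , y - y′)

  _⊙_ : Carrier → Point → Point
  s ⊙ (x , y) = (s * x , s * y)

  det : Point → Point → Carrier
  det (x , y) (x′ , y′) = x * y′ - y * x′

  Collinear : Point → Point → Point → Set ℓ₁
  Collinear p q r = det (q ⊖ p) (r ⊖ p) ≈ 0#

  Interior : (p q z : Point) → Set (c ⊔ ℓ₁ ⊔ ℓ₃)
  Interior p q z = ∃[ s ] 0# < s × s < 1# × z ≈ₚ p ⊕ s ⊙ (q ⊖ p)

  -- z lies on the ray from p with direction w, and z is not p.
  OnRay : (p w z : Point) → Set (c ⊔ ℓ₁ ⊔ ℓ₃)
  OnRay p w z = ∃[ s ] 0# < s × z ≈ₚ p ⊕ s ⊙ w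

  -- Directions v and w point to the same open side of a line with
  -- direction d.
  SameSide : (d v w : Point) → Set ℓ₃
  SameSide d v w = 0# < det d v * det d w

  -- For v and w on the same side of d: the angle from d to v is smaller
  -- than the angle from d to w.  Indeed v is then met before w when
  -- turning away from d towards their side, that is, the turn from v to
  -- w has the same sense as the turn from d to v.
  SmallerAngle : (d v w : Point) → Set ℓ₃
  SmallerAngle d v w = 0# < det d v * det v w

  module _ {V : Set} (Adj : Rel V 0ℓ) (pos : V → Point) where

    DistinctEdges : (u v x y : V) → Set
    DistinctEdges u v x y = ¬ ((u ≡ x × v ≡ y) ⊎ (u ≡ y × v ≡ x))

    CrossAt : (u v x y : V) → Point → Set (c ⊔ ℓ₁ ⊔ ℓ₃)
    CrossAt u v x y z = DistinctEdges u v x y ×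
      Interior (pos u) (pos v) z × Interior (pos x) (pos y) z

    record InGeneralPosition : Set (c ⊔ ℓ₁ ⊔ ℓ₃) where
      field
        distinct      : ∀ {u v} → u ≢ v → ¬ pos u ≈ₚ pos v
        no-collinear  : ∀ {u v w} → u ≢ v → v ≢ w → u ≢ w →
                        ¬ Collinear (pos u) (pos v) (pos w)
        no-concurrent : ∀ {u v x y s t} → Adj u v → Adj x y → Adj s t →
                        ∀ z → ¬ (CrossAt u v x y z × CrossAt x y s t z ×
                                 CrossAt u v s t z)

  record GeometricGraph : Set (lsuc 0ℓ ⊔ c ⊔ ℓ₁ ⊔ ℓ₃) where
    field
      {V}             : Set
      Adj             : Rel V 0ℓ
      adj-sym         : Symmetric Adj
      adj-irrefl      : ∀ v → ¬ Adj v v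
      pos             : V → Point
      generalPosition : InGeneralPosition Adj pos

    Cross : (u v x y : V) → Set (c ⊔ ℓ₁ ⊔ ℓ₃)
    Cross u v x y = ∃[ z ] CrossAt Adj pos u v x y z

  record GeoIsomorphism (X Y : GeometricGraph) : Set (c ⊔ ℓ₁ ⊔ ℓ₃) where
    private
      module X = GeometricGraph X
      module Y = GeometricGraph Y
    field
      to         : X.V → Y.V
      isGraphIso : IsOrderIsomorphism _≡_ _≡_ X.Adj Y.Adj to
      crossings  : ∀ {u v x y} → X.Adj u v → X.Adj x y →
                   X.Cross u v x y ⇔ Y.Cross (to u) (to v) (to x) (to y)

  position : ∀ {n} → Point → Point → (Fin n → Point) → Vertex n → Point
  position A B P a        = A
  position A B P b        = B
  position A B P (leaf i) = P i

  -- The drawings K̄₂,ₙ(π).  The k-th ray from A (in order of angle with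
  -- AB) has direction α k and label π(k); the k-th ray from B (in order
  -- of angle with BA) has direction β k and label k.
  record Realization {n : ℕ} (π : Permutation′ n) : Set (c ⊔ ℓ₁ ⊔ ℓ₃) where
    field
      A B          : Point
      α β          : Fin n → Point
      same-side    : ∀ (k l : Fin n ⊎ Fin n) →
                     SameSide (B ⊖ A) ([ α , β ]′ k) ([ α , β ]′ l)
      α-increasing : ∀ {k l} → k Fin.< l → SmallerAngle (B ⊖ A) (α k) (α l)
      β-increasing : ∀ {k l} → k Fin.< l → SmallerAngle (A ⊖ B) (β k) (β l)
      rays-meet    : ∀ k l → ∃[ z ] OnRay A (α k) z × OnRay B (β l) z
      P            : Fin n → Point
      P-on-α       : ∀ k → OnRay A (α k) (P (π ⟨$⟩ʳ k))
      P-on-β       : ∀ i → OnRay B (β i) (P i)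
      generalPosition : InGeneralPosition (K₂ n) (position A B P)

    geometricGraph : GeometricGraph
    geometricGraph = record
      { Adj             = K₂ n
      ; adj-sym         = K₂-sym
      ; adj-irrefl      = K₂-irrefl
      ; pos             = position A B P
      ; generalPosition = generalPosition
      }

  -- K̄₂,ₙ(π) is determined by π up to geo-isomorphism only, hence the
  -- choice of a realization on each side.
  infix 4 _∼_
  _∼_ : ∀ {n} → Rel (Permutation′ n) (c ⊔ ℓ₁ ⊔ ℓ₃)
  σ ∼ π = Σ[ X ∈ Realization σ ] Σ[ Y ∈ Realization π ]
    GeoIsomorphism (Realization.geometricGraph X) (Realization.geometricGraph Y)

  GeoClass : ∀ {n} → Permutation′ n → Pred (Permutation′ n) (c ⊔ ℓ₁ ⊔ ℓ₃)
  GeoClass π σ = σ ∼ π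

{-# OPTIONS --safe #-}
module Submission where

-- A permutation is a pair of linear orders, and i, j are adjacent in G(π)
-- iff the orders < and π⁻¹ disagree on them.  In a cograph every strong
-- module with more than one element is a 0-node or a 1-node; D orders the
-- children of a 1-node, but not those of a 0-node.  So D ≅ D(σ) iff the
-- trees of π and σ, with the children of every node ordered by <, have the
-- same shape up to rearranging the children of 0-nodes.  A permutation can
-- be read off the ordered shape of its tree, and a rearrangement at a
-- 0-node is a word in the isomorphism types of the children, of which
-- there are k! / (n₁! n₂! ⋯).
--
-- In any realization, the edges aj and bi cross iff (i , j) is an arc, and
-- edges that share an end do not cross.  For n > 2, a geo-isomorphism fixes
-- or exchanges a and b, so it is an isomorphism D(σ) ≅ D(π) or
-- D(σ) ≅ −D(π); for n ≤ 2 there is at most one crossing.  Finally,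
-- D(σ⁻¹) ≅ −D(σ), so that −D represents as many permutations as D, and the
-- two sets are equal or disjoint.
--
-- Realizations exist over every ordered field: a projective map takes the
-- two pencils of rays to the lines with x = U and y = V, and three points
-- are never collinear if the U are at most n and the V are powers of n + 1.

open import Defs using (OrderedField)
open import Level using (Level; 0ℓ)

-- The hypotheses count strong modules and components, that is, subsets, while the formula is a
-- recursion over ordered lists of children. The recursion therefore runs over an inductive tree
-- whose leaves are vertices, and connectivity is expressed by closed properties instead of paths
-- through dependent pairs. Isomorphisms become relations between lists of leaves, which can be
-- inverted and restricted to subtrees at no cost. The tree is found by splitting into components;
-- it is the modular one because a component of a strong module is strong, and a strong module below
-- a node is that node or lies inside one of its children.
--
-- Ordering the children by < makes sense since the components of a node never interleave: a label
-- between two linked ones would settle how these are related, against the link. This order is the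
-- normal form that lets each equivalent shape stand for exactly one permutation.
--
-- In the plane neither equality nor order is assumed decidable. Conditions on angles and sides are
-- kept as positivity of a product of two determinants, and a sign is extracted only from an
-- invertible quantity.

module Drawings {c ℓ₁ ℓ₂ ℓ₃ : Level} (K : OrderedField c ℓ₁ ℓ₂ ℓ₃) where

  open import Algebra.Apartness.Bundles using (HeytingCommutativeRing)
  open import Algebra.Bundles using (CommutativeRing)
  import Algebra.Properties.Ring as RingProperties
  import Algebra.Properties.Semiring.Mult as Mult
  import Algebra.Solver.Ring as Solver
  open import Algebra.Solver.Ring.AlmostCommutativeRing
    using (AlmostCommutativeRing; Induced-equivalence; _-Raw-AlmostCommutative⟶_;
      fromCommutativeRing)
  open import Data.Bool.Base using (Bool; false; true)
  open import Data.Empty using (⊥)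
  open import Data.Fin.Base as Fin using (Fin; toℕ)
  open import Data.Fin.Permutation using (Permutation′; _⟨$⟩ʳ_; _⟨$⟩ˡ_; inverseʳ; inverseˡ)
  import Data.Fin.Properties as FinP
  open import Data.Integer.Base as ℤ using (+_; -[1+_]; ℤ)
  import Data.Integer.Properties as ℤP
  import Data.Integer.Tactic.RingSolver as ℤSolver
  open import Data.Maybe.Base using (just; nothing)
  open import Data.Nat.Base as ℕ using (suc; zero; ℕ)
  import Data.Nat.Properties as ℕP
  open import Data.Product.Base using (_,_; _×_; proj₁; proj₂; ∃-syntax)
  open import Data.Sum.Base using ([_,_]′; _⊎_; inj₁; inj₂)
  open import Defs using (D[_]; K₂; OrderedField; Vertex; module Geometry)
  open import Function.Base using (_∘_)
  open import Function.Bundles using (Equivalence; _⇔_; mk⇔)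
  open import Relation.Binary.Core using (Rel)
  open import Relation.Binary.Definitions using (WeaklyDecidable; tri<; tri>; tri≈)
  import Relation.Binary.PropositionalEquality as ≡
  open import Relation.Binary.Structures using (IsStrictPartialOrder)
  open import Relation.Nullary using (contradiction; no; yes; ¬_)

  open ≡ using (_≡_; _≢_)

  open OrderedField K

  -- Integer coefficients and signs in an ordered field.

  ring : CommutativeRing c ℓ₁
  ring = HeytingCommutativeRing.commutativeRing heytingCommutativeRing

  open CommutativeRing ring using (semiring)
  open RingProperties (CommutativeRing.ring ring) using (-‿distribˡ-*; -‿distribʳ-*; -‿involutive; -0#≈0#; -‿+-comm)
  open Mult semiring using (×1-homo-*; ×-homo-+) renaming (_×_ to _·_)
  open import Relation.Binary.Reasoning.Setoid setoid

  -- The ring solver has to compare coefficients, which is possible in ℤ but not in the field. The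
  -- same map later supplies the integer coordinates of the points in a realization.
  ι : ℤ → Carrier
  ι (+ m)    = m · 1#
  ι -[1+ m ] = - (suc m · 1#)

  ι-neg : ∀ i → ι (ℤ.- i) ≈ - ι i
  ι-neg (+ zero)  = sym -0#≈0#
  ι-neg (+ suc m) = refl
  ι-neg -[1+ m ]  = sym (-‿involutive _)

  ι-⊖ : ∀ m n → ι (m ℤ.⊖ n) ≈ m · 1# - n · 1#
  ι-⊖ zero    zero    = sym (-‿inverseʳ 0#)
  ι-⊖ zero    (suc n) = sym (+-identityˡ _)
  ι-⊖ (suc m) zero    = sym (trans (+-congˡ -0#≈0#) (+-identityʳ _))
  ι-⊖ (suc m) (suc n) = begin
    ι (suc m ℤ.⊖ suc n)              ≡⟨ ≡.cong ι (ℤP.[1+m]⊖[1+n]≡m⊖n m n) ⟩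
    ι (m ℤ.⊖ n)                      ≈⟨ ι-⊖ m n ⟩
    x - y                            ≈⟨ +-congʳ
      (trans (sym (+-identityˡ x)) (+-congʳ (sym (-‿inverseˡ 1#)))) ⟩
    (- 1# + 1# + x) - y              ≈⟨ +-congʳ (trans (+-assoc _ _ _) (+-comm _ _)) ⟩
    (1# + x + - 1#) - y              ≈⟨ +-assoc _ _ _ ⟩
    1# + x + (- 1# - y)              ≈⟨ +-congˡ (-‿+-comm 1# y) ⟩
    1# + x - (1# + y)                ∎
    where
    x = m · 1#
    y = n · 1#

  ι-+ : ∀ i j → ι (i ℤ.+ j) ≈ ι i + ι j
  ι-+ (+ m)    (+ n)    = ×-homo-+ 1# m n
  ι-+ (+ m)    -[1+ n ] = ι-⊖ m (suc n)
  ι-+ -[1+ m ] (+ n)    = trans (ι-⊖ n (suc m)) (+-comm _ _)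
  ι-+ -[1+ m ] -[1+ n ] = begin
    - (suc (suc (m ℕ.+ n)) · 1#)         ≡⟨ ≡.cong (λ k → - (suc k · 1#)) (≡.sym (ℕP.+-suc m n)) ⟩
    - ((suc m ℕ.+ suc n) · 1#)           ≈⟨ -‿cong (×-homo-+ 1# (suc m) (suc n)) ⟩
    - (suc m · 1# + suc n · 1#)          ≈⟨ -‿+-comm _ _ ⟨
    - (suc m · 1#) - suc n · 1#          ∎

  ι-*⁺ : ∀ m j → ι (+ m ℤ.* j) ≈ m · 1# * ι j
  ι-*⁺ m (+ n)    = trans (reflexive (≡.cong ι (≡.sym (ℤP.pos-* m n)))) (×1-homo-* m n)
  ι-*⁺ m -[1+ n ] = begin
    ι (+ m ℤ.* ℤ.- (+ suc n))     ≡⟨ ≡.cong ι (≡.sym (ℤP.neg-distribʳ-* (+ m) (+ suc n))) ⟩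
    ι (ℤ.- (+ m ℤ.* + suc n))     ≈⟨ ι-neg (+ m ℤ.* + suc n) ⟩
    - ι (+ m ℤ.* + suc n)         ≈⟨ -‿cong (ι-*⁺ m (+ suc n)) ⟩
    - (m · 1# * suc n · 1#)       ≈⟨ -‿distribʳ-* _ _ ⟩
    m · 1# * - (suc n · 1#)       ∎

  ι-* : ∀ i j → ι (i ℤ.* j) ≈ ι i * ι j
  ι-* (+ m)    j = ι-*⁺ m j
  ι-* -[1+ m ] j = begin
    ι (ℤ.- (+ suc m) ℤ.* j)       ≡⟨ ≡.cong ι (≡.sym (ℤP.neg-distribˡ-* (+ suc m) j)) ⟩
    ι (ℤ.- (+ suc m ℤ.* j))       ≈⟨ ι-neg (+ suc m ℤ.* j) ⟩
    - ι (+ suc m ℤ.* j)           ≈⟨ -‿cong (ι-*⁺ (suc m) j) ⟩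
    - (suc m · 1# * ι j)          ≈⟨ -‿distribˡ-* _ _ ⟩
    - (suc m · 1#) * ι j          ∎

  ι-1 : ι (+ 1) ≈ 1#
  ι-1 = +-identityʳ 1#

  private
    almostRing : AlmostCommutativeRing c ℓ₁
    almostRing = fromCommutativeRing ring

    coefficients : ℤ.+-*-rawRing -Raw-AlmostCommutative⟶ almostRing
    coefficients = record
      { ⟦_⟧ = ι ; +-homo = ι-+ ; *-homo = ι-* ; -‿homo = ι-neg ; 0-homo = refl ; 1-homo = ι-1 }

    coefficient≟ : WeaklyDecidable (Induced-equivalence coefficients)
    coefficient≟ i j with i ℤP.≟ j
    ... | yes ≡.refl = just refl
    ... | no _       = nothing

  module ℤ-Solver = Solver ℤ.+-*-rawRing almostRing coefficients coefficient≟
  open ℤ-Solver using (solve; _:=_; _:+_; _:*_; _:-_; :-_; con)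

  private module < = IsStrictPartialOrder isStrictPartialOrder

  <-irrefl : ∀ {x y} → x ≈ y → ¬ x < y
  <-irrefl = <.irrefl

  Pos : Carrier → Set ℓ₃
  Pos x = 0# < x

  pos-resp : ∀ {x y} → x ≈ y → Pos x → Pos y
  pos-resp e = <.<-respʳ-≈ e

  neg-zero : ∀ {x} → x ≈ 0# → - x ≈ 0#
  neg-zero e = trans (-‿cong e) -0#≈0#

  pos⇒≉0 : ∀ {x} → Pos x → ¬ x ≈ 0#
  pos⇒≉0 p e = <-irrefl (sym e) p

  <⇒pos : ∀ {x y} → x < y → Pos (y - x)
  <⇒pos {x} p = <.<-respˡ-≈ (-‿inverseʳ x) (+-monoˡ-< (- x) p)

  pos⇒< : ∀ {x y} → Pos (y - x) → x < y
  pos⇒< {x} {y} p = <.<-respˡ-≈ (+-identityˡ x)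
    (<.<-respʳ-≈ (solve 2 (λ x y → (y :- x) :+ x := y) refl x y) (+-monoˡ-< x p))

  pos-+ : ∀ {x y} → Pos x → Pos y → Pos (x + y)
  pos-+ {x} {y} p q = <.trans q (<.<-respˡ-≈ (+-identityˡ y) (+-monoˡ-< y p))

  pos-neg : ∀ {x} → Pos x → ¬ Pos (- x)
  pos-neg {x} p q = <-irrefl refl (pos-resp (-‿inverseʳ x) (pos-+ p q))

  <0⇒pos-neg : ∀ {x} → x < 0# → Pos (- x)
  <0⇒pos-neg p = pos-resp (+-identityˡ _) (<⇒pos p)

  pos⇒#0 : ∀ {x} → Pos x → x # 0#
  pos⇒#0 p = Equivalence.from (#⇔<⊎> _ _) (inj₂ p)

  #0⇒inverse : ∀ {x} → x # 0# → ∃[ y ] y * x ≈ 1#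
  #0⇒inverse {x} h with #⇒invertible h
  ... | y , e , _ = y , trans (*-congˡ (trans (sym (+-identityʳ x)) (+-congˡ (sym -0#≈0#)))) e

  inverse⇒#0 : ∀ {x y} → y * x ≈ 1# → x # 0#
  inverse⇒#0 {x} {y} e =
    invertible⇒# (y , trans (*-congˡ x-0) e , trans (*-congʳ x-0) (trans (*-comm x y) e))
    where
    x-0 : x - 0# ≈ x
    x-0 = trans (+-congˡ -0#≈0#) (+-identityʳ x)

  -- A positive product `x * y` has an inverse `z`, so `z * x` is an inverse of `y`. Hence `y # 0`,
  -- and apartness from 0 splits into the two signs.
  pos*⇒sign : ∀ {x y} → Pos (x * y) → Pos y ⊎ Pos (- y)
  pos*⇒sign {x} {y} p with #0⇒inverse (pos⇒#0 p)
  ... | z , e with Equivalence.to (#⇔<⊎> y 0#) (inverse⇒#0 {y = z * x} (trans (*-assoc z x y) e))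
  ... | inj₁ y<0 = inj₂ (<0⇒pos-neg y<0)
  ... | inj₂ 0<y = inj₁ 0<y

  pos-cancelˡ : ∀ {x y} → Pos x → Pos (x * y) → Pos y
  pos-cancelˡ {x} {y} p q with pos*⇒sign q
  ... | inj₁ r = r
  ... | inj₂ r = contradiction (pos-resp (sym (-‿distribʳ-* x y)) (*-pos p r)) (pos-neg q)

  pos-square : ∀ {x y} → Pos (x * y) → Pos (y * y)
  pos-square {x} {y} p with pos*⇒sign p
  ... | inj₁ q = *-pos q q
  ... | inj₂ q = pos-resp (solve 1 (λ y → (:- y) :* (:- y) := y :* y) refl y) (*-pos q q)

  pos-comm : ∀ {x y} → Pos (x * y) → Pos (y * x)
  pos-comm {x} {y} = pos-resp (*-comm x y)

  -- The hypotheses multiply to y² (x z), and y² is positive and can be cancelled.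
  pos-trans : ∀ {x y z} → Pos (x * y) → Pos (y * z) → Pos (x * z)
  pos-trans {x} {y} {z} p q = pos-cancelˡ (pos-square p)
    (pos-resp (solve 3 (λ x y z → (x :* y) :* (y :* z) := (y :* y) :* (x :* z)) refl x y z)
      (*-pos p q))

  0<1 : Pos 1#
  0<1 with Equivalence.to (#⇔<⊎> 1# 0#) (inverse⇒#0 (*-identityˡ 1#))
  ... | inj₂ p = p
  -- If 1 were negative, then -1 would be positive, and so would its square, which is 1.
  ... | inj₁ p = let q = <0⇒pos-neg p in pos-resp
    (trans (solve 1 (λ y → (:- y) :* (:- y) := y :* y) refl 1#) (*-identityˡ 1#)) (*-pos q q)

  ι-pos : ∀ {m} → 0 ℕ.< m → Pos (ι (+ m))
  ι-pos {suc zero}    _ = pos-resp (sym ι-1) 0<1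
  ι-pos {suc (suc m)} _ = pos-+ 0<1 (ι-pos {suc m} (ℕ.s≤s ℕ.z≤n))

  ι-mono : ∀ {m n} → m ℕ.< n → Pos (ι (+ n) - ι (+ m))
  ι-mono {m} {n} m<n = pos-resp
    (trans (reflexive (≡.cong ι (≡.sym (ℤP.⊖-≥ (ℕP.<⇒≤ m<n))))) (ι-⊖ n m))
      (ι-pos (ℕP.m<n⇒0<n∸m m<n))

  ι-≉0 : ∀ {i} → i ≢ + 0 → ¬ ι i ≈ 0#
  ι-≉0 {+ zero}   i≢0 _ = i≢0 ≡.refl
  ι-≉0 {+ suc m}  _   e = pos⇒≉0 (ι-pos {suc m} (ℕ.s≤s ℕ.z≤n)) e
  ι-≉0 { -[1+ m ]} _  e = pos⇒≉0 (ι-pos {suc m} (ℕ.s≤s ℕ.z≤n))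
    (trans (sym (-‿involutive _)) (trans (-‿cong e) -0#≈0#))

  -- Crossings of segments and general position.

  open Vertex

  open Geometry K
  open ℤ-Solver using (solve; _:=_; _:+_; _:*_; _:-_; :-_; con; Polynomial)

  private
    det′ : ∀ {n} → Polynomial n × Polynomial n → Polynomial n × Polynomial n → Polynomial n
    det′ (x , y) (x′ , y′) = x :* y′ :- y :* x′
    infixl 6 _⊖′_
    _⊖′_ : ∀ {n} → Polynomial n × Polynomial n → Polynomial n × Polynomial n →
      Polynomial n × Polynomial n
    (x , y) ⊖′ (x′ , y′) = x :- x′ , y :- y′

  det-cong : ∀ {p p′ q q′} → p ≈ₚ p′ → q ≈ₚ q′ → det p q ≈ det p′ q′
  det-cong (e , f) (e′ , f′) = +-cong (*-cong e f′) (-‿cong (*-cong f e′))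

  one-minus : ∀ m x → (1# - m) * x ≈ x - m * x
  one-minus m x = trans (solve 3 (λ o m x → (o :- m) :* x := o :* x :- m :* x) refl 1# m x)
    (+-congʳ (*-identityˡ x))

  difference≈0 : ∀ {x y z} → z ≈ x → z ≈ y → x - y ≈ 0#
  difference≈0 {x} {y} e f = trans (+-congʳ (trans (sym e) f)) (-‿inverseʳ y)

  interior-sym : ∀ {p q z} → Interior p q z → Interior q p z
  interior-sym {p} {q} (s , 0<s , s<1 , e , f) = 1# - s , <⇒pos s<1 ,
    pos⇒< (pos-resp (solve 2 (λ o s → s := o :- (o :- s)) refl 1# s) 0<s) ,
    trans e (flipped (proj₁ p) (proj₁ q)) , trans f (flipped (proj₂ p) (proj₂ q))
    where
    flipped : ∀ x y → x + s * (y - x) ≈ y + (1# - s) * (x - y)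
    flipped x y = trans (solve 3 (λ x y s → x :+ s :* (y :- x) :=
      y :+ ((x :- y) :- s :* (x :- y))) refl x y s)
      (+-congˡ (sym (one-minus s (x - y))))

  -- The points P i are seen from A in the order of π⁻¹ i and from B in the
  -- order of i, in both cases on one side of AB.
  module Drawing {n} (π : Permutation′ n) (A B : Point) (P : Fin n → Point)
    (one-side : ∀ i j → Pos (det (B ⊖ A) (P i ⊖ A) * det (B ⊖ A) (P j ⊖ A)))
    (from-A : ∀ {i j} → π ⟨$⟩ˡ i Fin.< π ⟨$⟩ˡ j →
      Pos (det (B ⊖ A) (P i ⊖ A) * det (P i ⊖ A) (P j ⊖ A)))
    (from-B : ∀ {i j} → i Fin.< j →
      Pos (det (B ⊖ A) (P i ⊖ A) * det (P j ⊖ B) (P i ⊖ B)))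
    where

    private
      p q : Fin n → Point
      p i = P i ⊖ A
      q i = P i ⊖ B

      h : Fin n → Carrier
      h i = det (B ⊖ A) (p i)

    det-antisym : ∀ u v x → x * det u v ≈ - (x * det v u)
    det-antisym (u₁ , u₂) (v₁ , v₂) x = solve 5 (λ u₁ u₂ v₁ v₂ x →
      x :* det′ (u₁ , u₂) (v₁ , v₂) := :- (x :* det′ (v₁ , v₂) (u₁ , u₂))) refl u₁ u₂ v₁ v₂ x

    det-self : ∀ u x → x * det u u ≈ 0#
    det-self (u₁ , u₂) x =
      solve 3 (λ u₁ u₂ x → x :* det′ (u₁ , u₂) (u₁ , u₂) := con (+ 0)) refl u₁ u₂ x

    from-A⁻ : ∀ {i j} → Pos (h j * det (p j) (p i)) → π ⟨$⟩ˡ j Fin.< π ⟨$⟩ˡ i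
    from-A⁻ {i} {j} pos with FinP.<-cmp (π ⟨$⟩ˡ j) (π ⟨$⟩ˡ i)
    ... | tri< lt _ _ = lt
    ... | tri≈ _ e _  = contradiction (det-self (p j) (h j))
            (pos⇒≉0 (≡.subst (λ i → Pos (h j * det (p j) (p i))) (injective (≡.sym e)) pos))
      where
      injective : ∀ {x y} → π ⟨$⟩ˡ x ≡ π ⟨$⟩ˡ y → x ≡ y
      injective e = ≡.trans (≡.sym (inverseʳ π)) (≡.trans (≡.cong (π ⟨$⟩ʳ_) e) (inverseʳ π))
    ... | tri> _ _ gt = contradiction
            (pos-resp (det-antisym (p i) (p j) (h j)) (pos-trans (one-side j i) (from-A gt)))
            (pos-neg pos)

    from-B⁻ : ∀ {i j} → Pos (h i * det (q j) (q i)) → i Fin.< j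
    from-B⁻ {i} {j} pos with FinP.<-cmp i j
    ... | tri< lt _ _ = lt
    ... | tri≈ _ ≡.refl _ = contradiction (det-self (q i) (h i)) (pos⇒≉0 pos)
    ... | tri> _ _ gt = contradiction
            (pos-resp (det-antisym (q i) (q j) (h i)) (pos-trans (one-side i j) (from-B gt)))
            (pos-neg pos)

    -- At a common point, l p_j = (1 - m)(B - A) + m p_i. The determinant with p_j gives m det(p_j,
    -- p_i) = (1 - m) h_j, so that det(p_j, p_i) has the sign of h_j, which decides the order seen
    -- from A. The same computation from B decides the order seen from B.
    crossing⇒inversion : ∀ {i j z} → Interior A (P j) z → Interior B (P i) z → D[ π ] i j
    crossing⇒inversion {i} {j} (l , 0<l , l<1 , e₁ , e₂) (m , 0<m , m<1 , f₁ , f₂) =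
      from-B⁻ posB , from-A⁻ posA
      where
      a₁ = proj₁ A ; a₂ = proj₂ A ; b₁ = proj₁ B ; b₂ = proj₂ B
      x₁ = proj₁ (P j) ; x₂ = proj₂ (P j) ; y₁ = proj₁ (P i) ; y₂ = proj₂ (P i)
      -- The difference of the two expressions for the common point. In `eqA` and `eqB` the
      -- polynomial identity holds up to a combination of `E₁` and `E₂`, which vanishes.
      E₁ = (a₁ + l * (x₁ - a₁)) - (b₁ + m * (y₁ - b₁))
      E₂ = (a₂ + l * (x₂ - a₂)) - (b₂ + m * (y₂ - b₂))
      vanish : ∀ u v → E₁ * u - E₂ * v ≈ 0#
      vanish u v = trans (+-cong (trans (*-congʳ (difference≈0 e₁ f₁)) (zeroˡ u))
        (-‿cong (trans (*-congʳ (difference≈0 e₂ f₂)) (zeroˡ v)))) (-‿inverseʳ 0#)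
      eqA : m * det (p j) (p i) ≈ (1# - m) * h j
      eqA = trans (solve 10 (λ a₁ a₂ b₁ b₂ x₁ x₂ y₁ y₂ l m →
          let A = a₁ , a₂ ; B = b₁ , b₂ ; X = x₁ , x₂ ; Y = y₁ , y₂ in
          m :* det′ (X ⊖′ A) (Y ⊖′ A) :=
          (det′ (B ⊖′ A) (X ⊖′ A) :- m :* det′ (B ⊖′ A) (X ⊖′ A)) :+
          (((a₁ :+ l :* (x₁ :- a₁)) :- (b₁ :+ m :* (y₁ :- b₁))) :* (x₂ :- a₂) :-
           ((a₂ :+ l :* (x₂ :- a₂)) :- (b₂ :+ m :* (y₂ :- b₂))) :* (x₁ :- a₁)))
          refl a₁ a₂ b₁ b₂ x₁ x₂ y₁ y₂ l m)
        (trans (+-congˡ (vanish _ _)) (trans (+-identityʳ _) (sym (one-minus m (h j)))))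
      eqB : l * det (q j) (q i) ≈ (1# - l) * h i
      eqB = trans (solve 10 (λ a₁ a₂ b₁ b₂ x₁ x₂ y₁ y₂ l m →
          let A = a₁ , a₂ ; B = b₁ , b₂ ; X = x₁ , x₂ ; Y = y₁ , y₂ in
          l :* det′ (X ⊖′ B) (Y ⊖′ B) :=
          (det′ (B ⊖′ A) (Y ⊖′ A) :- l :* det′ (B ⊖′ A) (Y ⊖′ A)) :+
          (((a₁ :+ l :* (x₁ :- a₁)) :- (b₁ :+ m :* (y₁ :- b₁))) :* (y₂ :- b₂) :-
           ((a₂ :+ l :* (x₂ :- a₂)) :- (b₂ :+ m :* (y₂ :- b₂))) :* (y₁ :- b₁)))
          refl a₁ a₂ b₁ b₂ x₁ x₂ y₁ y₂ l m)
        (trans (+-congˡ (vanish _ _)) (trans (+-identityʳ _) (sym (one-minus l (h i)))))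
      scaled : ∀ {s k x} → Pos s → s < 1# → Pos (k * k) → s * x ≈ (1# - s) * k → Pos (k * x)
      scaled {s} {k} {x} 0<s s<1 0<kk e = pos-cancelˡ 0<s (pos-resp
        (trans (solve 3 (λ o k s → o :* (k :* k) := k :* (o :* k)) refl (1# - s) k s)
          (trans (*-congˡ (sym e)) (solve 3 (λ k s x → k :* (s :* x) := s :* (k :* x)) refl k s x)))
        (*-pos (<⇒pos s<1) 0<kk))
      posA : Pos (h j * det (p j) (p i))
      posA = scaled 0<m m<1 (one-side j j) eqA
      posB : Pos (h i * det (q j) (q i))
      posB = scaled 0<l l<1 (one-side i i) eqB

    -- With W = h j + det (p j) (p i) = h i + det (q j) (q i), the segments
    -- A (P j) and B (P i) meet at the parameters h i / W and h j / W.
    inversion⇒crossing : ∀ {i j} → D[ π ] i j → ∃[ z ] Interior A (P j) z × Interior B (P i) z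
    inversion⇒crossing {i} {j} (i<j , j≺i) = z ,
        (l , byW (pos-resp (*-congˡ W≈) (plus (one-side i i) posB)) ,
         param< (h i) (det (q j) (q i)) (sym W≈) posB
           (pos-resp (*-congˡ W≈) (plus (one-side i i) posB)) , refl , refl) ,
        (m , byW (plus (one-side j j) posA) ,
         param< (h j) (det (p j) (p i)) refl posA (plus (one-side j j) posA) ,
         coordinate₁ , coordinate₂)
      where
      a₁ = proj₁ A ; a₂ = proj₂ A ; b₁ = proj₁ B ; b₂ = proj₂ B
      x₁ = proj₁ (P j) ; x₂ = proj₂ (P j) ; y₁ = proj₁ (P i) ; y₂ = proj₂ (P i)
      posA = from-A j≺i
      posB = from-B i<j
      W = h j + det (p j) (p i)
      W≈ : h i + det (q j) (q i) ≈ W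
      W≈ = solve 8 (λ a₁ a₂ b₁ b₂ x₁ x₂ y₁ y₂ →
        let A = a₁ , a₂ ; B = b₁ , b₂ ; X = x₁ , x₂ ; Y = y₁ , y₂ in
        det′ (B ⊖′ A) (Y ⊖′ A) :+ det′ (X ⊖′ B) (Y ⊖′ B) :=
          det′ (B ⊖′ A) (X ⊖′ A) :+ det′ (X ⊖′ A) (Y ⊖′ A))
        refl a₁ a₂ b₁ b₂ x₁ x₂ y₁ y₂
      plus : ∀ {x y} → Pos (x * x) → Pos (x * y) → Pos (x * (x + y))
      plus {x} {y} r s = pos-resp (sym (distribˡ x x y)) (pos-+ r s)
      -- Only `h j * W` is known to be positive, as the points may lie on either side of AB. It
      -- still gives W a sign, and W is invertible in both cases.
      inverse : ∃[ w ] w * W ≈ 1#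
      inverse = #0⇒inverse W#0
        where
        W#0 : W # 0#
        W#0 with pos*⇒sign (plus (one-side j j) posA)
        ... | inj₁ r = pos⇒#0 r
        ... | inj₂ r = let w , e = #0⇒inverse (pos⇒#0 r) in
          inverse⇒#0 {y = - w} (trans (solve 2 (λ w W → (:- w) :* W := w :* (:- W)) refl w W) e)
      w = proj₁ inverse
      wW = proj₂ inverse
      W*W : Pos (W * W)
      W*W = pos-square (plus (one-side j j) posA)
      byW : ∀ {x} → Pos (x * W) → Pos (x * w)
      byW {x} r = pos-cancelˡ W*W (pos-resp (trans (sym (trans (*-congˡ wW) (*-identityʳ (x * W))))
        (solve 3 (λ x w W → (x :* W) :* (w :* W) := (W :* W) :* (x :* w)) refl x w W)) r)
      l = h i * w
      m = h j * w
      -- 1 - x w = y w, and y has the sign of x and hence that of W.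
      param< : ∀ x y → W ≈ x + y → Pos (x * y) → Pos (x * W) → x * w < 1#
      param< x y e r s = pos⇒< (pos-resp
        (trans (trans (solve 3 (λ x y w → y :* w := w :* (x :+ y) :- x :* w) refl x y w)
          (+-congʳ (*-congˡ (sym e)))) (+-congʳ wW))
        (byW (pos-trans (pos-comm r) s)))
      z : Point
      z = A ⊕ l ⊙ (P j ⊖ A)
      substituted : ∀ s t v → v ≈ w * W * (t - s) → s + v ≈ t
      substituted s t v e = trans (+-congˡ (trans e (trans (*-congʳ wW) (*-identityˡ _))))
        (solve 2 (λ s t → s :+ (t :- s) := t) refl s t)
      coordinate₁ : a₁ + l * (x₁ - a₁) ≈ b₁ + m * (y₁ - b₁)
      coordinate₁ = trans
        (solve 9 (λ a₁ a₂ b₁ b₂ x₁ x₂ y₁ y₂ w →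
          let A = a₁ , a₂ ; B = b₁ , b₂ ; X = x₁ , x₂ ; Y = y₁ , y₂ in
          a₁ :+ (det′ (B ⊖′ A) (Y ⊖′ A) :* w) :* (x₁ :- a₁) :=
          (a₁ :+ w :* (det′ (B ⊖′ A) (X ⊖′ A) :+ det′ (X ⊖′ A) (Y ⊖′ A)) :* (b₁ :- a₁)) :+
          (det′ (B ⊖′ A) (X ⊖′ A) :* w) :* (y₁ :- b₁)) refl a₁ a₂ b₁ b₂ x₁ x₂ y₁ y₂ w)
        (+-congʳ (substituted a₁ b₁ _ refl))
      coordinate₂ : a₂ + l * (x₂ - a₂) ≈ b₂ + m * (y₂ - b₂)
      coordinate₂ = trans
        (solve 9 (λ a₁ a₂ b₁ b₂ x₁ x₂ y₁ y₂ w →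
          let A = a₁ , a₂ ; B = b₁ , b₂ ; X = x₁ , x₂ ; Y = y₁ , y₂ in
          a₂ :+ (det′ (B ⊖′ A) (Y ⊖′ A) :* w) :* (x₂ :- a₂) :=
          (a₂ :+ w :* (det′ (B ⊖′ A) (X ⊖′ A) :+ det′ (X ⊖′ A) (Y ⊖′ A)) :* (b₂ :- a₂)) :+
          (det′ (B ⊖′ A) (X ⊖′ A) :* w) :* (y₂ :- b₂)) refl a₁ a₂ b₁ b₂ x₁ x₂ y₁ y₂ w)
        (+-congʳ (substituted a₂ b₂ _ refl))

    det-A-≉0 : ∀ {i j} → i ≢ j → ¬ det (p i) (p j) ≈ 0#
    det-A-≉0 {i} {j} i≢j e with FinP.<-cmp (π ⟨$⟩ˡ i) (π ⟨$⟩ˡ j)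
    ... | tri< lt _ _ = pos⇒≉0 (from-A lt) (trans (*-congˡ e) (zeroʳ (h i)))
    ... | tri≈ _ e′ _ = i≢j
      (≡.trans (≡.sym (inverseʳ π)) (≡.trans (≡.cong (π ⟨$⟩ʳ_) e′) (inverseʳ π)))
    ... | tri> _ _ gt = pos⇒≉0 (from-A gt) (trans (det-antisym (p j) (p i) (h j))
            (neg-zero (trans (*-congˡ e) (zeroʳ (h j)))))

    det-B-≉0 : ∀ {i j} → i ≢ j → ¬ det (q i) (q j) ≈ 0#
    det-B-≉0 {i} {j} i≢j e with FinP.<-cmp i j
    ... | tri< lt _ _ = pos⇒≉0 (from-B lt) (trans (det-antisym (q j) (q i) (h i))
            (neg-zero (trans (*-congˡ e) (zeroʳ (h i)))))
    ... | tri≈ _ e′ _ = i≢j e′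
    ... | tri> _ _ gt = pos⇒≉0 (from-B gt) (trans (*-congˡ e) (zeroʳ (h j)))

    -- A common point makes the vectors from C proportional, so that `s` times their determinant
    -- vanishes, and `s` is invertible.
    no-common-point : ∀ C {x y z} → ¬ det (x ⊖ C) (y ⊖ C) ≈ 0# → Interior C x z → ¬ Interior C y z
    no-common-point C@(c₁ , c₂) {x@(x₁ , x₂)} {y@(y₁ , y₂)} ≉0 (s , 0<s , _ , e₁ , e₂)
      (t , _ , _ , f₁ , f₂) = ≉0 (
      trans (trans (sym (*-identityˡ _)) (*-congʳ (sym inv)))
        (trans (*-assoc _ s _) (trans (*-congˡ s*det≈0) (zeroʳ _))))
      where
      inverse = #0⇒inverse (pos⇒#0 0<s)
      inv = proj₂ inverse
      E₁ = (c₁ + s * (x₁ - c₁)) - (c₁ + t * (y₁ - c₁))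
      E₂ = (c₂ + s * (x₂ - c₂)) - (c₂ + t * (y₂ - c₂))
      s*det≈0 : s * det (x ⊖ C) (y ⊖ C) ≈ 0#
      s*det≈0 = trans (solve 8 (λ c₁ c₂ x₁ x₂ y₁ y₂ s t →
          s :* det′ ((x₁ , x₂) ⊖′ (c₁ , c₂)) ((y₁ , y₂) ⊖′ (c₁ , c₂)) :=
          ((c₁ :+ s :* (x₁ :- c₁)) :- (c₁ :+ t :* (y₁ :- c₁))) :* (y₂ :- c₂) :-
          ((c₂ :+ s :* (x₂ :- c₂)) :- (c₂ :+ t :* (y₂ :- c₂))) :* (y₁ :- c₁)) refl c₁ c₂ x₁ x₂ y₁ y₂
            s t)
        (trans (+-cong (trans (*-congʳ (difference≈0 e₁ f₁)) (zeroˡ _))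
          (-‿cong (trans (*-congʳ (difference≈0 e₂ f₂)) (zeroˡ _)))) (-‿inverseʳ 0#))

  -- An edge of K₂ₙ: false and true stand for the ends a and b.
  Edge : ℕ → Set
  Edge n = Bool × Fin n

  edge : ∀ {n} (u v : Vertex n) → K₂ n u v → Edge n
  edge a        (leaf i) _ = false , i
  edge b        (leaf i) _ = true , i
  edge (leaf i) a        _ = false , i
  edge (leaf i) b        _ = true , i

  EdgeCrossing : ∀ {n} → Rel (Fin n) 0ℓ → Edge n → Edge n → Set
  EdgeCrossing D (false , j) (true , i)  = D i j
  EdgeCrossing D (true , i)  (false , j) = D i j
  EdgeCrossing D _           _           = ⊥

  module CrossTable {n} (π : Permutation′ n) (A B : Point) (P : Fin n → Point)
    (one-side : ∀ i j → Pos (det (B ⊖ A) (P i ⊖ A) * det (B ⊖ A) (P j ⊖ A)))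
    (from-A : ∀ {i j} → π ⟨$⟩ˡ i Fin.< π ⟨$⟩ˡ j →
      Pos (det (B ⊖ A) (P i ⊖ A) * det (P i ⊖ A) (P j ⊖ A)))
    (from-B : ∀ {i j} → i Fin.< j → Pos (det (B ⊖ A) (P i ⊖ A) * det (P j ⊖ B) (P i ⊖ B)))
    where

    open Drawing π A B P one-side from-A from-B

    private
      pos = position A B P
      Crossing : (u v x y : Vertex n) → Set _
      Crossing u v x y = ∃[ z ] CrossAt (K₂ n) pos u v x y z

      end : Bool → Vertex n
      end false = a
      end true  = b

      Sorted : (u v : Vertex n) → Edge n → Set
      Sorted u v (e , i) = (u ≡ end e × v ≡ leaf i) ⊎ (u ≡ leaf i × v ≡ end e)

      sorted : ∀ u v (k : K₂ n u v) → Sorted u v (edge u v k)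
      sorted a        (leaf i) _ = inj₁ (≡.refl , ≡.refl)
      sorted b        (leaf i) _ = inj₁ (≡.refl , ≡.refl)
      sorted (leaf i) a        _ = inj₂ (≡.refl , ≡.refl)
      sorted (leaf i) b        _ = inj₂ (≡.refl , ≡.refl)

      swap₁ : ∀ {u v x y} → Crossing u v x y → Crossing v u x y
      swap₁ {u} {v} (z , ne , i , j) =
        z , (λ { (inj₁ (p , q)) → ne (inj₂ (q , p)) ; (inj₂ (p , q)) → ne (inj₁ (q , p)) }) ,
        interior-sym {pos u} {pos v} {z} i , j

      swap₂ : ∀ {u v x y} → Crossing u v x y → Crossing u v y x
      swap₂ {x = x} {y} (z , ne , i , j) =
        z , (λ { (inj₁ (p , q)) → ne (inj₂ (p , q)) ; (inj₂ (p , q)) → ne (inj₁ (p , q)) }) ,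
        i , interior-sym {pos x} {pos y} {z} j

      sorted⇒ : ∀ {e i e′ j} → Crossing (end e) (leaf i) (end e′) (leaf j) →
        EdgeCrossing D[ π ] (e , i) (e′ , j)
      sorted⇒ {false} {i} {true} {j} (z , _ , c , c′) = crossing⇒inversion {z = z} c c′
      sorted⇒ {true} {i} {false} {j} (z , _ , c , c′) = crossing⇒inversion {z = z} c′ c
      sorted⇒ {false} {i} {false} {j} (z , ne , c , c′) =
        no-common-point A {P i} {P j} {z} (det-A-≉0 λ { ≡.refl → ne (inj₁ (≡.refl , ≡.refl)) }) c c′
      sorted⇒ {true} {i} {true} {j} (z , ne , c , c′) =
        no-common-point B {P i} {P j} {z} (det-B-≉0 λ { ≡.refl → ne (inj₁ (≡.refl , ≡.refl)) }) c c′

      sorted⇐ : ∀ {e i e′ j} → EdgeCrossing D[ π ] (e , i) (e′ , j) →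
        Crossing (end e) (leaf i) (end e′) (leaf j)
      sorted⇐ {false} {i} {true} {j} d = let z , c , c′ = inversion⇒crossing d in
        z , (λ { (inj₁ (() , _)) ; (inj₂ (() , _)) }) , c , c′
      sorted⇐ {true} {i} {false} {j} d = let z , c , c′ = inversion⇒crossing d in
        z , (λ { (inj₁ (() , _)) ; (inj₂ (() , _)) }) , c′ , c

      reorder : ∀ {u v x y e i e′ j} → Sorted u v (e , i) → Sorted x y (e′ , j) →
        (Crossing u v x y → Crossing (end e) (leaf i) (end e′) (leaf j)) ×
        (Crossing (end e) (leaf i) (end e′) (leaf j) → Crossing u v x y)
      reorder (inj₁ (≡.refl , ≡.refl)) (inj₁ (≡.refl , ≡.refl)) = (λ c → c) , λ c → c
      reorder {u} {v} {x} {y} (inj₁ (≡.refl , ≡.refl)) (inj₂ (≡.refl , ≡.refl)) =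
        swap₂ {u} {v} {x} {y} , swap₂ {u} {v} {y} {x}
      reorder {u} {v} {x} {y} (inj₂ (≡.refl , ≡.refl)) (inj₁ (≡.refl , ≡.refl)) =
        swap₁ {u} {v} {x} {y} , swap₁ {v} {u} {x} {y}
      reorder {u} {v} {x} {y} (inj₂ (≡.refl , ≡.refl)) (inj₂ (≡.refl , ≡.refl)) =
        swap₁ {u} {v} {y} {x} ∘ swap₂ {u} {v} {x} {y} , swap₂ {u} {v} {y} {x} ∘ swap₁ {v} {u} {y}
          {x}

    -- A crossing does not depend on the order in which the ends of an edge are named, so both edges
    -- may be written with a or b first; four cases remain.
    crossing-table : ∀ {u v x y} (k : K₂ n u v) (k′ : K₂ n x y) →
      (∃[ z ] CrossAt (K₂ n) (position A B P) u v x y z) ⇔ EdgeCrossing D[ π ] (edge u v k)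
        (edge x y k′)
    crossing-table {u} {v} {x} {y} k k′ = mk⇔ (sorted⇒ ∘ proj₁ r) (proj₂ r ∘ sorted⇐)
      where r = reorder {u} {v} {x} {y} (sorted u v k) (sorted x y k′)

    -- Two of any three edges share the end a or b and so do not cross. This rules out concurrent
    -- edges wherever the points lie.
    no-three : ∀ (e f g : Edge n) → EdgeCrossing D[ π ] e f → EdgeCrossing D[ π ] f g →
      ¬ EdgeCrossing D[ π ] e g
    no-three (false , _) (true , _)  (false , _) _ _ ()
    no-three (true , _)  (false , _) (true , _)  _ _ ()

    collinear-rotate : ∀ {x y z} → Collinear x y z → Collinear y z x
    collinear-rotate {x₁ , x₂} {y₁ , y₂} {z₁ , z₂} = trans (solve 6 (λ x₁ x₂ y₁ y₂ z₁ z₂ →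
      let X = x₁ , x₂ ; Y = y₁ , y₂ ; Z = z₁ , z₂ in det′ (Z ⊖′ Y) (X ⊖′ Y) := det′ (Y ⊖′ X) (Z ⊖′ X)) refl x₁ x₂ y₁ y₂ z₁ z₂)

    collinear-swap : ∀ {x y z} → Collinear x y z → Collinear x z y
    collinear-swap {x₁ , x₂} {y₁ , y₂} {z₁ , z₂} e = trans (solve 6 (λ x₁ x₂ y₁ y₂ z₁ z₂ →
      let X = x₁ , x₂ ; Y = y₁ , y₂ ; Z = z₁ , z₂ in det′ (Z ⊖′ X) (Y ⊖′ X) := :- det′ (Y ⊖′ X) (Z ⊖′ X)) refl x₁ x₂ y₁ y₂ z₁ z₂)
      (neg-zero e)

    generalPosition : ¬ A ≈ₚ B →
      (∀ {i j k} → i ≢ j → j ≢ k → i ≢ k → ¬ Collinear (P i) (P j) (P k)) →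
      InGeneralPosition (K₂ n) (position A B P)
    generalPosition A≉B P-general = record
      { distinct      = distinct
      ; no-collinear  = λ {u} {v} {w} → no-collinear {u} {v} {w}
      ; no-concurrent = λ {u} {v} {x} {y} {s} {t} k k′ k″ z (c , c′ , c″) →
          no-three (edge u v k) (edge x y k′) (edge s t k″)
            (Equivalence.to (crossing-table k k′) (z , c))
              (Equivalence.to (crossing-table k′ k″) (z , c′))
            (Equivalence.to (crossing-table k k″) (z , c″))
      }
      where
      abi : ∀ i → ¬ Collinear A B (P i)
      abi i e = pos⇒≉0 (one-side i i) (trans (*-congʳ e) (zeroˡ _))
      aij : ∀ {i j} → i ≢ j → ¬ Collinear A (P i) (P j)
      aij i≢j = det-A-≉0 i≢j
      bij : ∀ {i j} → i ≢ j → ¬ Collinear B (P i) (P j)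
      bij i≢j = det-B-≉0 i≢j
      rot : ∀ u v w → Collinear u v w → Collinear v w u
      rot u v w = collinear-rotate {u} {v} {w}
      swp : ∀ u v w → Collinear u v w → Collinear u w v
      swp u v w = collinear-swap {u} {v} {w}
      no-collinear : ∀ {u v w} → u ≢ v → v ≢ w → u ≢ w → ¬ Collinear (pos u) (pos v) (pos w)
      no-collinear {a} {a} {_} p q r = contradiction ≡.refl p
      no-collinear {a} {b} {a} p q r = contradiction ≡.refl r
      no-collinear {a} {b} {b} p q r = contradiction ≡.refl q
      no-collinear {a} {b} {leaf i} p q r = abi i
      no-collinear {a} {leaf i} {a} p q r = contradiction ≡.refl r
      no-collinear {a} {leaf i} {b} p q r = abi i ∘ swp A (P i) B
      no-collinear {a} {leaf i} {leaf j} p q r = aij (q ∘ ≡.cong leaf)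
      no-collinear {b} {b} {_} p q r = contradiction ≡.refl p
      no-collinear {b} {a} {a} p q r = contradiction ≡.refl q
      no-collinear {b} {a} {b} p q r = contradiction ≡.refl r
      no-collinear {b} {a} {leaf i} p q r = abi i ∘ swp A (P i) B ∘ rot B A (P i)
      no-collinear {b} {leaf i} {b} p q r = contradiction ≡.refl r
      no-collinear {b} {leaf i} {a} p q r = abi i ∘ rot (P i) A B ∘ rot B (P i) A
      no-collinear {b} {leaf i} {leaf j} p q r = bij (q ∘ ≡.cong leaf)
      no-collinear {leaf i} {a} {a} p q r = contradiction ≡.refl q
      no-collinear {leaf i} {a} {b} p q r = abi i ∘ rot (P i) A B
      no-collinear {leaf i} {a} {leaf j} p q r = aij (r ∘ ≡.cong leaf ∘ ≡.sym) ∘ rot (P i) A (P j)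
      no-collinear {leaf i} {b} {b} p q r = contradiction ≡.refl q
      no-collinear {leaf i} {b} {a} p q r = abi i ∘ swp A (P i) B ∘ rot B A (P i) ∘ rot (P i) B A
      no-collinear {leaf i} {b} {leaf j} p q r = bij (r ∘ ≡.cong leaf ∘ ≡.sym) ∘ rot (P i) B (P j)
      no-collinear {leaf i} {leaf j} {a} p q r =
        aij (p ∘ ≡.cong leaf) ∘ rot (P j) A (P i) ∘ rot (P i) (P j) A
      no-collinear {leaf i} {leaf j} {b} p q r =
        bij (p ∘ ≡.cong leaf) ∘ rot (P j) B (P i) ∘ rot (P i) (P j) B
      no-collinear {leaf i} {leaf j} {leaf k} p q r =
        P-general (p ∘ ≡.cong leaf) (q ∘ ≡.cong leaf) (r ∘ ≡.cong leaf)
      degenerate : ∀ {x y} w → x ≈ₚ y → Collinear x w y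
      degenerate w (e , f) = trans (+-cong (vanish f) (-‿cong (vanish e))) (-‿inverseʳ 0#)
        where
        vanish : ∀ {x y u} → x ≈ y → u * (y - x) ≈ 0#
        vanish {x} {y} {u} e = trans (*-congˡ (difference≈0 {y} {x} refl (sym e))) (zeroʳ u)
      -- Coinciding vertices would be collinear with any third vertex, so distinctness of all pairs
      -- but A, B reduces to non-collinearity.
      apart : ∀ {u v} w → u ≢ v → u ≢ w → w ≢ v → ¬ pos u ≈ₚ pos v
      apart {u} {v} w u≢v u≢w w≢v e = no-collinear {u} {w} {v} u≢w w≢v u≢v (degenerate (pos w) e)
      distinct : ∀ {u v} → u ≢ v → ¬ pos u ≈ₚ pos v
      distinct {a} {a} u≢v = contradiction ≡.refl u≢v
      distinct {a} {b} u≢v = A≉B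
      distinct {b} {a} u≢v (e , f) = A≉B (sym e , sym f)
      distinct {b} {b} u≢v = contradiction ≡.refl u≢v
      distinct {a} {leaf i} u≢v = apart b u≢v (λ ()) (λ ())
      distinct {b} {leaf i} u≢v = apart a u≢v (λ ()) (λ ())
      distinct {leaf i} {a} u≢v = apart b u≢v (λ ()) (λ ())
      distinct {leaf i} {b} u≢v = apart a u≢v (λ ()) (λ ())
      distinct {leaf i} {leaf j} u≢v = apart a u≢v (λ ()) (λ ())

  -- From rays to determinants, and the existence of realizations.

  module Rays {n} (π : Permutation′ n) (A B : Point) (α β : Fin n → Point) (P : Fin n → Point)
    (same-side : ∀ (k l : Fin n ⊎ Fin n) → SameSide (B ⊖ A) ([ α , β ]′ k) ([ α , β ]′ l))
    (α-increasing : ∀ {k l} → k Fin.< l → SmallerAngle (B ⊖ A) (α k) (α l))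
    (β-increasing : ∀ {k l} → k Fin.< l → SmallerAngle (A ⊖ B) (β k) (β l))
    (P-on-α : ∀ k → OnRay A (α k) (P (π ⟨$⟩ʳ k)))
    (P-on-β : ∀ i → OnRay B (β i) (P i))
    where

    private
      d = B ⊖ A
      p : Fin n → Point
      p i = P i ⊖ A
      q : Fin n → Point
      q i = P i ⊖ B
      α′ : Fin n → Point
      α′ i = α (π ⟨$⟩ˡ i)

      onRay⇒multiple : ∀ {C w z} → OnRay C w z → ∃[ s ] Pos s × z ⊖ C ≈ₚ s ⊙ w
      onRay⇒multiple {C} {w} {z} (s , 0<s , e , f) = s , 0<s , shift e , shift f
        where
        shift : ∀ {x y v} → x ≈ y + v → x - y ≈ v
        shift {x} {y} {v} e = trans (+-congʳ e) (solve 2 (λ y v → (y :+ v) :- y := v) refl y v)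

      onA : ∀ i → ∃[ s ] Pos s × p i ≈ₚ s ⊙ α′ i
      onA i = onRay⇒multiple (≡.subst (λ j → OnRay A (α′ i) (P j)) (inverseʳ π) (P-on-α (π ⟨$⟩ˡ i)))

      onB : ∀ i → ∃[ t ] Pos t × q i ≈ₚ t ⊙ β i
      onB i = onRay⇒multiple (P-on-β i)

      det-scale : ∀ u v s → det u (s ⊙ v) ≈ s * det u v
      det-scale (u₁ , u₂) (v₁ , v₂) s = solve 5 (λ u₁ u₂ v₁ v₂ s →
        u₁ :* (s :* v₂) :- u₂ :* (s :* v₁) := s :* (u₁ :* v₂ :- u₂ :* v₁)) refl u₁ u₂ v₁ v₂ s

      det-scale₂ : ∀ u v s t → det (s ⊙ u) (t ⊙ v) ≈ s * t * det u v
      det-scale₂ (u₁ , u₂) (v₁ , v₂) s t = solve 6 (λ u₁ u₂ v₁ v₂ s t →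
        (s :* u₁) :* (t :* v₂) :- (s :* u₂) :* (t :* v₁) := (s :* t) :* (u₁ :* v₂ :- u₂ :* v₁)) refl
          u₁ u₂ v₁ v₂ s t

      refl₂ : ∀ {x} → x ≈ₚ x
      refl₂ = refl , refl

      height-A : ∀ i → det d (p i) ≈ proj₁ (onA i) * det d (α′ i)
      height-A i = trans (det-cong refl₂ (proj₂ (proj₂ (onA i)))) (det-scale d (α′ i) _)

      -- P i - A and P i - B differ by B - A, so the height of P i over AB can be taken from either
      -- end. This links the conditions at A with those at B.
      height-B : ∀ i → det d (p i) ≈ proj₁ (onB i) * det d (β i)
      height-B i = trans (solve 6 (λ a₁ a₂ b₁ b₂ x₁ x₂ →
          (b₁ :- a₁) :* (x₂ :- a₂) :- (b₂ :- a₂) :* (x₁ :- a₁) :=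
          (b₁ :- a₁) :* (x₂ :- b₂) :- (b₂ :- a₂) :* (x₁ :- b₁))
          refl (proj₁ A) (proj₂ A) (proj₁ B) (proj₂ B) (proj₁ (P i)) (proj₂ (P i)))
        (trans (det-cong refl₂ (proj₂ (proj₂ (onB i)))) (det-scale d (β i) _))

      regroup : ∀ s t x y → (s * t) * (x * y) ≈ (s * x) * (t * y)
      regroup s t x y = solve 4 (λ s t x y → (s :* t) :* (x :* y) :=
        (s :* x) :* (t :* y)) refl s t x y

    one-side : ∀ i j → Pos (det d (p i) * det d (p j))
    one-side i j = pos-resp (trans (regroup _ _ _ _) (sym (*-cong (height-A i) (height-A j))))
      (*-pos (*-pos (proj₁ (proj₂ (onA i))) (proj₁ (proj₂ (onA j)))) (same-side (inj₁ _) (inj₁ _)))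

    from-A : ∀ {i j} → π ⟨$⟩ˡ i Fin.< π ⟨$⟩ˡ j → Pos (det d (p i) * det (p i) (p j))
    from-A {i} {j} lt = pos-resp (trans (regroup _ _ _ _) (sym (*-cong (height-A i)
        (trans (det-cong (proj₂ (proj₂ (onA i))) (proj₂ (proj₂ (onA j)))) (det-scale₂ _ _ _ _)))))
      (*-pos (*-pos 0<s (*-pos 0<s (proj₁ (proj₂ (onA j))))) (α-increasing lt))
      where 0<s = proj₁ (proj₂ (onA i))

    from-B : ∀ {i j} → i Fin.< j → Pos (det d (p i) * det (q j) (q i))
    from-B {i} {j} lt = pos-resp (trans (regroup _ _ _ _) (sym (*-cong (height-B i)
        (trans (det-cong (proj₂ (proj₂ (onB j))) (proj₂ (proj₂ (onB i)))) (det-scale₂ _ _ _ _)))))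
      (*-pos (*-pos 0<s (*-pos (proj₁ (proj₂ (onB j))) 0<s)) (pos-resp
        -- Two sign changes cancel: the base is BA instead of AB, and the two directions are
        -- exchanged.
        (solve 8 (λ a₁ a₂ b₁ b₂ u₁ u₂ v₁ v₂ →
          ((a₁ :- b₁) :* u₂ :- (a₂ :- b₂) :* u₁) :* (u₁ :* v₂ :- u₂ :* v₁) :=
          ((b₁ :- a₁) :* u₂ :- (b₂ :- a₂) :* u₁) :* (v₁ :* u₂ :- v₂ :* u₁))
          refl (proj₁ A) (proj₂ A) (proj₁ B) (proj₂ B) (proj₁ (β i)) (proj₂ (β i)) (proj₁ (β j))
            (proj₂ (β j)))
        (β-increasing lt)))
      where 0<s = proj₁ (proj₂ (onB i))

  -- The determinant of the points (uᵢ , 1 , vᵢ), in which the point with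
  -- uᵢ on the ray from A and vᵢ on the ray from B is a projective image.
  minor : (u₁ u₂ u₃ v₁ v₂ v₃ : ℤ) → ℤ
  minor u₁ u₂ u₃ v₁ v₂ v₃ = (u₂ ℤ.- u₃) ℤ.* v₁ ℤ.+ (u₃ ℤ.- u₁) ℤ.* v₂ ℤ.+ (u₁ ℤ.- u₂) ℤ.* v₃

  -- After division by N ^ e₁, the strictly smallest of the three powers, the minor is congruent to
  -- u₂ - u₃ modulo N; this difference is nonzero and of absolute value less than N.
  minor≢0 : ∀ {N u₁ u₂ u₃ e₁} d₂ d₃ → u₂ ℕ.< N → u₃ ℕ.< N → u₂ ≢ u₃ →
    minor (+ u₁) (+ u₂) (+ u₃) (+ (N ℕ.^ e₁)) (+ (N ℕ.^ (e₁ ℕ.+ suc d₂)))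
      (+ (N ℕ.^ (e₁ ℕ.+ suc d₃))) ≢ + 0
  minor≢0 {N@(suc N′)} {u₁} {u₂} {u₃} {e₁} d₂ d₃ u₂<N u₃<N u₂≢u₃ eq = clash (ℤ.∣ X ∣) ≡.refl
    where
    V = + (N ℕ.^ e₁)
    c₂ = + (N ℕ.^ d₂)
    c₃ = + (N ℕ.^ d₃)
    X = (+ u₃ ℤ.- + u₁) ℤ.* c₂ ℤ.+ (+ u₁ ℤ.- + u₂) ℤ.* c₃
    power : ∀ d → + (N ℕ.^ (e₁ ℕ.+ suc d)) ≡ V ℤ.* (+ N ℤ.* + (N ℕ.^ d))
    power d = ≡.trans (≡.cong +_ (ℕP.^-distribˡ-+-* N e₁ (suc d)))
      (≡.trans (ℤP.pos-* (N ℕ.^ e₁) (N ℕ.* N ℕ.^ d)) (≡.cong (V ℤ.*_) (ℤP.pos-* N (N ℕ.^ d))))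
    factor : ∀ a b c V N s t →
      (b ℤ.- c) ℤ.* V ℤ.+ (c ℤ.- a) ℤ.* (V ℤ.* (N ℤ.* s)) ℤ.+ (a ℤ.- b) ℤ.* (V ℤ.* (N ℤ.* t)) ≡
      V ℤ.* ((b ℤ.- c) ℤ.+ N ℤ.* ((c ℤ.- a) ℤ.* s ℤ.+ (a ℤ.- b) ℤ.* t))
    factor = ℤSolver.solve-∀
    V≢0 : V ≢ + 0
    V≢0 e = ℕP.<⇒≢ (ℕP.m^n>0 N e₁) (≡.sym (ℤP.+-injective e))
    sum≡0 : (+ u₂ ℤ.- + u₃) ℤ.+ + N ℤ.* X ≡ + 0
    sum≡0 with ℤP.i*j≡0⇒i≡0∨j≡0 V (≡.trans (≡.sym (factor (+ u₁) (+ u₂) (+ u₃) V (+ N) c₂ c₃))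
      (≡.trans (≡.cong₂ (λ y z →
        (+ u₂ ℤ.- + u₃) ℤ.* V ℤ.+ (+ u₃ ℤ.- + u₁) ℤ.* y ℤ.+ (+ u₁ ℤ.- + u₂) ℤ.* z)
        (≡.sym (power d₂)) (≡.sym (power d₃))) eq))
    ... | inj₁ e = contradiction e V≢0
    ... | inj₂ e = e
    difference : + u₂ ℤ.- + u₃ ≡ ℤ.- (+ N ℤ.* X)
    difference = ≡.trans (cancel (+ u₂ ℤ.- + u₃) (+ N ℤ.* X))
      (≡.trans (≡.cong (ℤ._- + N ℤ.* X) sum≡0) (ℤP.+-identityˡ _))
      where
      cancel : ∀ x y → x ≡ x ℤ.+ y ℤ.- y
      cancel = ℤSolver.solve-∀
    size : ℤ.∣ + u₂ ℤ.- + u₃ ∣ ≡ N ℕ.* ℤ.∣ X ∣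
    size = ≡.trans (≡.cong ℤ.∣_∣ difference)
      (≡.trans (ℤP.∣-i∣≡∣i∣ (+ N ℤ.* X)) (ℤP.∣i*j∣≡∣i∣*∣j∣ (+ N) X))
    small : ℤ.∣ + u₂ ℤ.- + u₃ ∣ ℕ.< N
    small = ≡.subst (λ i → ℤ.∣ i ∣ ℕ.< N) (≡.sym (ℤP.m-n≡m⊖n u₂ u₃))
      (ℕP.≤-<-trans (ℤP.∣m⊝n∣≤m⊔n u₂ u₃) (ℕP.⊔-lub u₂<N u₃<N))
    clash : ∀ x → ℤ.∣ X ∣ ≡ x → _
    clash zero e = u₂≢u₃ (ℤP.+-injective (ℤP.i-j≡0⇒i≡j (+ u₂) (+ u₃) (ℤP.∣i∣≡0⇒i≡0
      (≡.trans size (≡.trans (≡.cong (N ℕ.*_) e) (ℕP.*-zeroʳ N))))))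
    clash (suc x) e = ℕP.<⇒≱ small
      (ℕP.≤-trans (ℕP.m≤m*n N (suc x)) (ℕP.≤-reflexive (≡.sym (≡.trans size (≡.cong (N ℕ.*_) e)))))

  module Existence {n} (π : Permutation′ n) where

    -- With A = (0 , 0) and B = (1 , 0), the ray from A of parameter u is x = u y, and the ray from
    -- B of parameter v is 1 - x = v y. They meet at height 1 / (u + v), hence the positive values.
    -- Both sequences decrease, since a smaller parameter means a larger angle with the base. The
    -- base n + 1 of the powers exceeds every `U k`, as `minor≢0` requires.
    U V : Fin n → ℕ
    U k = n ℕ.∸ toℕ k
    V l = suc n ℕ.^ (n ℕ.∸ toℕ l)

    private
      u v : Fin n → Carrier
      u k = ι (+ U k)
      v l = ι (+ V l)

    u-pos : ∀ k → Pos (u k)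
    u-pos k = ι-pos (ℕP.m<n⇒0<n∸m (FinP.toℕ<n k))

    v-pos : ∀ l → Pos (v l)
    v-pos l = ι-pos (ℕP.m^n>0 (suc n) (n ℕ.∸ toℕ l))

    U-decreasing : ∀ {k l} → k Fin.< l → U l ℕ.< U k
    U-decreasing {k} {l} lt = ℕP.∸-monoʳ-< lt (ℕP.<⇒≤ (FinP.toℕ<n l))

    V-decreasing : ∀ {k l} → k Fin.< l → V l ℕ.< V k
    V-decreasing {k} {l} lt = ℕP.^-monoʳ-< (suc n) (ℕ.s≤s (ℕP.≤-trans (ℕ.s≤s ℕ.z≤n) (FinP.toℕ<n l)))
      (ℕP.∸-monoʳ-< lt (ℕP.<⇒≤ (FinP.toℕ<n l)))

    height : Fin n → Fin n → Carrier
    height k l = proj₁ (#0⇒inverse (pos⇒#0 (pos-+ (u-pos k) (v-pos l))))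

    height-inverse : ∀ k l → height k l * (u k + v l) ≈ 1#
    height-inverse k l = proj₂ (#0⇒inverse (pos⇒#0 (pos-+ (u-pos k) (v-pos l))))

    height-pos : ∀ k l → Pos (height k l)
    height-pos k l = pos-cancelˡ (pos-+ (u-pos k) (v-pos l))
      (pos-resp (trans (sym (height-inverse k l)) (*-comm _ _)) 0<1)

    A B : Point
    A = 0# , 0#
    B = 1# , 0#

    α β : Fin n → Point
    α k = u k , 1#
    β l = - v l , 1#

    meet : Fin n → Fin n → Point
    meet k l = height k l * u k , height k l

    P : Fin n → Point
    P i = meet (π ⟨$⟩ˡ i) i

    on-α : ∀ k l → OnRay A (α k) (meet k l)
    on-α k l = height k l , height-pos k l , sym (+-identityˡ _) , trans (sym (*-identityʳ _))
      (sym (+-identityˡ _))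

    on-β : ∀ k l → OnRay B (β l) (meet k l)
    on-β k l = height k l , height-pos k l ,
      trans (solve 3 (λ y u v → y :* u := y :* (u :+ v) :+ y :* (:- v)) refl (height k l) (u k)
        (v l)) (+-congʳ (height-inverse k l)) ,
      trans (sym (*-identityʳ _)) (sym (+-identityˡ _))

    det-base : ∀ x → det (B ⊖ A) (x , 1#) ≈ 1#
    det-base x = trans (solve 3 (λ z o x → (o :- z) :* o :- (z :- z) :* x :=
      o :* o :- z :* o) refl 0# 1# x)
      (trans (+-cong (*-identityˡ 1#) (neg-zero (zeroˡ 1#))) (+-identityʳ 1#))

    det-base′ : ∀ x → det (A ⊖ B) (x , 1#) ≈ - 1#
    det-base′ x = trans (solve 3 (λ z o x → (z :- o) :* o :- (z :- z) :* x :=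
      :- ((o :- z) :* o :- (z :- z) :* x)) refl 0# 1# x)
      (-‿cong (det-base x))

    det-pencil : ∀ x y → det (x , 1#) (y , 1#) ≈ x - y
    det-pencil x y = +-cong (*-identityʳ x) (-‿cong (*-identityˡ y))

    same-side : ∀ (k l : Fin n ⊎ Fin n) → SameSide (B ⊖ A) ([ α , β ]′ k) ([ α , β ]′ l)
    same-side k l = pos-resp (sym (trans (*-cong (base k) (base l)) (*-identityˡ 1#))) 0<1
      where
      base : ∀ k → det (B ⊖ A) ([ α , β ]′ k) ≈ 1#
      base (inj₁ k) = det-base (u k)
      base (inj₂ l) = det-base (- v l)

    α-increasing : ∀ {k l} → k Fin.< l → SmallerAngle (B ⊖ A) (α k) (α l)
    α-increasing {k} {l} lt =
      pos-resp (sym (trans (*-cong (det-base (u k)) (det-pencil (u k) (u l))) (*-identityˡ _)))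
      (ι-mono (U-decreasing lt))

    β-increasing : ∀ {k l} → k Fin.< l → SmallerAngle (A ⊖ B) (β k) (β l)
    β-increasing {k} {l} lt =
      pos-resp (sym (trans (*-cong (det-base′ (- v k)) (det-pencil (- v k) (- v l)))
        (trans (solve 3 (λ o x y → (:- o) :* ((:- x) :- (:- y)) :=
          o :* (x :- y)) refl 1# (v k) (v l)) (*-identityˡ _))))
      (ι-mono (V-decreasing lt))

    P-on-α : ∀ k → OnRay A (α k) (P (π ⟨$⟩ʳ k))
    P-on-α k = ≡.subst (λ k′ → OnRay A (α k) (meet k′ (π ⟨$⟩ʳ k))) (≡.sym (inverseˡ π))
      (on-α k (π ⟨$⟩ʳ k))

    P-on-β : ∀ i → OnRay B (β i) (P i)
    P-on-β i = on-β (π ⟨$⟩ˡ i) i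

    ι-minor : ∀ u₁ u₂ u₃ v₁ v₂ v₃ → ι (minor u₁ u₂ u₃ v₁ v₂ v₃) ≈
      (ι u₂ - ι u₃) * ι v₁ + (ι u₃ - ι u₁) * ι v₂ + (ι u₁ - ι u₂) * ι v₃
    ι-minor u₁ u₂ u₃ v₁ v₂ v₃ =
      trans (ι-+ ((u₂ ℤ.- u₃) ℤ.* v₁ ℤ.+ (u₃ ℤ.- u₁) ℤ.* v₂) ((u₁ ℤ.- u₂) ℤ.* v₃))
      (+-cong (trans (ι-+ ((u₂ ℤ.- u₃) ℤ.* v₁) ((u₃ ℤ.- u₁) ℤ.* v₂))
        (+-cong (term u₂ u₃ v₁) (term u₃ u₁ v₂))) (term u₁ u₂ v₃))
      where
      term : ∀ x y z → ι ((x ℤ.- y) ℤ.* z) ≈ (ι x - ι y) * ι z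
      term x y z = trans (ι-* (x ℤ.- y) z) (*-congʳ (trans (ι-+ x (ℤ.- y)) (+-congˡ (ι-neg y))))

    -- The coordinate 1 of the three points is replaced by y * (u + v) = 1,
    -- which makes the determinant homogeneous.
    collinear⇒minor≈0 : ∀ i j k → Collinear (P i) (P j) (P k) →
      ι (minor (+ U (π ⟨$⟩ˡ i)) (+ U (π ⟨$⟩ˡ j)) (+ U (π ⟨$⟩ˡ k)) (+ V i) (+ V j) (+ V k)) ≈ 0#
    collinear⇒minor≈0 i j k e =
      trans (ι-minor (+ U (π ⟨$⟩ˡ i)) (+ U (π ⟨$⟩ˡ j)) (+ U (π ⟨$⟩ˡ k)) (+ V i) (+ V j) (+ V k))
      (trans (sym (trans (*-congˡ ones) (*-identityʳ m)))
      (trans (solve 10 (λ m y₁ y₂ y₃ u₁ u₂ u₃ v₁ v₂ v₃ →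
          m :* ((y₁ :* (u₁ :+ v₁)) :* (y₂ :* (u₂ :+ v₂)) :* (y₃ :* (u₃ :+ v₃))) :=
          (y₁ :* y₂ :* y₃ :* m) :* ((u₁ :+ v₁) :* (u₂ :+ v₂) :* (u₃ :+ v₃)))
          refl m y₁ y₂ y₃ u₁ u₂ u₃ v₁ v₂ v₃)
        (trans (*-congʳ vanishing) (zeroˡ _))))
      where
      u₁ = u (π ⟨$⟩ˡ i) ; u₂ = u (π ⟨$⟩ˡ j) ; u₃ = u (π ⟨$⟩ˡ k)
      v₁ = v i ; v₂ = v j ; v₃ = v k
      y₁ = height (π ⟨$⟩ˡ i) i ; y₂ = height (π ⟨$⟩ˡ j) j ; y₃ = height (π ⟨$⟩ˡ k) k
      o₁ = height-inverse (π ⟨$⟩ˡ i) i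
      o₂ = height-inverse (π ⟨$⟩ˡ j) j
      o₃ = height-inverse (π ⟨$⟩ˡ k) k
      m = (u₂ - u₃) * v₁ + (u₃ - u₁) * v₂ + (u₁ - u₂) * v₃
      ones : y₁ * (u₁ + v₁) * (y₂ * (u₂ + v₂)) * (y₃ * (u₃ + v₃)) ≈ 1#
      ones = trans (*-cong (trans (*-cong o₁ o₂) (*-identityˡ 1#)) o₃) (*-identityˡ 1#)
      vanishing : y₁ * y₂ * y₃ * m ≈ 0#
      vanishing = trans (solve 9 (λ y₁ y₂ y₃ u₁ u₂ u₃ v₁ v₂ v₃ →
          y₁ :* y₂ :* y₃ :* ((u₂ :- u₃) :* v₁ :+ (u₃ :- u₁) :* v₂ :+ (u₁ :- u₂) :* v₃) :=
          ((y₂ :* u₂) :* y₃ :- (y₃ :* u₃) :* y₂) :* (y₁ :* (u₁ :+ v₁)) :+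
          ((y₃ :* u₃) :* y₁ :- (y₁ :* u₁) :* y₃) :* (y₂ :* (u₂ :+ v₂)) :+
          ((y₁ :* u₁) :* y₂ :- (y₂ :* u₂) :* y₁) :* (y₃ :* (u₃ :+ v₃)))
          refl y₁ y₂ y₃ u₁ u₂ u₃ v₁ v₂ v₃)
        (trans (+-cong (+-cong (unit o₁) (unit o₂)) (unit o₃))
        (trans (solve 6 (λ x₁ y₁ x₂ y₂ x₃ y₃ →
          (x₂ :* y₃ :- x₃ :* y₂) :+ (x₃ :* y₁ :- x₁ :* y₃) :+ (x₁ :* y₂ :- x₂ :* y₁) :=
          (x₂ :- x₁) :* (y₃ :- y₁) :- (y₂ :- y₁) :* (x₃ :- x₁)) refl (y₁ * u₁) y₁ (y₂ * u₂) y₂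
            (y₃ * u₃) y₃) e))
        where
        unit : ∀ {x o} → o ≈ 1# → x * o ≈ x
        unit {x} e = trans (*-congˡ e) (*-identityʳ x)

    U<N : ∀ k → U k ℕ.< suc n
    U<N k = ℕ.s≤s (ℕP.m∸n≤m n (toℕ k))

    U-injective : ∀ {k l} → k ≢ l → U k ≢ U l
    U-injective {k} {l} k≢l e with FinP.<-cmp k l
    ... | tri< lt _ _ = ℕP.<⇒≢ (U-decreasing lt) (≡.sym e)
    ... | tri≈ _ e′ _ = k≢l e′
    ... | tri> _ _ gt = ℕP.<⇒≢ (U-decreasing gt) e

    -- The largest label has the smallest power `V`, so it must be in the first place for `minor≢0`;
    -- the two remaining values of `U` are then distinct. Any other triple is rotated into this
    -- form.
    last-noncollinear : ∀ {i j k} → j Fin.< i → k Fin.< i → j ≢ k → ¬ Collinear (P i) (P j) (P k)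
    last-noncollinear {i} {j} {k} j<i k<i j≢k e = ι-≉0 (≡.subst₂
        (λ x y → minor (+ U (π ⟨$⟩ˡ i)) (+ U (π ⟨$⟩ˡ j)) (+ U (π ⟨$⟩ˡ k)) (+ V i) (+ (suc n ℕ.^ x))
          (+ (suc n ℕ.^ y)) ≢ + 0)
        (proj₂ (gap j<i)) (proj₂ (gap k<i))
        (minor≢0 {suc n} {U (π ⟨$⟩ˡ i)} {e₁ = n ℕ.∸ toℕ i} (proj₁ (gap j<i)) (proj₁ (gap k<i))
          (U<N (π ⟨$⟩ˡ j)) (U<N (π ⟨$⟩ˡ k))
          (U-injective (λ e → j≢k
            (≡.trans (≡.sym (inverseʳ π)) (≡.trans (≡.cong (π ⟨$⟩ʳ_) e) (inverseʳ π)))))))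
      (collinear⇒minor≈0 i j k e)
      where
      gap : ∀ {l} → l Fin.< i → ∃[ d ] (n ℕ.∸ toℕ i) ℕ.+ suc d ≡ n ℕ.∸ toℕ l
      gap {l} l<i = let d , e = ℕP.m≤n⇒∃[o]m+o≡n (U-decreasing l<i) in d , ≡.trans (ℕP.+-suc _ d) e

    private
      module R = Rays π A B α β P same-side α-increasing β-increasing P-on-α P-on-β
      module T = CrossTable π A B P R.one-side R.from-A R.from-B

    noncollinear : ∀ {i j k} → i ≢ j → j ≢ k → i ≢ k → ¬ Collinear (P i) (P j) (P k)
    noncollinear {i} {j} {k} i≢j j≢k i≢k c with FinP.<-cmp i j | FinP.<-cmp j k | FinP.<-cmp i k
    ... | tri≈ _ e _  | _ | _ = i≢j e
    ... | _ | tri≈ _ e _  | _ = j≢k e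
    ... | _ | _ | tri≈ _ e _  = i≢k e
    ... | tri> _ _ j<i | _ | tri> _ _ k<i = last-noncollinear j<i k<i j≢k c
    ... | tri< i<j _ _ | tri> _ _ k<j | _ =
      last-noncollinear k<j i<j (i≢k ∘ ≡.sym) (T.collinear-rotate {P i} {P j} {P k} c)
    ... | _ | tri< j<k _ _ | tri< i<k _ _ = last-noncollinear i<k j<k i≢j
        (T.collinear-rotate {P j} {P k} {P i} (T.collinear-rotate {P i} {P j} {P k} c))
    ... | tri> _ _ j<i | tri> _ _ k<j | tri< i<k _ _ =
      contradiction (ℕP.<-trans k<j j<i) (ℕP.<-asym i<k)
    ... | tri< i<j _ _ | tri< j<k _ _ | tri> _ _ k<i =
      contradiction (ℕP.<-trans i<j j<k) (ℕP.<-asym k<i)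

    realization : Realization π
    realization = record
      { A = A ; B = B ; α = α ; β = β
      ; same-side       = same-side
      ; α-increasing    = α-increasing
      ; β-increasing    = β-increasing
      ; rays-meet       = λ k l → meet k l , on-α k l , on-β k l
      ; P               = P
      ; P-on-α          = P-on-α
      ; P-on-β          = P-on-β
      ; generalPosition = T.generalPosition (λ (e , _) → pos⇒≉0 0<1 (sym e))
        (λ {i} {j} {k} → noncollinear {i} {j} {k})
      }

-- Geo-isomorphisms and isomorphisms of digraphs.

module GeoIsomorphisms {c ℓ₁ ℓ₂ ℓ₃ : Level} (K : OrderedField c ℓ₁ ℓ₂ ℓ₃) where

  open import Data.Bool.Base using (Bool; _xor_; false; not; true)
  open import Data.Empty using (⊥; ⊥-elim)
  open import Data.Fin.Base as Fin using (Fin; suc; toℕ; zero)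
  open import Data.Fin.Permutation using (Permutation′)
  import Data.Fin.Properties as FinP
  open import Data.Nat.Base using (_<_; _≤_; suc; s≤s; zero; z≤n; ℕ)
  import Data.Nat.Properties as ℕP
  open import Data.Product.Base using (_,_; _×_; proj₁; proj₂; ∃-syntax)
  open import Data.Unit.Base using (tt)
  open import Defs using (-_; D[_]; K₂; Vertex; _≅_; module Geometry)
  open import Function.Base using (_∘_; id)
  open import Function.Bundles using (Equivalence; _⇔_; mk⇔)
  open import Relation.Binary.Core using (Rel)
  open import Relation.Binary.Morphism.Structures using (IsOrderIsomorphism)
  open import Relation.Binary.PropositionalEquality
  open import Relation.Nullary using (contradiction; no; yes)

  open Drawings K using (Edge; edge; EdgeCrossing; module CrossTable; module Rays; module Existence)
  open Vertex

  open Geometry K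

  cross⇔ : ∀ {n} {σ : Permutation′ n} (X : Realization σ) {u v x y} (k : K₂ n u v) (k′ : K₂ n x y) →
    GeometricGraph.Cross (Realization.geometricGraph X) u v x y ⇔ EdgeCrossing D[ σ ] (edge u v k)
      (edge x y k′)
  cross⇔ {σ = σ} X = CrossTable.crossing-table σ A B P R.one-side R.from-A R.from-B
    where
    open Realization X
    module R = Rays σ A B α β P same-side α-increasing β-increasing P-on-α P-on-β

  end : ∀ {n} → Bool → Vertex n
  end false = a
  end true  = b

  -- `true` stands for a map that exchanges a and b. It takes the edges aj and bi to b f(j) and a
  -- f(i), and these cross for the reverse arc, from f(j) to f(i).
  orient : ∀ {A : Set} → Bool → Rel A 0ℓ → Rel A 0ℓ
  orient false D = D
  orient true  D = - D

  end≢leaf : ∀ {n} s {i : Fin n} → end s ≢ leaf i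
  end≢leaf false ()
  end≢leaf true  ()

  module _ {n : ℕ} (s : Bool) (f : Fin n → Fin n) where

    relabel : Vertex n → Vertex n
    relabel a        = end s
    relabel b        = end (not s)
    relabel (leaf i) = leaf (f i)

    relabel-edge : Edge n → Edge n
    relabel-edge (e , i) = s xor e , f i

  relabel-K₂ : ∀ {n} s (f : Fin n → Fin n) u v → K₂ n u v → K₂ n (relabel s f u) (relabel s f v)
  relabel-K₂ false f a        (leaf i) _ = tt
  relabel-K₂ true  f a        (leaf i) _ = tt
  relabel-K₂ false f b        (leaf i) _ = tt
  relabel-K₂ true  f b        (leaf i) _ = tt
  relabel-K₂ false f (leaf i) a        _ = tt
  relabel-K₂ true  f (leaf i) a        _ = tt
  relabel-K₂ false f (leaf i) b        _ = tt
  relabel-K₂ true  f (leaf i) b        _ = tt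

  relabel-K₂⁻ : ∀ {n} s (f : Fin n → Fin n) u v → K₂ n (relabel s f u) (relabel s f v) → K₂ n u v
  relabel-K₂⁻ s f a (leaf i) _ = tt
  relabel-K₂⁻ s f b (leaf i) _ = tt
  relabel-K₂⁻ s f (leaf i) a _ = tt
  relabel-K₂⁻ s f (leaf i) b _ = tt
  relabel-K₂⁻ false f a a ()
  relabel-K₂⁻ true  f a a ()
  relabel-K₂⁻ false f a b ()
  relabel-K₂⁻ true  f a b ()
  relabel-K₂⁻ false f b a ()
  relabel-K₂⁻ true  f b a ()
  relabel-K₂⁻ false f b b ()
  relabel-K₂⁻ true  f b b ()

  edge-relabel : ∀ {n} s (f : Fin n → Fin n) u v (k : K₂ n u v)
    (k′ : K₂ n (relabel s f u) (relabel s f v)) →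
    edge (relabel s f u) (relabel s f v) k′ ≡ relabel-edge s f (edge u v k)
  edge-relabel false f a        (leaf i) _ _ = refl
  edge-relabel true  f a        (leaf i) _ _ = refl
  edge-relabel false f b        (leaf i) _ _ = refl
  edge-relabel true  f b        (leaf i) _ _ = refl
  edge-relabel false f (leaf i) a        _ _ = refl
  edge-relabel true  f (leaf i) a        _ _ = refl
  edge-relabel false f (leaf i) b        _ _ = refl
  edge-relabel true  f (leaf i) b        _ _ = refl

  module _ {n} {D E : Rel (Fin n) 0ℓ} {f : Fin n → Fin n} where

    edgeCrossing⁺ : ∀ s → (∀ {i j} → D i j → orient s E (f i) (f j)) → ∀ e e′ →
      EdgeCrossing D e e′ → EdgeCrossing E (relabel-edge s f e) (relabel-edge s f e′)
    edgeCrossing⁺ false h (false , j) (true , i)  d = h d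
    edgeCrossing⁺ true  h (false , j) (true , i)  d = h d
    edgeCrossing⁺ false h (true , i)  (false , j) d = h d
    edgeCrossing⁺ true  h (true , i)  (false , j) d = h d

    edgeCrossing⁻ : ∀ s → (∀ {i j} → orient s E (f i) (f j) → D i j) → ∀ e e′ →
      EdgeCrossing E (relabel-edge s f e) (relabel-edge s f e′) → EdgeCrossing D e e′
    edgeCrossing⁻ false h (false , j) (true , i)   d = h d
    edgeCrossing⁻ true  h (false , j) (true , i)   d = h d
    edgeCrossing⁻ false h (true , i)  (false , j)  d = h d
    edgeCrossing⁻ true  h (true , i)  (false , j)  d = h d
    edgeCrossing⁻ false h (false , _) (false , _) ()
    edgeCrossing⁻ true  h (false , _) (false , _) ()
    edgeCrossing⁻ false h (true , _)  (true , _)  ()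
    edgeCrossing⁻ true  h (true , _)  (true , _)  ()

  iso⇒∼ : ∀ {n} {σ π : Permutation′ n} s → D[ σ ] ≅ orient s D[ π ] → σ ∼ π
  iso⇒∼ {n} {σ} {π} s (f , iso) = X , Y , record
    { to         = relabel s f
    ; isGraphIso = record
      { isOrderMonomorphism = record
        { isOrderHomomorphism = record
          { cong = cong (relabel s f) ; mono = λ {u} {v} → relabel-K₂ s f u v }
        ; injective = λ {u} {v} → injective s u v
        ; cancel    = λ {u} {v} → relabel-K₂⁻ s f u v
        }
      ; surjective = surjective s
      }
    ; crossings  = λ {u} {v} {x} {y} k k′ →
        let k₁ = relabel-K₂ s f u v k
            k₂ = relabel-K₂ s f x y k′
            e₁ = edge-relabel s f u v k k₁
            e₂ = edge-relabel s f x y k′ k₂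
        in mk⇔
          (λ c → Equivalence.from (cross⇔ Y k₁ k₂) (subst₂ (EdgeCrossing D[ π ]) (sym e₁) (sym e₂)
            (edgeCrossing⁺ {D = D[ σ ]} {D[ π ]} s I.mono (edge u v k) (edge x y k′)
              (Equivalence.to (cross⇔ X k k′) c))))
          (λ c → Equivalence.from (cross⇔ X k k′)
            (edgeCrossing⁻ {D = D[ σ ]} {D[ π ]} s I.cancel (edge u v k) (edge x y k′)
            (subst₂ (EdgeCrossing D[ π ]) e₁ e₂ (Equivalence.to (cross⇔ Y k₁ k₂) c))))
    }
    where
    module I = IsOrderIsomorphism iso
    X = Existence.realization σ
    Y = Existence.realization π
    leaf-injective : ∀ {n} {i j : Fin n} → leaf i ≡ leaf j → i ≡ j
    leaf-injective refl = refl
    injective : ∀ s u v → relabel s f u ≡ relabel s f v → u ≡ v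
    injective s     a        a        _  = refl
    injective s     b        b        _  = refl
    injective s     (leaf i) (leaf j) e  = cong leaf (I.injective (leaf-injective e))
    injective false a        b        ()
    injective true  a        b        ()
    injective false b        a        ()
    injective true  b        a        ()
    injective false a        (leaf _) ()
    injective true  a        (leaf _) ()
    injective false b        (leaf _) ()
    injective true  b        (leaf _) ()
    injective false (leaf _) a        ()
    injective true  (leaf _) a        ()
    injective false (leaf _) b        ()
    injective true  (leaf _) b        ()
    surjective : ∀ s v → ∃[ u ] ∀ {w} → w ≡ u → relabel s f w ≡ v
    surjective false a        = a , λ { refl → refl }
    surjective true  a        = b , λ { refl → refl }
    surjective false b        = b , λ { refl → refl }
    surjective true  b        = a , λ { refl → refl }
    surjective s     (leaf i) = let j , h = I.surjective i in leaf j , λ { refl → cong leaf (h refl) }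

  edgeCrossing⇒arc : ∀ {n} {D : Rel (Fin n) 0ℓ} e e′ → EdgeCrossing D e e′ → ∃[ i ] ∃[ j ] D i j
  edgeCrossing⇒arc (false , j) (true , i)  d = i , j , d
  edgeCrossing⇒arc (true , i)  (false , j) d = i , j , d

  module _ {n} {σ π : Permutation′ n} (X : Realization σ) (Y : Realization π)
    (geo : GeoIsomorphism (Realization.geometricGraph X) (Realization.geometricGraph Y)) where

    open GeoIsomorphism geo
    private module I = IsOrderIsomorphism isGraphIso

    arc-transport : (∃[ i ] ∃[ j ] D[ σ ] i j) → ∃[ i ] ∃[ j ] D[ π ] i j
    arc-transport (i , j , d) =
      edgeCrossing⇒arc (edge (to a) (to (leaf j)) k) (edge (to b) (to (leaf i)) k′)
      (Equivalence.to (cross⇔ Y k k′)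
        (Equivalence.to (crossings tt tt)
        (Equivalence.from (cross⇔ X {a} {leaf j} {b} {leaf i} tt tt) d)))
      where
      k : K₂ n (to a) (to (leaf j))
      k = I.mono tt
      k′ : K₂ n (to b) (to (leaf i))
      k′ = I.mono tt

    arc-transport⁻ : (∃[ i ] ∃[ j ] D[ π ] i j) → ∃[ i ] ∃[ j ] D[ σ ] i j
    arc-transport⁻ (i , j , d) = edgeCrossing⇒arc (edge u x k) (edge v y k′)
      (Equivalence.to (cross⇔ X k k′) (Equivalence.from (crossings k k′) crossing))
      where
      preimage : ∀ v → ∃[ u ] to u ≡ v
      preimage v = let u , h = I.surjective v in u , h refl
      u = proj₁ (preimage a) ; eu = proj₂ (preimage a)
      v = proj₁ (preimage b) ; ev = proj₂ (preimage b)
      x = proj₁ (preimage (leaf j)) ; ex = proj₂ (preimage (leaf j))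
      y = proj₁ (preimage (leaf i)) ; ey = proj₂ (preimage (leaf i))
      k : K₂ n u x
      k = I.cancel (subst₂ (K₂ n) (sym eu) (sym ex) tt)
      k′ : K₂ n v y
      k′ = I.cancel (subst₂ (K₂ n) (sym ev) (sym ey) tt)
      crossing : GeometricGraph.Cross (Realization.geometricGraph Y) (to u) (to x) (to v) (to y)
      crossing rewrite eu | ev | ex | ey = Equivalence.from (cross⇔ Y {a} {leaf j} {b} {leaf i} tt tt) d

    -- For n = 2 the graph is a 4-cycle, and a geo-isomorphism may take a and b to leaves. But the
    -- only possible arc leads from the first label to the second, so it suffices to transport the
    -- existence of some crossing, and the identity is an isomorphism.
    small⇒iso : n ≤ 2 → D[ σ ] ≅ D[ π ]
    small⇒iso n≤2 = id , record
      { isOrderMonomorphism = record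
        { isOrderHomomorphism = record
          { cong = id
          ; mono = λ {i} {j} d → let i′ , j′ , d′ = arc-transport (i , j , d)
                                 in only {E = D[ π ]} proj₁ d′ (proj₁ d) }
        ; injective = id
        ; cancel = λ {i} {j} d → let i′ , j′ , d′ = arc-transport⁻ (i , j , d)
                                 in only {E = D[ σ ]} proj₁ d′ (proj₁ d)
        }
      ; surjective = λ y → y , id
      }
      where
      first : ∀ {i j : Fin n} → i Fin.< j → toℕ i ≡ 0 × toℕ j ≡ 1
      first {i} {j} i<j = i≡0 , ℕP.≤-antisym j≤1 (ℕP.≤-trans (s≤s z≤n) i<j)
        where
        j≤1 : toℕ j ≤ 1
        j≤1 = ℕP.≤-pred (ℕP.≤-trans (FinP.toℕ<n j) n≤2)
        i≡0 : toℕ i ≡ 0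
        i≡0 = ℕP.n<1⇒n≡0 (ℕP.≤-trans i<j j≤1)
      only : ∀ {E : Rel (Fin n) 0ℓ} → (∀ {i j} → E i j → i Fin.< j) → ∀ {i j i′ j′} → E i′ j′ →
        i Fin.< j → E i j
      only h e lt = let p , q = first lt ; p′ , q′ = first (h e)
                    in subst₂ _ (FinP.toℕ-injective (trans p′ (sym p))) (FinP.toℕ-injective (trans q′ (sym q))) e

    neighbour-of-leaf : ∀ {m} v → K₂ n (leaf m) v → ∃[ e ] v ≡ end e
    neighbour-of-leaf a _ = false , refl
    neighbour-of-leaf b _ = true , refl

    -- If an end went to a leaf, its three or more neighbours would go injectively to the two
    -- neighbours of that leaf.
    end-to-end : 3 ≤ n → ∀ e → ∃[ e′ ] to (end e) ≡ end e′
    end-to-end (s≤s (s≤s (s≤s _))) e with to (end e) in eq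
    ... | a = false , refl
    ... | b = true , refl
    ... | leaf m = ⊥-elim (three (image zero) (image (suc zero)) (image (suc (suc zero))))
      where
      adjacent : ∀ e i → K₂ n (end e) (leaf i)
      adjacent false i = tt
      adjacent true  i = tt
      image : ∀ i → ∃[ e′ ] to (leaf i) ≡ end e′
      image i = neighbour-of-leaf (to (leaf i))
        (subst (λ u → K₂ n u (to (leaf i))) eq (I.mono (adjacent e i)))
      same : ∀ {i j e′} → to (leaf i) ≡ end e′ → to (leaf j) ≡ end e′ → i ≢ j → ⊥
      same {i} {j} p q i≢j with I.injective {leaf i} {leaf j} (trans p (sym q))
      ... | refl = i≢j refl
      three : (∃[ e′ ] to (leaf zero) ≡ end e′) → (∃[ e′ ] to (leaf (suc zero)) ≡ end e′) →
        (∃[ e′ ] to (leaf (suc (suc zero))) ≡ end e′) → ⊥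
      three (false , p) (false , q) _           = same p q λ ()
      three (true , p)  (true , q)  _           = same p q λ ()
      three (false , p) _           (false , q) = same p q λ ()
      three (true , p)  _           (true , q)  = same p q λ ()
      three _           (false , p) (false , q) = same p q λ ()
      three _           (true , p)  (true , q)  = same p q λ ()

    ends⇒iso : ∀ s → to a ≡ end s → to b ≡ end (not s) → D[ σ ] ≅ orient s D[ π ]
    ends⇒iso s ea eb = f , record
      { isOrderMonomorphism = record
        { isOrderHomomorphism = record
          { cong = cong f
          ; mono = λ {i} {j} d → arc s f (to-f j) (to-f i) ea eb
              (Equivalence.to (crossings tt tt)
                (Equivalence.from (cross⇔ X {a} {leaf j} {b} {leaf i} tt tt) d)) }
        ; injective = λ {i} {j} e →
          leaf-injective (I.injective {leaf i} {leaf j}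
          (trans (to-f i) (trans (cong leaf e) (sym (to-f j)))))
        ; cancel = λ {i} {j} d → Equivalence.to (cross⇔ X {a} {leaf j} {b} {leaf i} tt tt)
            (Equivalence.from (crossings tt tt) (arc⁻ s f (to-f j) (to-f i) ea eb d))
        }
      ; surjective = surj
      }
      where
      leaf-injective : ∀ {n} {i j : Fin n} → leaf i ≡ leaf j → i ≡ j
      leaf-injective refl = refl
      neighbour-of-end : ∀ s v → K₂ n (end s) v → ∃[ j ] v ≡ leaf j
      neighbour-of-end false (leaf j) _ = j , refl
      neighbour-of-end true  (leaf j) _ = j , refl
      image : ∀ i → ∃[ j ] to (leaf i) ≡ leaf j
      image i = neighbour-of-end s (to (leaf i)) (subst (λ u → K₂ n u (to (leaf i))) ea (I.mono tt))
      f : Fin n → Fin n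
      f = proj₁ ∘ image
      to-f : ∀ i → to (leaf i) ≡ leaf (f i)
      to-f = proj₂ ∘ image
      CrossY = GeometricGraph.Cross (Realization.geometricGraph Y)
      arc : ∀ s (f : Fin n → Fin n) {i j u v x y} → x ≡ leaf (f j) → y ≡ leaf (f i) → u ≡ end s →
        v ≡ end (not s) →
        CrossY u x v y → orient s D[ π ] (f i) (f j)
      arc false f {i} {j} refl refl refl refl =
        Equivalence.to (cross⇔ Y {a} {leaf (f j)} {b} {leaf (f i)} tt tt)
      arc true  f {i} {j} refl refl refl refl =
        Equivalence.to (cross⇔ Y {b} {leaf (f j)} {a} {leaf (f i)} tt tt)
      arc⁻ : ∀ s (f : Fin n → Fin n) {i j u v x y} → x ≡ leaf (f j) → y ≡ leaf (f i) → u ≡ end s →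
        v ≡ end (not s) →
        orient s D[ π ] (f i) (f j) → CrossY u x v y
      arc⁻ false f {i} {j} refl refl refl refl =
        Equivalence.from (cross⇔ Y {a} {leaf (f j)} {b} {leaf (f i)} tt tt)
      arc⁻ true  f {i} {j} refl refl refl refl =
        Equivalence.from (cross⇔ Y {b} {leaf (f j)} {a} {leaf (f i)} tt tt)
      surj : ∀ y → ∃[ x ] ∀ {z} → z ≡ x → f z ≡ y
      surj y with I.surjective (leaf y)
      ... | leaf x , h = x , λ { refl → leaf-injective (trans (sym (to-f x)) (h refl)) }
      ... | a , h = contradiction (trans (sym ea) (h refl)) (end≢leaf s)
      ... | b , h = contradiction (trans (sym eb) (h refl)) (end≢leaf (not s))

    large⇒iso : 3 ≤ n → ∃[ s ] D[ σ ] ≅ orient s D[ π ]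
    large⇒iso 3≤n = go (proj₁ endA) (proj₁ endB) (proj₂ endA) (proj₂ endB)
      where
      endA = end-to-end 3≤n false
      endB = end-to-end 3≤n true
      go : ∀ s s′ → to a ≡ end s → to b ≡ end s′ → ∃[ s ] D[ σ ] ≅ orient s D[ π ]
      go false false p q with () ← I.injective {a} {b} (trans p (sym q))
      go true  true  p q with () ← I.injective {a} {b} (trans p (sym q))
      go false true  p q = false , ends⇒iso false p q
      go true  false p q = true , ends⇒iso true p q

  ∼⇒iso : ∀ {n} {σ π : Permutation′ n} → σ ∼ π → ∃[ s ] D[ σ ] ≅ orient s D[ π ]
  ∼⇒iso {n} (X , Y , geo) with n ℕP.≤? 2
  ... | yes n≤2 = false , small⇒iso X Y geo n≤2
  ... | no n≰2  = large⇒iso X Y geo (ℕP.≰⇒> n≰2)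

-- Finite listings, words with given letters, and multinomial coefficients.

module Counting where

  open import Data.Fin.Base using (Fin; suc; zero)
  import Data.Fin.Properties as FinP
  open import Data.List.Base
    using (List; []; _++_; _∷_; cartesianProductWith; concat; length; lookup; map; tabulate)
  open import Data.List.Membership.Propositional using (_∈_)
  open import Data.List.Membership.Propositional.Properties
    using (∈-cartesianProductWith⁺; ∈-cartesianProductWith⁻; ∈-concat⁺′; ∈-concat⁻′; ∈-lookup;
      ∈-map⁺; ∈-map⁻; ∈-tabulate⁺; ∈-tabulate⁻; ∈-∃++)
  open import Data.List.Membership.Propositional.Properties.WithK using (unique∧set⇒bag)
  import Data.List.Properties as ListP
  open import Data.List.Relation.Binary.BagAndSetEquality using (∼bag⇒↭)
  open import Data.List.Relation.Binary.Permutation.Propositional as Perm using (_↭_; ↭-sym)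
  open import Data.List.Relation.Binary.Permutation.Propositional.Properties using (shift; ↭-length)
  open import Data.List.Relation.Binary.Pointwise.Base using (Pointwise; []; _∷_)
  open import Data.List.Relation.Unary.All as All using (All; []; _∷_)
  import Data.List.Relation.Unary.All.Properties as AllP
  open import Data.List.Relation.Unary.AllPairs using ([]; _∷_)
  import Data.List.Relation.Unary.AllPairs.Properties as AllPairsP
  open import Data.List.Relation.Unary.Any using (here; there)
  open import Data.List.Relation.Unary.Unique.Propositional using (Unique)
  import Data.List.Relation.Unary.Unique.Propositional.Properties as UniqueP
  open import Data.Nat.Base as ℕ using (_!; _*_; _+_; pred; suc; zero; ℕ)
  import Data.Nat.DivMod as DivMod
  open import Data.Nat.ListAction using (product; sum)
  import Data.Nat.Properties as ℕP
  open import Data.Nat.Tactic.RingSolver using (solve-∀)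
  open import Data.Product.Base using (_,_; _×_; proj₁; proj₂; ∃-syntax)
  open import Defs using (Enumeration; multinomial; ∏; ∏!≢0)
  open import Function.Base using (_∘_)
  open import Function.Bundles using (Bijection; mk⇔)
  open import Level using (Level)
  open import Relation.Binary.Bundles using (Setoid)
  open import Relation.Binary.PropositionalEquality
  open import Relation.Nullary using (contradiction; no; yes)
  open import Relation.Unary using (Pred)

  private variable
    a b c p q : Level
    A : Set a
    B : Set b
    C : Set c

  -- Lists can be concatenated, multiplied and compared up to `_↭_`, unlike the bijections of
  -- `Enumeration`. Two listings of one predicate are permutations of each other, so cardinalities
  -- and products over the listed elements are well defined.
  record Listing {A : Set a} (P : Pred A p) (xs : List A) : Set (a Level.⊔ p) where
    field
      unique   : Unique xs
      sound    : ∀ {x} → x ∈ xs → P x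
      complete : ∀ {x} → P x → x ∈ xs
  open Listing public

  HasCard : {A : Set a} → Pred A p → ℕ → Set _
  HasCard P N = ∃[ xs ] Listing P xs × length xs ≡ N

  listing-↭ : {P : Pred A p} {xs ys : List A} → Listing P xs → Listing P ys → xs ↭ ys
  listing-↭ L M = ∼bag⇒↭ (unique∧set⇒bag (unique L) (unique M)
    (mk⇔ (complete M ∘ sound L) (complete L ∘ sound M)))

  listing-resp : {P : Pred A p} {Q : Pred A q} {xs : List A} →
    (∀ {x} → P x → Q x) → (∀ {x} → Q x → P x) → Listing P xs → Listing Q xs
  listing-resp f g L = record
    { unique = unique L ; sound = f ∘ sound L ; complete = complete L ∘ g }

  card-unique : {P : Pred A p} {M N : ℕ} → HasCard P M → HasCard P N → M ≡ N
  card-unique (_ , L , refl) (_ , L′ , refl) = ↭-length (listing-↭ L L′)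

  module _ {c ℓ} (S : Setoid c ℓ) where
    open Setoid S using (_≈_) renaming (Carrier to X)

    enumeration : ∀ {p} {P : Pred X p} {N : ℕ} (f : Fin N → X) →
      (∀ {i j} → f i ≈ f j → i ≡ j) → (∀ i → P (f i)) →
      (∀ x → P x → ∃[ i ] f i ≈ x) → Enumeration S P N
    enumeration f inj s surj = record
      { to        = λ i → f i , s i
      ; cong      = λ { refl → Setoid.refl S }
      ; bijective = inj , λ (x , px) → proj₁ (surj x px) ,
          λ { refl → proj₂ (surj x px) }
      }

    module _ {p} {P : Pred X p} {N : ℕ} (e : Enumeration S P N) where
      open Bijection e using (to)

      elem : Fin N → X
      elem = proj₁ ∘ to

      elem-injective : ∀ {i j} → elem i ≈ elem j → i ≡ j
      elem-injective = Bijection.injective e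

      elem-sound : ∀ i → P (elem i)
      elem-sound = proj₂ ∘ to

      elem-surjective : ∀ x → P x → ∃[ i ] elem i ≈ x
      elem-surjective x px = let i , h = Bijection.surjective e (x , px) in i , h refl

  enumeration⇒listing : {P : Pred A p} {N : ℕ} (e : Enumeration (setoid A) P N) →
    Listing P (tabulate (elem (setoid A) e))
  enumeration⇒listing {A = A} {P = P} e = record
    { unique   = UniqueP.tabulate⁺ (elem-injective (setoid A) e)
    ; sound    = λ x∈ → let i , eq = ∈-tabulate⁻ x∈ in subst P (sym eq) (elem-sound (setoid A) e i)
    ; complete = λ px → let i , eq = elem-surjective (setoid A) e _ px in
        subst (_∈ _) eq (∈-tabulate⁺ i)
    }

  enumeration⇒card : {P : Pred A p} {N : ℕ} → Enumeration (setoid A) P N → HasCard P N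
  enumeration⇒card e = _ , enumeration⇒listing e , ListP.length-tabulate _

  lookup-injective : {xs : List A} → Unique xs → ∀ i j → lookup xs i ≡ lookup xs j → i ≡ j
  lookup-injective (px ∷ u) zero zero eq = refl
  lookup-injective (px ∷ u) zero (suc j) eq = contradiction eq (All.lookup px (∈-lookup j))
  lookup-injective (px ∷ u) (suc i) zero eq = contradiction (sym eq) (All.lookup px (∈-lookup i))
  lookup-injective (px ∷ u) (suc i) (suc j) eq = cong suc (lookup-injective u i j eq)

  concat-tabulate-unique : ∀ {n} (f : Fin n → List A) → (∀ i → Unique (f i)) →
    (∀ {i j x} → x ∈ f i → x ∈ f j → i ≡ j) → Unique (concat (tabulate f))
  concat-tabulate-unique f u d = UniqueP.concat⁺ (AllP.tabulate⁺ u)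
    (AllPairsP.tabulate⁺ λ i≢j (x∈ , x∈′) → i≢j (d x∈ x∈′))

  length-cartesianProductWith : (f : A → B → C) (xs : List A) (ys : List B) →
    length (cartesianProductWith f xs ys) ≡ length xs * length ys
  length-cartesianProductWith f []       ys = refl
  length-cartesianProductWith f (x ∷ xs) ys = trans (ListP.length-++ (map (f x) ys))
    (cong₂ _+_ (ListP.length-map (f x) ys) (length-cartesianProductWith f xs ys))

  cartesian-card : {R : A → Pred B p} {N : A → ℕ} (xs : List A) →
    All (λ x → HasCard (R x) (N x)) xs →
    HasCard (Pointwise R xs) (product (map N xs))
  cartesian-card [] [] = [] ∷ [] , record
    { unique = [] ∷ [] ; sound = λ { (here refl) → [] } ; complete = λ { [] → here refl } } , refl
  cartesian-card {R = R} (x ∷ xs) ((ys , L , l) ∷ cs) with cartesian-card xs cs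
  ... | zs , L′ , l′ = cartesianProductWith _∷_ ys zs , record
    { unique   = UniqueP.cartesianProductWith⁺ _∷_ ListP.∷-injective (unique L) (unique L′)
    ; sound    = snd
    ; complete = λ { (r ∷ rs) → ∈-cartesianProductWith⁺ _∷_ (complete L r) (complete L′ rs) }
    } , trans (length-cartesianProductWith _∷_ ys zs) (cong₂ _*_ l l′)
    where
    snd : ∀ {v} → v ∈ cartesianProductWith _∷_ ys zs → Pointwise R (x ∷ xs) v
    snd v∈ with ∈-cartesianProductWith⁻ _∷_ ys zs v∈
    ... | _ , _ , y∈ , z∈ , refl = sound L y∈ ∷ sound L′ z∈

  occ : ∀ {t} → Fin t → List (Fin t) → ℕ
  occ j []       = 0
  occ j (x ∷ xs) with j FinP.≟ x
  ... | yes _ = suc (occ j xs)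
  ... | no _  = occ j xs

  ∑ : ∀ {n} → (Fin n → ℕ) → ℕ
  ∑ f = sum (tabulate f)

  ∑-cong : ∀ {n} {f g : Fin n → ℕ} → (∀ i → f i ≡ g i) → ∑ f ≡ ∑ g
  ∑-cong h = cong sum (ListP.tabulate-cong h)

  ∑-*ʳ : ∀ {n} (f : Fin n → ℕ) c → ∑ f * c ≡ ∑ (λ i → f i * c)
  ∑-*ʳ {zero}  f c = refl
  ∑-*ʳ {suc n} f c = trans (ℕP.*-distribʳ-+ c (f zero) _) (cong (f zero * c +_) (∑-*ʳ (f ∘ suc) c))

  ∑-0 : ∀ n → ∑ {n} (λ _ → 0) ≡ 0
  ∑-0 zero    = refl
  ∑-0 (suc n) = ∑-0 n

  ∏-cong : ∀ {n} {f g : Fin n → ℕ} → (∀ i → f i ≡ g i) → ∏ f ≡ ∏ g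
  ∏-cong {zero}  h = refl
  ∏-cong {suc n} h = cong₂ _*_ (h zero) (∏-cong (h ∘ suc))

  length-concat-tabulate : ∀ {n} (f : Fin n → List A) →
    length (concat (tabulate f)) ≡ ∑ (length ∘ f)
  length-concat-tabulate {n = zero}  f = refl
  length-concat-tabulate {n = suc n} f = trans (ListP.length-++ (f zero))
    (cong (length (f zero) +_) (length-concat-tabulate (f ∘ suc)))

  decr : ∀ {t} → Fin t → (Fin t → ℕ) → Fin t → ℕ
  decr j m i with i FinP.≟ j
  ... | yes _ = pred (m i)
  ... | no _  = m i

  ∑-decr : ∀ {t} (m : Fin t → ℕ) j {x} → m j ≡ suc x → ∑ m ≡ suc (∑ (decr j m))
  ∑-decr m zero {x} eq rewrite eq = refl
  ∑-decr m (suc j) eq rewrite ∑-decr (m ∘ suc) j eq =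
    trans (ℕP.+-suc (m zero) _) (cong (λ x → suc (m zero + x)) (∑-cong λ i → lem i))
    where
    lem : ∀ i → decr j (m ∘ suc) i ≡ decr (suc j) m (suc i)
    lem i with i FinP.≟ j
    ... | yes _ = refl
    ... | no _  = refl

  ∏!-decr : ∀ {t} (m : Fin t → ℕ) j {x} → m j ≡ suc x →
    ∏ (λ i → m i !) ≡ m j * ∏ (λ i → decr j m i !)
  ∏!-decr m zero {x} eq rewrite eq = ℕP.*-assoc (suc x) (x !) _
  ∏!-decr m (suc j) eq = trans (cong (m zero ! *_) (trans (∏!-decr (m ∘ suc) j eq)
      (cong (m (suc j) *_) (∏-cong λ i → cong _! (lem i)))))
    (swap (m zero !) (m (suc j)) _)
    where
    lem : ∀ i → decr j (m ∘ suc) i ≡ decr (suc j) m (suc i)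
    lem i with i FinP.≟ j
    ... | yes _ = refl
    ... | no _  = refl
    swap : ∀ x y z → x * (y * z) ≡ y * (x * z)
    swap = solve-∀

  HasContent : ∀ {t} → (Fin t → ℕ) → List (Fin t) → Set
  HasContent m w = ∀ j → occ j w ≡ m j

  -- The last argument is `m j`. When it is 0, no word starts with j; the truncated `pred` in `decr`
  -- would otherwise produce wrong words.
  words-from : ∀ {t} → (m : Fin t → ℕ) (j : Fin t) → List (List (Fin t)) → ℕ → List (List (Fin t))
  words-from m j ws zero    = []
  words-from m j ws (suc _) = map (j ∷_) ws

  words : ∀ {t} (k : ℕ) → (Fin t → ℕ) → List (List (Fin t))
  words zero    m = [] ∷ []
  words (suc k) m = concat (tabulate λ j → words-from m j (words k (decr j m)) (m j))

  occ-same : ∀ {t} (j : Fin t) w → occ j (j ∷ w) ≡ suc (occ j w)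
  occ-same j w with j FinP.≟ j
  ... | yes _ = refl
  ... | no ¬p = contradiction refl ¬p

  content-cons : ∀ {t} (m : Fin t → ℕ) j {x} → m j ≡ suc x → ∀ {w} →
    HasContent (decr j m) w → HasContent m (j ∷ w)
  content-cons m j eq h i with i FinP.≟ j | h i
  ... | yes refl | e = trans (cong suc e) (trans (cong (λ y → suc (pred y)) eq) (sym eq))
  ... | no _     | e = e

  content-tail : ∀ {t} (m : Fin t → ℕ) j {w} → HasContent m (j ∷ w) → HasContent (decr j m) w
  content-tail m j h i with i FinP.≟ j | h i
  ... | yes refl | e = cong pred e
  ... | no _     | e = e

  ∑≡0 : ∀ {n} (m : Fin n → ℕ) → ∑ m ≡ 0 → ∀ i → m i ≡ 0
  ∑≡0 m eq zero    = ℕP.m+n≡0⇒m≡0 (m zero) eq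
  ∑≡0 m eq (suc i) = ∑≡0 (m ∘ suc) (ℕP.m+n≡0⇒n≡0 (m zero) eq) i

  words-listing : ∀ {t} k (m : Fin t → ℕ) → ∑ m ≡ k → Listing (HasContent m) (words k m)
  words-listing zero m eq = record
    { unique = [] ∷ [] ; sound = λ { (here refl) j → sym (∑≡0 m eq j) } ; complete = cmp }
    where
    cmp : ∀ {w} → HasContent m w → w ∈ [] ∷ []
    cmp {[]} h = here refl
    cmp {x ∷ w} h with () ← trans (sym (occ-same x w)) (trans (h x) (∑≡0 m eq x))
  words-listing {t} (suc k) m eq = record
    { unique   = concat-tabulate-unique f uni λ {i} {j} → disj i j
    ; sound    = λ w∈ → let _ , w∈l , l∈ = ∈-concat⁻′ (tabulate f) w∈
                            j , l≡ = ∈-tabulate⁻ l∈ in snd j (subst (_ ∈_) l≡ w∈l)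
    ; complete = cmp
    }
    where
    f : Fin t → List (List (Fin t))
    f j = words-from m j (words k (decr j m)) (m j)
    view : ∀ j {w} → w ∈ f j → ∃[ x ] m j ≡ suc x × ∃[ v ] v ∈ words k (decr j m) × w ≡ j ∷ v
    view j w∈ with m j
    ... | suc x = x , refl , ∈-map⁻ (j ∷_) w∈
    IH : ∀ j {x} → m j ≡ suc x → Listing (HasContent (decr j m)) (words k (decr j m))
    IH j e = words-listing k (decr j m) (ℕP.suc-injective (trans (sym (∑-decr m j e)) eq))
    uni : ∀ j → Unique (f j)
    uni j with m j in e
    ... | zero  = []
    ... | suc x = UniqueP.map⁺ ListP.∷-injectiveʳ (unique (IH j e))
    disj : ∀ i j {x} → x ∈ f i → x ∈ f j → i ≡ j
    disj i j x∈ x∈′ with view i x∈ | view j x∈′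
    ... | _ , _ , _ , _ , refl | _ , _ , _ , _ , refl = refl
    snd : ∀ j {w} → w ∈ f j → HasContent m w
    snd j w∈ with view j w∈
    ... | _ , e , v , v∈ , refl = content-cons m j e (sound (IH j e) v∈)
    cmp : ∀ {w} → HasContent m w → w ∈ concat (tabulate f)
    cmp {[]} h with () ← trans (sym eq) (trans (∑-cong (sym ∘ h)) (∑-0 t))
    cmp {j ∷ w} h = ∈-concat⁺′ w∈ (∈-tabulate⁺ j)
      where
      e : m j ≡ suc (occ j w)
      e = trans (sym (h j)) (occ-same j w)
      w∈ : (j ∷ w) ∈ f j
      w∈ rewrite e = ∈-map⁺ (j ∷_) (complete (IH j e) (content-tail m j h))

  -- The recursion of the multinomial coefficients: a word starts with
  -- some letter j, and m j of the k + 1 letters are equal to j.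
  length-words : ∀ {t} k (m : Fin t → ℕ) → ∑ m ≡ k → length (words k m) * ∏ (λ j → m j !) ≡ k !
  length-words {t} zero m eq = trans (ℕP.+-identityʳ _)
    (trans (∏-cong λ j → cong _! (∑≡0 m eq j)) (∏1 t))
    where
    ∏1 : ∀ n → ∏ {n} (λ _ → 1) ≡ 1
    ∏1 zero    = refl
    ∏1 (suc n) = trans (ℕP.+-identityʳ _) (∏1 n)
  length-words {t} (suc k) m eq = begin
    length (concat (tabulate f)) * M ≡⟨ cong (_* M) (length-concat-tabulate f) ⟩
    ∑ (length ∘ f) * M               ≡⟨ ∑-*ʳ (length ∘ f) M ⟩
    ∑ (λ j → length (f j) * M)       ≡⟨ ∑-cong term ⟩
    ∑ (λ j → m j * k !)              ≡⟨ ∑-*ʳ m (k !) ⟨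
    ∑ m * k !                        ≡⟨ cong (_* k !) eq ⟩
    suc k * k !                      ∎
    where
    open ≡-Reasoning
    f : Fin t → List (List (Fin t))
    f j = words-from m j (words k (decr j m)) (m j)
    M = ∏ (λ j → m j !)
    swap : ∀ x y z → x * (y * z) ≡ y * (x * z)
    swap = solve-∀
    len : ∀ j {x} → m j ≡ suc x → length (f j) ≡ length (words k (decr j m))
    len j e rewrite e = ListP.length-map (j ∷_) (words k (decr j m))
    term : ∀ j → length (f j) * M ≡ m j * k !
    term j with m j in e
    ... | zero  = refl
    ... | suc x = begin
      length (map (j ∷_) W) * M   ≡⟨ cong (_* M) (ListP.length-map (j ∷_) W) ⟩
      length W * M                ≡⟨ cong (length W *_) (∏!-decr m j e) ⟩
      length W * (m j * M′)       ≡⟨ swap (length W) (m j) M′ ⟩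
      m j * (length W * M′)       ≡⟨ cong (m j *_) (length-words k (decr j m)
                                       (ℕP.suc-injective (trans (sym (∑-decr m j e)) eq))) ⟩
      m j * k !                   ≡⟨ cong (_* k !) e ⟩
      suc x * k !                 ∎
      where
      W  = words k (decr j m)
      M′ = ∏ (λ i → decr j m i !)

  words-card : ∀ {t} k (m : Fin t → ℕ) → ∑ m ≡ k → HasCard (HasContent m) (multinomial k m)
  words-card k m eq = words k m , words-listing k m eq , sym (trans
    (cong (λ x → ℕ._/_ x M {{∏!≢0 m}}) (sym (length-words k m eq)))
    (DivMod.m*n/n≡m (length (words k m)) M {{∏!≢0 m}}))
    where M = ∏ (λ j → m j !)

  occ-tail : ∀ {t} (j x : Fin t) {v w} → occ j v ≡ occ j w → occ j (x ∷ v) ≡ occ j (x ∷ w)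
  occ-tail j x e with j FinP.≟ x
  ... | yes _ = cong suc e
  ... | no _  = e

  occ-swap : ∀ {t} (j x y : Fin t) w → occ j (x ∷ y ∷ w) ≡ occ j (y ∷ x ∷ w)
  occ-swap j x y w with j FinP.≟ x in e | j FinP.≟ y in e′
  ... | yes _ | yes _ rewrite e | e′ = refl
  ... | yes _ | no _  rewrite e | e′ = refl
  ... | no _  | yes _ rewrite e | e′ = refl
  ... | no _  | no _  rewrite e | e′ = refl

  occ-↭ : ∀ {t} (j : Fin t) {v w} → v ↭ w → occ j v ≡ occ j w
  occ-↭ j Perm.refl = refl
  occ-↭ j (Perm.prep x p) = occ-tail j x (occ-↭ j p)
  occ-↭ j (Perm.swap {ys = ys} x y p) =
    trans (occ-tail j x (occ-tail j y (occ-↭ j p))) (occ-swap j x y ys)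
  occ-↭ j (Perm.trans p q) = trans (occ-↭ j p) (occ-↭ j q)

  occ>0⇒∈ : ∀ {t} (j : Fin t) w {x} → occ j w ≡ suc x → j ∈ w
  occ>0⇒∈ j (y ∷ w) e with j FinP.≟ y
  ... | yes p = here p
  ... | no _  = there (occ>0⇒∈ j w e)

  content⇒↭ : ∀ {t} (v w : List (Fin t)) → (∀ j → occ j v ≡ occ j w) → v ↭ w
  content⇒↭ [] [] h = Perm.refl
  content⇒↭ [] (x ∷ w) h with () ← trans (h x) (occ-same x w)
  content⇒↭ (x ∷ v) w h with ∈-∃++ (occ>0⇒∈ x w (trans (sym (h x)) (occ-same x v)))
  ... | w₁ , w₂ , refl = Perm.↭-trans (Perm.prep x (content⇒↭ v (w₁ ++ w₂) h′)) (↭-sym sh)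
    where
    sh = shift x w₁ w₂
    h′ : ∀ j → occ j v ≡ occ j (w₁ ++ w₂)
    h′ j with trans (h j) (occ-↭ j sh)
    ... | e with j FinP.≟ x
    ... | yes _ = ℕP.suc-injective e
    ... | no _  = e

  ∑-suc : ∀ {n} (f g : Fin n → ℕ) (x : Fin n) → f x ≡ suc (g x) → (∀ j → j ≢ x → f j ≡ g j) →
    ∑ f ≡ suc (∑ g)
  ∑-suc f g zero e₀ h = cong₂ _+_ e₀ (∑-cong {f = f ∘ suc} {g ∘ suc} λ j → h (suc j) λ ())
  ∑-suc f g (suc x) e₀ h = trans (cong₂ _+_ (h zero λ ()) (∑-suc (f ∘ suc) (g ∘ suc) x e₀
    λ j j≢ → h (suc j) (j≢ ∘ FinP.suc-injective))) (ℕP.+-suc (g zero) _)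

  occ-other : ∀ {t} {j x : Fin t} w → j ≢ x → occ j (x ∷ w) ≡ occ j w
  occ-other {j = j} {x} w j≢x with j FinP.≟ x
  ... | yes p = contradiction p j≢x
  ... | no _  = refl

  ∑-occ : ∀ {t} (w : List (Fin t)) → ∑ (λ j → occ j w) ≡ length w
  ∑-occ {t} []  = ∑-0 t
  ∑-occ (x ∷ w) = trans (∑-suc _ (λ j → occ j w) x (occ-same x w) λ j → occ-other w)
    (cong suc (∑-occ w))

  ↭-card : ∀ {t} k (w : List (Fin t)) (m : Fin t → ℕ) → length w ≡ k → (∀ j → occ j w ≡ m j) →
    HasCard (_↭ w) (multinomial k m)
  ↭-card {t} k w m len e with words-card k m (trans (∑-cong (sym ∘ e)) (trans (∑-occ w) len))
  ... | ws , L , l = ws , listing-resp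
    (λ {v} h → content⇒↭ v w λ j → trans (h j) (sym (e j)))
    (λ p j → trans (occ-↭ j p) (e j)) L , l

open Counting

open import Data.Bool.Base using (Bool; false; not; true)
import Data.Bool.Properties as BoolP
open import Data.Empty using (⊥; ⊥-elim)
open import Data.Fin.Base as Fin using (Fin; _↑ʳ_; _↑ˡ_; inject₁; splitAt; suc; toℕ; zero)
open import Data.Fin.Permutation as FPerm
  using (Permutation′; _∘ₚ_; _⟨$⟩ʳ_; _⟨$⟩ˡ_; cast-id; inverseʳ; inverseˡ; permutation)
import Data.Fin.Properties as FinP
open import Data.Fin.Subset as Sub using (Nonempty; Subset; _⊆_; inside; ⁅_⁆; ∣_∣)
import Data.Fin.Subset.Properties as SubP
open import Data.List.Base
  using (List; []; _++_; _∷_; allFin; concat; drop; length; lookup; map; tabulate; take)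
import Data.List.Membership.DecPropositional as DecMem
open import Data.List.Membership.Propositional using (_∈_; _∉_; find; lose)
open import Data.List.Membership.Propositional.Properties
  using (∈-++⁺ʳ; ∈-++⁺ˡ; ∈-++⁻; ∈-allFin; ∈-concat⁺′; ∈-concat⁻′; ∈-lookup; ∈-map⁺; ∈-map⁻; ∈-∃++)
import Data.List.Properties as ListP
open import Data.List.Relation.Binary.Permutation.Propositional as Perm using (_↭_; ↭-sym; ↭-trans)
open import Data.List.Relation.Binary.Permutation.Propositional.Properties as PermP
  using (++-comm; ++⁺; ++⁺ˡ; All-resp-↭; shift; shifts; ↭-length; ↭-map-inv; ∈-resp-↭)
open import Data.List.Relation.Binary.Pointwise.Base using (Pointwise; []; _∷_)
open import Data.List.Relation.Unary.All as All using (All; []; _∷_)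
import Data.List.Relation.Unary.All.Properties as AllP
open import Data.List.Relation.Unary.AllPairs as AllPairs using (AllPairs; []; _∷_)
import Data.List.Relation.Unary.AllPairs.Properties as AllPairsP
open import Data.List.Relation.Unary.Any as Any using (Any; here; there)
import Data.List.Relation.Unary.Any.Properties as AnyP
open import Data.List.Relation.Unary.Unique.Propositional using (Unique)
import Data.List.Relation.Unary.Unique.Propositional.Properties as UniqueP
open import Data.Nat.Base as ℕ using (_*_; _+_; _<_; _∸_; _≤_; suc; s≤s; zero; z≤n; ℕ)
open import Data.Nat.ListAction using (product)
import Data.Nat.ListAction.Properties as ActP
import Data.Nat.Properties as ℕP
open import Data.Product.Base using (_,_; _×_; proj₁; proj₂; Σ-syntax; ∃; ∃-syntax)
open import Data.Sum.Base as Sum using ([_,_]′; _⊎_; inj₁; inj₂)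
open import Data.Unit.Base using (tt; ⊤)
import Data.Vec.Base as Vec
import Data.Vec.Properties as VecP
open import Defs
  using (-_; Child; Connected; D[_]; Enumeration; G[_]; IsCograph; IsComponent; IsModule; IsNode;
    IsStrong; IsoClasses; OneNode; OrderedField; Overlap; Represents; Subsets; Sym; ZeroNode; _ᶜ;
    _↾_; _≅_; module Geometry; multinomial; ofOne; ofPrime; ofZero; ∏)
open import Function.Base using (_on_; _∘_; case_of_; const; flip; id)
open import Function.Bundles using (Bijection; Equivalence; mk⇔)
open import Relation.Binary.Bundles using (Setoid)
open import Relation.Binary.Construct.Closure.ReflexiveTransitive using (Star; _◅_; _◅◅_; ε)
open import Relation.Binary.Construct.Closure.Symmetric using (bwd; fwd)
open import Relation.Binary.Core using (Rel)
open import Relation.Binary.Definitions using (Transitive; tri<; tri>; tri≈)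
import Relation.Binary.Morphism.Construct.Composition as Compose
open import Relation.Binary.Morphism.Structures using (IsOrderIsomorphism)
open import Relation.Binary.PropositionalEquality
open import Relation.Nullary using (Dec; contradiction; does; no; yes; ¬_)
open import Relation.Nullary.Decidable using (_×-dec_; _⊎-dec_; dec-true; decidable-stable; ¬?)
open import Relation.Unary using (Pred)

-- Lists up to permutation; trees and their shapes.

private variable
  ℓ ℓ′ : Level
  A B : Set

module _ {A : Set ℓ} {R : Rel A ℓ′} where

  allPairs-++ˡ : ∀ xs {ys} → AllPairs R (xs ++ ys) → AllPairs R xs
  allPairs-++ˡ []       _       = []
  allPairs-++ˡ (x ∷ xs) (p ∷ q) = AllP.++⁻ˡ xs p ∷ allPairs-++ˡ xs q

  allPairs-++ʳ : ∀ xs {ys} → AllPairs R (xs ++ ys) → AllPairs R ys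
  allPairs-++ʳ []       p       = p
  allPairs-++ʳ (x ∷ xs) (p ∷ q) = allPairs-++ʳ xs q

  allPairs-++-cross : ∀ xs {ys} → AllPairs R (xs ++ ys) → ∀ {x y} → x ∈ xs → y ∈ ys → R x y
  allPairs-++-cross (x ∷ xs) (p ∷ q) (here refl) y∈ = All.lookup p (∈-++⁺ʳ xs y∈)
  allPairs-++-cross (x ∷ xs) (p ∷ q) (there x∈)  y∈ = allPairs-++-cross xs q x∈ y∈

  allPairs-delete : ∀ xs {y ys} → AllPairs R (xs ++ y ∷ ys) → AllPairs R (xs ++ ys)
  allPairs-delete []       (p ∷ q) = q
  allPairs-delete (x ∷ xs) (p ∷ q) with AllP.++⁻ˡ xs p | AllP.++⁻ʳ xs p
  ... | l | _ ∷ r = AllP.++⁺ l r ∷ allPairs-delete xs q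

  allPairs-++⁺ : ∀ xs {ys} → AllPairs R xs → AllPairs R ys → (∀ {x y} → x ∈ xs → y ∈ ys → R x y) →
    AllPairs R (xs ++ ys)
  allPairs-++⁺ []       _       q h = q
  allPairs-++⁺ (x ∷ xs) (p ∷ p′) q h =
    AllP.++⁺ p (All.tabulate (h (here refl))) ∷ allPairs-++⁺ xs p′ q (h ∘ there)

  allPairs-↭ : (∀ {x y} → R x y → R y x) → ∀ {xs ys} → xs ↭ ys → AllPairs R xs → AllPairs R ys
  allPairs-↭ sm Perm.refl           r                  = r
  allPairs-↭ sm (Perm.prep x p)     (a ∷ r)            = All-resp-↭ p a ∷ allPairs-↭ sm p r
  allPairs-↭ sm (Perm.swap x y p)   ((a ∷ b) ∷ c ∷ r)  =
    (sm a ∷ All-resp-↭ p c) ∷ All-resp-↭ p b ∷ allPairs-↭ sm p r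
  allPairs-↭ sm (Perm.trans p q)    r                  = allPairs-↭ sm q (allPairs-↭ sm p r)

module _ {a b r} {A : Set a} {B : Set b} {R : A → B → Set r} where

  pointwise-↭ : ∀ {xs xs′ ys} → xs ↭ xs′ → Pointwise R xs′ ys →
    ∃[ ys′ ] Pointwise R xs ys′ × ys′ ↭ ys
  pointwise-↭ Perm.refl         r           = _ , r , Perm.refl
  pointwise-↭ (Perm.prep x p)   (r ∷ rs)    = let _ , rs′ , q = pointwise-↭ p rs in
    _ , r ∷ rs′ , Perm.prep _ q
  pointwise-↭ (Perm.swap x y p) (r ∷ s ∷ t) = let _ , t′ , q = pointwise-↭ p t in
    _ , s ∷ r ∷ t′ , Perm.swap _ _ q
  pointwise-↭ (Perm.trans p q)  r           =
    let _ , r′ , q′ = pointwise-↭ q r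
        _ , r″ , p′ = pointwise-↭ p r′
    in _ , r″ , Perm.trans p′ q′

  pointwise-↭ʳ : ∀ {xs ys ys′} → Pointwise R xs ys → ys ↭ ys′ →
    ∃[ xs′ ] xs ↭ xs′ × Pointwise R xs′ ys′
  pointwise-↭ʳ r           Perm.refl         = _ , Perm.refl , r
  pointwise-↭ʳ (r ∷ rs)    (Perm.prep x p)   = let _ , q , rs′ = pointwise-↭ʳ rs p in
    _ , Perm.prep _ q , r ∷ rs′
  pointwise-↭ʳ (r ∷ s ∷ t) (Perm.swap x y p) = let _ , q , t′ = pointwise-↭ʳ t p in
    _ , Perm.swap _ _ q , s ∷ r ∷ t′
  pointwise-↭ʳ r           (Perm.trans p q)  =
    let _ , p′ , r′ = pointwise-↭ʳ r p
        _ , q′ , r″ = pointwise-↭ʳ r′ q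
    in _ , Perm.trans p′ q′ , r″

-- The modular decomposition tree of a cograph; node true and node false
-- are the degenerate 1-nodes and 0-nodes.
data Tree (A : Set) : Set where
  leaf : A → Tree A
  node : Bool → List (Tree A) → Tree A

leaves  : Tree A → List A
leavesF : List (Tree A) → List A
leaves (leaf x)    = x ∷ []
leaves (node b ts) = leavesF ts
leavesF []       = []
leavesF (t ∷ ts) = leaves t ++ leavesF ts

mapT : (A → B) → Tree A → Tree B
mapF : (A → B) → List (Tree A) → List (Tree B)
mapT f (leaf x)    = leaf (f x)
mapT f (node b ts) = node b (mapF f ts)
mapF f []       = []
mapF f (t ∷ ts) = mapT f t ∷ mapF f ts

Shape : Set
Shape = Tree ⊤

shape : Tree A → Shape
shape = mapT (const tt)

shapes : List (Tree A) → List Shape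
shapes = mapF (const tt)

mapF≡map : (f : A → B) (ts : List (Tree A)) → mapF f ts ≡ map (mapT f) ts
mapF≡map f []       = refl
mapF≡map f (t ∷ ts) = cong (mapT f t ∷_) (mapF≡map f ts)

leaves-mapT : (f : A → B) (t : Tree A) → leaves (mapT f t) ≡ map f (leaves t)
leaves-mapF : (f : A → B) (ts : List (Tree A)) → leavesF (mapF f ts) ≡ map f (leavesF ts)
leaves-mapT f (leaf x)    = refl
leaves-mapT f (node b ts) = leaves-mapF f ts
leaves-mapF f []       = refl
leaves-mapF f (t ∷ ts) = trans (cong₂ _++_ (leaves-mapT f t) (leaves-mapF f ts))
  (sym (ListP.map-++ f (leaves t) (leavesF ts)))

shape-mapT : (f : A → B) (t : Tree A) → shape (mapT f t) ≡ shape t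
shape-mapF : (f : A → B) (ts : List (Tree A)) → shapes (mapF f ts) ≡ shapes ts
shape-mapT f (leaf x)    = refl
shape-mapT f (node b ts) = cong (node b) (shape-mapF f ts)
shape-mapF f []       = refl
shape-mapF f (t ∷ ts) = cong₂ _∷_ (shape-mapT f t) (shape-mapF f ts)

leavesF-↭ : {ts us : List (Tree A)} → ts ↭ us → leavesF ts ↭ leavesF us
leavesF-↭ Perm.refl = Perm.refl
leavesF-↭ (Perm.prep t p) = ++⁺ˡ (leaves t) (leavesF-↭ p)
leavesF-↭ (Perm.swap {ys = ys} t u p) = ↭-trans (++⁺ˡ (leaves t) (++⁺ˡ (leaves u) (leavesF-↭ p)))
  (shifts (leaves t) (leaves u))
leavesF-↭ (Perm.trans p q) = Perm.trans (leavesF-↭ p) (leavesF-↭ q)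

shapes-↭ : {ts us : List (Tree A)} → ts ↭ us → shapes ts ↭ shapes us
shapes-↭ Perm.refl         = Perm.refl
shapes-↭ (Perm.prep t p)   = Perm.prep _ (shapes-↭ p)
shapes-↭ (Perm.swap t u p) = Perm.swap _ _ (shapes-↭ p)
shapes-↭ (Perm.trans p q)  = Perm.trans (shapes-↭ p) (shapes-↭ q)

∈-leavesF⁺ : {ts : List (Tree A)} {t : Tree A} {x : A} → t ∈ ts → x ∈ leaves t → x ∈ leavesF ts
∈-leavesF⁺ (here refl)           x∈ = ∈-++⁺ˡ x∈
∈-leavesF⁺ {ts = t ∷ _} (there t∈) x∈ = ∈-++⁺ʳ (leaves t) (∈-leavesF⁺ t∈ x∈)

∈-leavesF⁻ : (ts : List (Tree A)) {x : A} → x ∈ leavesF ts → ∃[ t ] t ∈ ts × x ∈ leaves t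
∈-leavesF⁻ (t ∷ ts) x∈ with ∈-++⁻ (leaves t) x∈
... | inj₁ x∈t  = t , here refl , x∈t
... | inj₂ x∈ts = let u , u∈ , x∈u = ∈-leavesF⁻ ts x∈ts in u , there u∈ , x∈u

∈-delete : (ts : List (Tree A)) {t : Tree A} {us : List (Tree A)} {x : A} →
  x ∈ leavesF (ts ++ t ∷ us) → x ∈ leaves t ⊎ x ∈ leavesF (ts ++ us)
∈-delete ts {t} {us} x∈ = ∈-++⁻ (leaves t) (∈-resp-↭ (leavesF-↭ (shift t ts us)) x∈)

∈-insert : (ts : List (Tree A)) {t : Tree A} {us : List (Tree A)} {x : A} →
  x ∈ leaves t ⊎ x ∈ leavesF (ts ++ us) → x ∈ leavesF (ts ++ t ∷ us)
∈-insert ts {t} {us} x∈ = ∈-resp-↭ (↭-sym (leavesF-↭ (shift t ts us)))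
  (Sum.[ ∈-++⁺ˡ , ∈-++⁺ʳ (leaves t) ]′ x∈)

RootNot : Bool → Tree A → Set
RootNot b (leaf _)    = ⊤
RootNot b (node b′ _) = b ≢ b′

-- At least two children at every node and alternating colours; without these conditions, trees of
-- inequivalent shapes would describe the same digraph.
data Proper {A : Set} : Tree A → Set where
  leaf : ∀ {x} → Proper (leaf x)
  node : ∀ {b ts} → 2 ≤ length ts → All (λ t → RootNot b t × Proper t) ts → Proper (node b ts)

nonempty : {t : Tree A} → Proper t → ∃[ x ] x ∈ leaves t
nonempty leaf = _ , here refl
nonempty (node {ts = t ∷ _} _ ((_ , p) ∷ _)) = let x , x∈ = nonempty p in x , ∈-++⁺ˡ x∈

-- Equality of shapes up to rearranging the children of nodes false,
-- unless o, when no rearrangement is allowed.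
Arrangement : Bool → Bool → Rel (List Shape) 0ℓ
Arrangement false false = _↭_
Arrangement false true  = _≡_
Arrangement true  _     = _≡_

infix 4 _≈[_]_
-- The children are first replaced one by one and then rearranged, which keeps the relation
-- structurally recursive. The price is that symmetry and transitivity have to move a rearrangement
-- past a pointwise relation. The flag lets `iso⇒≈` serve both for isomorphism of digraphs and for
-- equality of permutations.
data _≈[_]_ : Shape → Bool → Shape → Set where
  leaf : ∀ {o} → leaf tt ≈[ o ] leaf tt
  node : ∀ {o b ss us vs} → Pointwise _≈[ o ]_ ss us → Arrangement o b us vs →
    node b ss ≈[ o ] node b vs

infix 4 _≈_
_≈_ : Rel Shape 0ℓ
_≈_ = _≈[ false ]_

≈[true]⇒≡ : ∀ {s u} → s ≈[ true ] u → s ≡ u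
≈[true]⇒≡F : ∀ {ss us} → Pointwise _≈[ true ]_ ss us → ss ≡ us
≈[true]⇒≡ leaf          = refl
≈[true]⇒≡ (node p refl) = cong (node _) (≈[true]⇒≡F p)
≈[true]⇒≡F []       = refl
≈[true]⇒≡F (p ∷ ps) = cong₂ _∷_ (≈[true]⇒≡ p) (≈[true]⇒≡F ps)

arrangement-refl : ∀ o b {ss} → Arrangement o b ss ss
arrangement-refl false false = Perm.refl
arrangement-refl false true  = refl
arrangement-refl true  b     = refl

arrangement-⇒↭ : ∀ o b {ss us} → Arrangement o b ss us → ss ↭ us
arrangement-⇒↭ false false p    = p
arrangement-⇒↭ false true  refl = Perm.refl
arrangement-⇒↭ true  b     refl = Perm.refl

≈-refl : ∀ {s} → s ≈ s
≈-reflF : ∀ {ss} → Pointwise _≈_ ss ss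
≈-refl {leaf tt}   = leaf
≈-refl {node b ss} = node ≈-reflF (arrangement-refl false b)
≈-reflF {[]}     = []
≈-reflF {s ∷ ss} = ≈-refl ∷ ≈-reflF

≈-sym : ∀ {s u} → s ≈ u → u ≈ s
≈-symF : ∀ {ss us} → Pointwise _≈_ ss us → Pointwise _≈_ us ss
≈-sym leaf = leaf
≈-sym (node {b = true} p refl) = node (≈-symF p) refl
≈-sym (node {b = false} p q) = let _ , p′ , q′ = pointwise-↭ (↭-sym q) (≈-symF p) in node p′ q′
≈-symF []       = []
≈-symF (p ∷ ps) = ≈-sym p ∷ ≈-symF ps

≈-trans : ∀ {s u v} → s ≈ u → u ≈ v → s ≈ v
≈-transF : ∀ {ss us vs} → Pointwise _≈_ ss us → Pointwise _≈_ us vs → Pointwise _≈_ ss vs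
≈-trans leaf leaf = leaf
≈-trans (node {b = true} p refl) (node p′ refl) = node (≈-transF p p′) refl
≈-trans (node {b = false} p q) (node p′ q′) =
  let _ , p″ , q″ = pointwise-↭ q p′ in node (≈-transF p p″) (↭-trans q″ q′)
≈-transF []       []       = []
≈-transF (p ∷ ps) (q ∷ qs) = ≈-trans p q ∷ ≈-transF ps qs

size-≈ : ∀ {s u} → s ≈ u → length (leaves s) ≡ length (leaves u)
size-≈F : ∀ {ss us} → Pointwise _≈_ ss us → length (leavesF ss) ≡ length (leavesF us)
size-≈ leaf = refl
size-≈ (node {b = b} p q) = trans (size-≈F p) (↭-length (leavesF-↭ (arrangement-⇒↭ false b q)))
size-≈F [] = refl
size-≈F {s ∷ ss} {u ∷ us} (p ∷ ps) = trans (ListP.length-++ (leaves s))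
  (trans (cong₂ _+_ (size-≈ p) (size-≈F ps)) (sym (ListP.length-++ (leaves u))))

proper-≈ : ∀ {s u} → s ≈ u → Proper s → Proper u
proper-≈F : ∀ {b ss us} → Pointwise _≈_ ss us →
  All (λ t → RootNot b t × Proper t) ss → All (λ t → RootNot b t × Proper t) us
proper-≈ leaf leaf = leaf
proper-≈ (node {b = b} p q) (node l a) =
  node (subst (2 ≤_) (trans (length-Pw p) (↭-length q′)) l) (All-resp-↭ q′ (proper-≈F p a))
  where
  q′ = arrangement-⇒↭ false b q
  length-Pw : ∀ {xs ys} → Pointwise _≈_ xs ys → length xs ≡ length ys
  length-Pw []       = refl
  length-Pw (_ ∷ ps) = cong suc (length-Pw ps)
proper-≈F [] [] = []
proper-≈F (leaf ∷ ps) ((r , a) ∷ as) = (tt , leaf) ∷ proper-≈F ps as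
proper-≈F (p@(node _ _) ∷ ps) ((r , a) ∷ as) = (r , proper-≈ p a) ∷ proper-≈F ps as

length-mapF : (f : A → B) (ts : List (Tree A)) → length (mapF f ts) ≡ length ts
length-mapF f ts = trans (cong length (mapF≡map f ts)) (ListP.length-map (mapT f) ts)

proper-mapT : (f : A → B) {t : Tree A} → Proper t → Proper (mapT f t)
proper-mapF : (f : A → B) {b : Bool} {ts : List (Tree A)} → All (λ t → RootNot b t × Proper t) ts →
  All (λ t → RootNot b t × Proper t) (mapF f ts)
proper-mapT f leaf       = leaf
proper-mapT f (node {ts = ts} l a) =
  node (subst (2 ≤_) (sym (length-mapF f ts)) l) (proper-mapF f a)
proper-mapF f []       = []
proper-mapF f {ts = leaf _ ∷ _}   ((r , a) ∷ as) = (tt , leaf) ∷ proper-mapF f as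
proper-mapF f {ts = node _ _ ∷ _} ((r , a) ∷ as) = (r , proper-mapT f a) ∷ proper-mapF f as

proper-unshape : (t : Tree A) → Proper (shape t) → Proper t
proper-unshapeF : ∀ {b} (ts : List (Tree A)) → All (λ t → RootNot b t × Proper t) (shapes ts) →
  All (λ t → RootNot b t × Proper t) ts
proper-unshape (leaf x) _ = leaf
proper-unshape (node b ts) (node l a) =
  node (subst (2 ≤_) (length-mapF (const tt) ts) l) (proper-unshapeF ts a)
proper-unshapeF [] [] = []
proper-unshapeF (leaf x ∷ ts) (_ ∷ as) = (tt , leaf) ∷ proper-unshapeF ts as
proper-unshapeF (t@(node _ _) ∷ ts) ((r , a) ∷ as) =
  (r , proper-unshape t a) ∷ proper-unshapeF ts as

fill : (t : Tree A) (ys : List B) → length ys ≡ length (leaves t) →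
  ∃[ u ] shape u ≡ shape t × leaves u ≡ ys
fillF : (ts : List (Tree A)) (ys : List B) → length ys ≡ length (leavesF ts) →
  ∃[ us ] shapes us ≡ shapes ts × leavesF us ≡ ys
fill (leaf x) (y ∷ []) e = leaf y , refl , refl
fill (node b ts) ys e = let us , p , q = fillF ts ys e in node b us , cong (node b) p , q
fillF [] [] e = [] , refl , refl
fillF (t ∷ ts) ys e =
  let k = length (leaves t)
      e′ = trans e (ListP.length-++ (leaves t))
      u , p , q = fill t (take k ys) (trans (ListP.length-take k ys)
        (ℕP.m≤n⇒m⊓n≡m (ℕP.≤-trans (ℕP.m≤m+n k _) (ℕP.≤-reflexive (sym e′)))))
      us , ps , qs = fillF ts (drop k ys) (trans (ListP.length-drop k ys)
        (trans (cong (_∸ k) e′) (ℕP.m+n∸m≡n k _)))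
  in u ∷ us , cong₂ _∷_ p ps , trans (cong₂ _++_ q qs) (ListP.take++drop≡id k ys)

node-injective : ∀ {b b′} {ts us : List (Tree A)} → _≡_ {A = Tree A} (node b ts) (node b′ us) →
  b ≡ b′ × ts ≡ us
node-injective refl = refl , refl

shape-leaves-injective : (t u : Tree A) → shape t ≡ shape u → leaves t ≡ leaves u → t ≡ u
shapes-leaves-injective : (ts us : List (Tree A)) → shapes ts ≡ shapes us →
  leavesF ts ≡ leavesF us → ts ≡ us
shape-leaves-injective (leaf x) (leaf y) _ e = cong leaf (ListP.∷-injectiveˡ e)
shape-leaves-injective (node b ts) (node b′ us) p e with p′ ← node-injective p
  = cong₂ node (proj₁ p′) (shapes-leaves-injective ts us (proj₂ p′) e)
shapes-leaves-injective [] [] _ _ = refl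
shapes-leaves-injective (t ∷ ts) (u ∷ us) p e =
  let p₁ , p₂ = ListP.∷-injective p
      e₁ , e₂ = ++-cancel (leaves t) (leaves u) (size p₁) e
  in cong₂ _∷_ (shape-leaves-injective t u p₁ e₁) (shapes-leaves-injective ts us p₂ e₂)
  where
  size : shape t ≡ shape u → length (leaves t) ≡ length (leaves u)
  size q = trans (sym (len t)) (trans (cong (length ∘ leaves) q) (len u))
    where
    len : (v : Tree _) → length (leaves (shape v)) ≡ length (leaves v)
    len v = trans (cong length (leaves-mapT (const tt) v)) (ListP.length-map (const tt) (leaves v))
  ++-cancel : ∀ (xs ys : List _) {xs′ ys′} → length xs ≡ length ys → xs ++ xs′ ≡ ys ++ ys′ →
    xs ≡ ys × xs′ ≡ ys′
  ++-cancel [] [] _ q = refl , q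
  ++-cancel (x ∷ xs) (y ∷ ys) l q with ListP.∷-injective q
  ... | refl , q′ = let r , r′ = ++-cancel xs ys (ℕP.suc-injective l) q′ in cong (x ∷_) r , r′

-- Trees that describe a digraph, and isomorphisms between them.

module _ {A : Set} (D : Rel A 0ℓ) where

  -- The relation of a leaf in an earlier child of a node to a leaf in a later one. The condition
  -- `x ≢ y` makes all leaves of a tree that `Reads` the digraph distinct.
  Cross : Bool → Rel A 0ℓ
  Cross true  x y = x ≢ y × D x y × ¬ D y x
  Cross false x y = x ≢ y × ¬ D x y × ¬ D y x

  -- Adjacency in the graph whose components are the children of a node: the comparability graph for
  -- a 0-node and its complement for a 1-node.
  Link : Bool → Rel A 0ℓ
  Link true  x y = x ≢ y × ¬ D x y × ¬ D y x
  Link false x y = D x y ⊎ D y x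

  CrossT : Bool → Rel (Tree A) 0ℓ
  CrossT b t u = ∀ {x y} → x ∈ leaves t → y ∈ leaves u → Cross b x y

  data Reads : Tree A → Set where
    leaf : ∀ {x} → Reads (leaf x)
    node : ∀ {b ts} → All Reads ts → AllPairs (CrossT b) ts → Reads (node b ts)

  -- Connectivity without paths: no proper nonempty part of L is closed
  -- under links.
  Conn : Bool → List A → Set₁
  Conn b L = ∀ (Q : A → Set) → (∀ {x y} → x ∈ L → y ∈ L → Q x → Link b x y → Q y) →
    ∀ {x y} → x ∈ L → y ∈ L → Q x → Q y

other-leaf : ∀ {b} (ts : List (Tree A)) {t us} → 2 ≤ length (ts ++ t ∷ us) →
  All (λ t → RootNot b t × Proper t) (ts ++ t ∷ us) → ∃[ x ] x ∈ leavesF (ts ++ us)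
other-leaf [] {us = []} (s≤s ()) _
other-leaf [] {us = u ∷ us} _ (_ ∷ (_ , p) ∷ _) = let x , x∈ = nonempty p in x , ∈-++⁺ˡ x∈
other-leaf (u ∷ ts) _ ((_ , p) ∷ _) = let x , x∈ = nonempty p in x , ∈-++⁺ˡ x∈

module _ {A : Set} {D : Rel A 0ℓ} where

  link-sym : ∀ b {x y} → Link D b x y → Link D b y x
  link-sym true  (p , q , r) = p ∘ sym , r , q
  link-sym false (inj₁ p)    = inj₂ p
  link-sym false (inj₂ p)    = inj₁ p

  cross⇒≢ : ∀ b {x y} → Cross D b x y → x ≢ y
  cross⇒≢ true  = proj₁
  cross⇒≢ false = proj₁

  cross⇒¬link : ∀ b {x y} → Cross D b x y → ¬ Link D b x y
  cross⇒¬link true  (_ , p , _) (_ , q , _) = q p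
  cross⇒¬link false (_ , p , q) (inj₁ r)    = p r
  cross⇒¬link false (_ , p , q) (inj₂ r)    = q r

  cross⇒link : ∀ b {x y} → Cross D (not b) x y → Link D b x y
  cross⇒link true  c           = c
  cross⇒link false (_ , p , _) = inj₁ p

  NoLink : Bool → Rel A 0ℓ
  NoLink b x y = x ≢ y × ¬ Link D b x y

  nolink-sym : ∀ b {x y} → NoLink b x y → NoLink b y x
  nolink-sym b (p , q) = p ∘ sym , q ∘ link-sym b

  cross⇒nolink : ∀ b {x y} → Cross D b x y → NoLink b x y
  cross⇒nolink b c = cross⇒≢ b c , cross⇒¬link b c

  NoLinkT : Bool → Rel (Tree A) 0ℓ
  NoLinkT b t u = ∀ {x y} → x ∈ leaves t → y ∈ leaves u → NoLink b x y

  split-cross : ∀ (R : Rel A 0ℓ) ts {t us} →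
    AllPairs (λ u v → ∀ {x y} → x ∈ leaves u → y ∈ leaves v → R x y) (ts ++ t ∷ us) →
    ∀ {x y} → x ∈ leaves t → y ∈ leavesF (ts ++ us) → R x y ⊎ R y x
  split-cross R [] {us = us} (p ∷ _) x∈ y∈ =
    let u , u∈ , y∈u = ∈-leavesF⁻ us y∈ in inj₁ (All.lookup p u∈ x∈ y∈u)
  split-cross R (u ∷ ts) {t} (p ∷ q) x∈ y∈ with ∈-++⁻ (leaves u) y∈
  ... | inj₁ y∈u = inj₂ (All.lookup p (∈-++⁺ʳ ts (here refl)) y∈u x∈)
  ... | inj₂ y∈  = split-cross R ts q x∈ y∈

  split-nolink : ∀ b ts {t us} → AllPairs (CrossT D b) (ts ++ t ∷ us) →
    ∀ {x y} → x ∈ leaves t → y ∈ leavesF (ts ++ us) → NoLink b x y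
  split-nolink b ts ap x∈ y∈ with split-cross (Cross D b) ts ap x∈ y∈
  ... | inj₁ c = cross⇒nolink b c
  ... | inj₂ c = nolink-sym b (cross⇒nolink b c)

  split-link : ∀ {b b′} ts {t us} → b ≢ b′ → AllPairs (CrossT D b′) (ts ++ t ∷ us) →
    ∀ {x y} → x ∈ leaves t → y ∈ leavesF (ts ++ us) → Link D b x y
  split-link {b} {b′} ts {t} {us} b≢b′ ap x∈ y∈
    with split-cross (Cross D (not b)) ts (subst (λ c → AllPairs (CrossT D c) (ts ++ t ∷ us)) (≢⇒not b≢b′) ap) x∈ y∈
    where
    ≢⇒not : ∀ {b b′} → b ≢ b′ → b′ ≡ not b
    ≢⇒not {true}  {true}  p = contradiction refl p
    ≢⇒not {true}  {false} p = refl
    ≢⇒not {false} {true}  p = refl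
    ≢⇒not {false} {false} p = contradiction refl p
  ... | inj₁ c = cross⇒link b c
  ... | inj₂ c = link-sym b (cross⇒link b c)

  -- At a root of the other colour, leaves of different children are linked. Leaves of the same
  -- child are joined through a leaf of another child, which exists since there are at least two.
  conn : ∀ b {t : Tree A} → Proper t → Reads D t → RootNot b t → Conn D b (leaves t)
  conn b leaf leaf _ Q h (here refl) (here refl) q = q
  conn b (node {ts = ts} l ps) (node rs ap) b≢b′ Q h {x} {y} x∈ y∈ q with ∈-leavesF⁻ ts x∈
  ... | t , t∈ , x∈t with ∈-∃++ t∈
  ... | us , vs , refl with ∈-delete us y∈
  ... | inj₂ y∈r = h x∈ y∈ q (split-link us b≢b′ ap x∈t y∈r)
  ... | inj₁ y∈t = let z , z∈r = other-leaf us l ps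
                       z∈ = ∈-insert us (inj₂ z∈r)
                   in h z∈ y∈ (h x∈ z∈ q (split-link us b≢b′ ap x∈t z∈r))
                        (link-sym b (split-link us b≢b′ ap y∈t z∈r))

record Same {A B : Set} (D : Rel A 0ℓ) (D′ : Rel B 0ℓ) (x x′ : A) (y y′ : B) : Set where
  field
    eq→ : x ≡ x′ → y ≡ y′
    eq← : y ≡ y′ → x ≡ x′
    to  : D x x′ → D′ y y′
    from : D′ y y′ → D x x′
open Same public

-- A relation on lists instead of a function on types: its converse is again of this kind, and it
-- restricts to the leaves of a subtree without membership proofs in the domain.
record Iso {A B : Set} (D : Rel A 0ℓ) (D′ : Rel B 0ℓ) (xs : List A) (ys : List B) (F : A → B → Set) : Set where
  field
    total : ∀ {x} → x ∈ xs → ∃[ y ] y ∈ ys × F x y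
    onto  : ∀ {y} → y ∈ ys → ∃[ x ] x ∈ xs × F x y
    same  : ∀ {x x′ y y′} → x ∈ xs → x′ ∈ xs → y ∈ ys → y′ ∈ ys → F x y → F x′ y′ →
      Same D D′ x x′ y y′
open Iso public

iso-sym : ∀ {A B : Set} {D : Rel A 0ℓ} {D′ : Rel B 0ℓ} {xs : List A} {ys : List B}
  {F : A → B → Set} →
  Iso D D′ xs ys F → Iso D′ D ys xs (flip F)
iso-sym i = record { total = onto i ; onto = total i ; same = λ a b c d f g →
  let s = same i c d a b f g in record { eq→ = eq← s ; eq← = eq→ s ; to = from s ; from = to s } }

module _ {A B : Set} {D : Rel A 0ℓ} {D′ : Rel B 0ℓ} {F : A → B → Set} where

  link-transport : ∀ b {x x′ y y′} → Same D D′ x x′ y y′ → Same D D′ x′ x y′ y → Link D b x x′ →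
    Link D′ b y y′
  link-transport true  s s′ (p , q , r) = p ∘ eq← s , q ∘ from s , r ∘ from s′
  link-transport false s s′ (inj₁ p)    = inj₁ (to s p)
  link-transport false s s′ (inj₂ p)    = inj₂ (to s′ p)

  -- No link leads from `qs` to the rest of `ys`. So the property that every image of x lies in `qs`
  -- is closed under links, and it spreads from x₀ over the connected list `ps`.
  iso-conn : ∀ b {xs ys} {ps : List A} {qs rs : List B} → Iso D D′ xs ys F → Conn D b ps →
    (∀ {x} → x ∈ ps → x ∈ xs) → (∀ {y} → y ∈ qs → y ∈ ys) → (∀ {y} → y ∈ ys → y ∈ qs ⊎ y ∈ rs) →
    (∀ {y z} → y ∈ qs → z ∈ rs → NoLink {D = D′} b y z) →
    ∀ {x₀ y₀} → x₀ ∈ ps → y₀ ∈ qs → F x₀ y₀ →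
    ∀ {x y} → x ∈ ps → y ∈ ys → F x y → y ∈ qs
  iso-conn b {ys = ys} {qs = qs} i c ps⊆ qs⊆ cover nl {x₀} {y₀} x₀∈ y₀∈ f₀ x∈ y∈ f =
    c (λ x → ∀ {y} → y ∈ ys → F x y → y ∈ qs) step x₀∈ x∈ base y∈ f
    where
    base : ∀ {y} → y ∈ ys → F x₀ y → y ∈ qs
    base y∈ g = subst (_∈ qs) (eq→ (same i (ps⊆ x₀∈) (ps⊆ x₀∈) (qs⊆ y₀∈) y∈ f₀ g) refl) y₀∈
    step : ∀ {x x′} → x ∈ _ → x′ ∈ _ → (∀ {y} → y ∈ ys → F x y → y ∈ qs) → Link D b x x′ →
      ∀ {y} → y ∈ ys → F x′ y → y ∈ qs
    step {x} {x′} x∈ x′∈ h l {y} y∈ g with cover y∈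
    ... | inj₁ y∈qs = y∈qs
    ... | inj₂ y∈rs =
      let z , z∈ , f = total i (ps⊆ x∈)
          z∈qs = h z∈ f
      in contradiction (link-transport b (same i (ps⊆ x∈) (ps⊆ x′∈) z∈ y∈ f g)
           (same i (ps⊆ x′∈) (ps⊆ x∈) y∈ z∈ g f) l) (proj₂ (nl z∈qs y∈rs))

-- Both `xs₁` and `ys₁` are components, and one pair is related across them. By `iso-conn`, in both
-- directions, they correspond to each other, and then so do their complements.
matching : ∀ {A B : Set} {D : Rel A 0ℓ} {D′ : Rel B 0ℓ} {F : A → B → Set} b {xs xs₁ xs₂ : List A}
  {ys ys₁ ys₂ : List B} →
  Iso D D′ xs ys F → Conn D b xs₁ → Conn D′ b ys₁ →
  (∀ {x} → x ∈ xs → x ∈ xs₁ ⊎ x ∈ xs₂) → (∀ {x} → x ∈ xs₁ ⊎ x ∈ xs₂ → x ∈ xs) →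
  (∀ {y} → y ∈ ys → y ∈ ys₁ ⊎ y ∈ ys₂) → (∀ {y} → y ∈ ys₁ ⊎ y ∈ ys₂ → y ∈ ys) →
  (∀ {x x′} → x ∈ xs₁ → x′ ∈ xs₂ → NoLink {D = D} b x x′) →
  (∀ {y y′} → y ∈ ys₁ → y′ ∈ ys₂ → NoLink {D = D′} b y y′) →
  ∀ {x₀ y₀} → x₀ ∈ xs₁ → y₀ ∈ ys₁ → F x₀ y₀ →
  Iso D D′ xs₁ ys₁ F × Iso D D′ xs₂ ys₂ F
matching {D = D} {D′} {F} b {xs} {xs₁} {xs₂} {ys} {ys₁} {ys₂} i c c′ cov uncov cov′ uncov′ nl nl′
  x₀∈ y₀∈ f₀ =
  record
    { total = λ x∈ → let y , y∈ , f = total i (uncov (inj₁ x∈)) in y , forth x∈ y∈ f , f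
    ; onto  = λ y∈ → let x , x∈ , f = onto i (uncov′ (inj₁ y∈)) in x , back y∈ x∈ f , f
    ; same  = λ p q r s →
      same i (uncov (inj₁ p)) (uncov (inj₁ q)) (uncov′ (inj₁ r)) (uncov′ (inj₁ s))
    } , record
    { total = λ x∈ → let y , y∈ , f = total i (uncov (inj₂ x∈)) in y , rest x∈ y∈ f , f
    ; onto  = λ y∈ → let x , x∈ , f = onto i (uncov′ (inj₂ y∈)) in x , rest′ y∈ x∈ f , f
    ; same  = λ p q r s →
      same i (uncov (inj₂ p)) (uncov (inj₂ q)) (uncov′ (inj₂ r)) (uncov′ (inj₂ s))
    }
  where
  forth : ∀ {x y} → x ∈ xs₁ → y ∈ ys → F x y → y ∈ ys₁
  forth = iso-conn b i c (uncov ∘ inj₁) (uncov′ ∘ inj₁) cov′ nl′ x₀∈ y₀∈ f₀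
  back : ∀ {y x} → y ∈ ys₁ → x ∈ xs → F x y → x ∈ xs₁
  back = iso-conn b (iso-sym i) c′ (uncov′ ∘ inj₁) (uncov ∘ inj₁) cov nl y₀∈ x₀∈ f₀
  rest : ∀ {x y} → x ∈ xs₂ → y ∈ ys → F x y → y ∈ ys₂
  rest x∈ y∈ f with cov′ y∈
  ... | inj₂ y∈₂ = y∈₂
  ... | inj₁ y∈₁ = contradiction refl (proj₁ (nl (back y∈₁ (uncov (inj₂ x∈)) f) x∈))
  rest′ : ∀ {y x} → y ∈ ys₂ → x ∈ xs → F x y → x ∈ xs₂
  rest′ y∈ x∈ f with cov x∈
  ... | inj₂ x∈₂ = x∈₂
  ... | inj₁ x∈₁ = contradiction refl (proj₁ (nl′ (forth x∈₁ (uncov′ (inj₂ y∈)) f) y∈))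

two-leaves : ∀ {A : Set} {D : Rel A 0ℓ} {b ts} → Proper (node b ts) → Reads D (node b ts) →
  ∃[ x ] ∃[ y ] x ∈ leavesF ts × y ∈ leavesF ts × x ≢ y
two-leaves {b = b} {ts = t ∷ ts} (node l ((r , p) ∷ ps)) (node _ ap) =
  let x , x∈ = nonempty p
      y , y∈ = other-leaf [] l ((r , p) ∷ ps)
  in x , y , ∈-++⁺ˡ x∈ , ∈-++⁺ʳ (leaves t) y∈ , proj₁ (split-nolink b [] {t} {ts} ap x∈ y∈)

¬iso-leaf-node : ∀ {A B : Set} {D : Rel A 0ℓ} {D′ : Rel B 0ℓ} {F : A → B → Set} {x : A} {b}
  {us : List (Tree B)} →
  Proper (node b us) → Reads D′ (node b us) → ¬ Iso D D′ (x ∷ []) (leavesF us) F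
¬iso-leaf-node p r i with two-leaves p r
... | y , y′ , y∈ , y′∈ , y≢y′ with onto i y∈ | onto i y′∈
... | _ , here refl , f | _ , here refl , f′ =
  y≢y′ (eq→ (same i (here refl) (here refl) y∈ y′∈ f f′) refl)

module _ {A B : Set} {D : Rel A 0ℓ} {D′ : Rel B 0ℓ} {F : A → B → Set} {_<_ : Rel A 0ℓ} {_<′_ : Rel B 0ℓ} (o : Bool)
  (mono : o ≡ true → ∀ {x x′ y y′} → F x y → F x′ y′ → x < x′ → y <′ y′)
  (asym : ∀ {y y′} → y <′ y′ → ¬ y′ <′ y) where

  -- The children of a node are components, so an isomorphism permutes them and recursion applies to
  -- matched children. At a 1-node the arcs fix their order. With `o = true` the relation is
  -- monotone between lists that are sorted, which fixes the order at 0-nodes as well.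
  iso⇒≈ : (t : Tree A) (u : Tree B) → Proper t → Reads D t → Proper u → Reads D′ u →
    Iso D D′ (leaves t) (leaves u) F →
    (o ≡ true → AllPairs _<_ (leaves t)) → (o ≡ true → AllPairs _<′_ (leaves u)) →
    shape t ≈[ o ] shape u
  iso⇒≈F : ∀ b (ts : List (Tree A)) (us : List (Tree B)) →
    All (λ t → RootNot b t × Proper t) ts → All (Reads D) ts → AllPairs (CrossT D b) ts →
    All (λ t → RootNot b t × Proper t) us → All (Reads D′) us → AllPairs (CrossT D′ b) us →
    Iso D D′ (leavesF ts) (leavesF us) F →
    (o ≡ true → AllPairs _<_ (leavesF ts)) → (o ≡ true → AllPairs _<′_ (leavesF us)) →
    ∃[ ss ] Pointwise _≈[ o ]_ (shapes ts) ss × Arrangement o b ss (shapes us)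
  iso⇒≈ (leaf x) (leaf y) p r p′ r′ i s s′ = leaf
  iso⇒≈ (leaf x) (node b us) p r p′ r′ i s s′ = contradiction i (¬iso-leaf-node p′ r′)
  iso⇒≈ (node b ts) (leaf x) p r p′ r′ i s s′ = contradiction (iso-sym i) (¬iso-leaf-node p r)
  iso⇒≈ (node b ts) (node b′ us) p@(node l ps) r@(node rs ap) p′@(node l′ ps′) r′@(node rs′ ap′) i s
    s′
    with b BoolP.≟ b′
  ... | yes refl = let ss , q , a = iso⇒≈F b ts us ps rs ap ps′ rs′ ap′ i s s′ in node q a
  ... | no b≢b′ = contradiction i (mismatch ts p r)
    where
    -- For roots of different colours, the leaves of `us` are connected by links of colour b.
    -- Connectivity would bring z, a leaf of another child, into the first child t.
    mismatch : ∀ ts → Proper (node b ts) → Reads D (node b ts) →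
      ¬ Iso D D′ (leavesF ts) (leavesF us) F
    mismatch (t ∷ ts) (node l ((q , p) ∷ ps)) (node rs ap) i =
      let x , x∈ = nonempty p
          z , z∈ = other-leaf [] l ((q , p) ∷ ps)
          y , y∈ , f = total i (∈-++⁺ˡ x∈)
          w , w∈ , g = total i (∈-++⁺ʳ (leaves t) z∈)
          z∈t = iso-conn b (iso-sym i) (conn b p′ r′ b≢b′) id ∈-++⁺ˡ (∈-delete [] {t} {ts})
                  (split-nolink b [] {t} {ts} ap) y∈ x∈ f w∈ (∈-++⁺ʳ (leaves t) z∈) g
      in proj₁ (split-nolink b [] {t} {ts} ap z∈t z∈) refl

  iso⇒≈F b [] [] ps rs ap ps′ rs′ ap′ i s s′ = [] , [] , arrangement-refl o b
  iso⇒≈F b [] (u ∷ us) ps rs ap ((_ , p) ∷ _) rs′ ap′ i s s′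
    with () ← proj₁ (proj₂ (onto i (∈-++⁺ˡ (proj₂ (nonempty p)))))
  iso⇒≈F b (t ∷ ts) us ((q , p) ∷ ps) (r ∷ rs) (a ∷ ap) ps′ rs′ ap′ i s s′ with nonempty p
  -- One leaf of t and its image determine the child u that corresponds to t.
  ... | x , x∈ with total i (∈-++⁺ˡ x∈)
  ... | y , y∈us , f with ∈-leavesF⁻ us y∈us
  ... | u , u∈ , y∈ with ∈-∃++ u∈
  ... | vs , ws , refl with All.lookup ps′ u∈ | All.lookup rs′ u∈
  ... | q′ , p′ | r′ = shape u ∷ ss , iso⇒≈ t u p r p′ r′ iso₁
        (λ e → allPairs-++ˡ (leaves t) (s e))
        (λ e → allPairs-++ˡ (leaves u) (allPairs-leavesF vs (s′ e)))
      ∷ pw , arrange o b vs refl refl arr (λ e v vs′ eq → first v vs′ eq e)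
    where
    nl : ∀ {x x′} → x ∈ leaves t → x′ ∈ leavesF ts → NoLink {D = D} b x x′
    nl = split-nolink b [] {t} {ts} (a ∷ ap)
    isos = matching b i (conn b p r q) (conn b p′ r′ q′) (∈-delete [] {t} {ts})
      (∈-insert [] {t} {ts})
      (∈-delete vs {u} {ws}) (∈-insert vs {u} {ws}) nl (split-nolink b vs ap′) x∈ y∈ f
    iso₁ = proj₁ isos
    iso₂ = proj₂ isos
    allPairs-leavesF : ∀ vs {ws} → AllPairs _<′_ (leavesF (vs ++ ws)) → AllPairs _<′_ (leavesF ws)
    allPairs-leavesF []       k = k
    allPairs-leavesF (v ∷ vs) k = allPairs-leavesF vs (allPairs-++ʳ (leaves v) k)
    allPairs-remove : ∀ vs {u ws} → AllPairs _<′_ (leavesF (vs ++ u ∷ ws)) →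
      AllPairs _<′_ (leavesF (vs ++ ws))
    allPairs-remove []       {u} k = allPairs-++ʳ (leaves u) k
    allPairs-remove (v ∷ vs) {u} {ws} k = allPairs-++⁺ (leaves v) (allPairs-++ˡ (leaves v) k)
      (allPairs-remove vs (allPairs-++ʳ (leaves v) k))
      λ x∈ y∈ → allPairs-++-cross (leaves v) k x∈ (∈-insert vs {u} {ws} (inj₂ y∈))
    all-remove : ∀ {ℓ} {P : Tree B → Set ℓ} vs {u ws} → All P (vs ++ u ∷ ws) → All P (vs ++ ws)
    all-remove vs k with AllP.++⁻ˡ vs k | AllP.++⁻ʳ vs k
    ... | k₁ | _ ∷ k₂ = AllP.++⁺ k₁ k₂
    rec = iso⇒≈F b ts (vs ++ ws) ps rs ap (all-remove vs ps′) (all-remove vs rs′)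
      (allPairs-delete vs ap′)
      iso₂ (λ e → allPairs-++ʳ (leaves t) (s e)) (λ e → allPairs-remove vs (s′ e))
    ss = proj₁ rec
    pw = proj₁ (proj₂ rec)
    arr = proj₂ (proj₂ rec)
    -- If order matters, then u is the first tree: the leaves of an earlier
    -- one come before those of u, but correspond to leaves after those of t.
    first : ∀ v vs′ → vs ≡ v ∷ vs′ → ¬ (o ≡ true ⊎ b ≡ true)
    first v vs′ refl e =
      let z , z∈ = nonempty (proj₂ (All.head ps′))
          z∈rest = ∈-++⁺ˡ z∈
          x′ , x′∈ , g = onto iso₂ z∈rest
          c = All.lookup (AllPairs.head ap′) (∈-++⁺ʳ vs′ (here refl)) z∈ y∈
          z∈all = ∈-insert vs {u} {ws} (inj₂ z∈rest)
          _ , t′∈ , x′∈t′ = ∈-leavesF⁻ ts x′∈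
          c′ = All.lookup a t′∈ x∈ x′∈t′
      in case e of λ where
           (inj₁ e) → asym (mono e f g (allPairs-++-cross (leaves t) (s e) x∈ x′∈))
             (allPairs-++-cross (leaves v) (s′ e) z∈ (∈-insert vs′ {u} {ws} (inj₁ y∈)))
           (inj₂ refl) → proj₂ (proj₂ c)
             (to (same i (∈-++⁺ˡ x∈) (∈-++⁺ʳ (leaves t) x′∈) y∈us z∈all f g) (proj₁ (proj₂ c′)))
    arrange : ∀ o′ b′ vs → o′ ≡ o → b′ ≡ b → ∀ {ss} → Arrangement o′ b′ ss (shapes (vs ++ ws)) →
      (o ≡ true ⊎ b ≡ true → ∀ v vs′ → ¬ vs ≡ v ∷ vs′) →
      Arrangement o′ b′ (shape u ∷ ss) (shapes (vs ++ u ∷ ws))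
    arrange false false vs _ _ k h = ↭-trans (Perm.prep _ k) (↭-sym (shapes-↭ (shift u vs ws)))
    arrange false true [] _ e k h = cong (shape u ∷_) k
    arrange false true (v ∷ vs) _ refl k h = contradiction refl (h (inj₂ refl) v vs)
    arrange true b′ [] e _ k h = cong (shape u ∷_) k
    arrange true b′ (v ∷ vs) refl _ k h = contradiction refl (h (inj₁ refl) v vs)

crossT-sym : ∀ {A : Set} {D : Rel A 0ℓ} {t u} → CrossT D false t u → CrossT D false u t
crossT-sym c x∈ y∈ = let p , q , r = c y∈ x∈ in p ∘ sym , r , q

iso-↭ : ∀ {A B : Set} {D : Rel A 0ℓ} {D′ : Rel B 0ℓ} {F : A → B → Set} {xs ys zs} → ys ↭ zs →
  Iso D D′ xs ys F → Iso D D′ xs zs F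
iso-↭ p i = record
  { total = λ x∈ → let y , y∈ , f = total i x∈ in y , ∈-resp-↭ p y∈ , f
  ; onto  = λ y∈ → onto i (∈-resp-↭ (↭-sym p) y∈)
  ; same  = λ a b c d → same i a b (∈-resp-↭ (↭-sym p) c) (∈-resp-↭ (↭-sym p) d)
  }

cross-same : ∀ {A B : Set} {D : Rel A 0ℓ} {D′ : Rel B 0ℓ} b {x x′ y y′} → Cross D b x x′ →
  Cross D′ b y y′ →
  Same D D′ x x′ y y′ × Same D D′ x′ x y′ y
cross-same true (p , q , r) (p′ , q′ , r′) =
  record { eq→ = ⊥-elim ∘ p ; eq← = ⊥-elim ∘ p′ ; to = const q′ ; from = const q } ,
  record { eq→ = ⊥-elim ∘ p ∘ sym ; eq← = ⊥-elim ∘ p′ ∘ sym ; to = ⊥-elim ∘ r ; from = ⊥-elim ∘ r′ }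
cross-same false (p , q , r) (p′ , q′ , r′) =
  record { eq→ = ⊥-elim ∘ p ; eq← = ⊥-elim ∘ p′ ; to = ⊥-elim ∘ q ; from = ⊥-elim ∘ q′ } ,
  record { eq→ = ⊥-elim ∘ p ∘ sym ; eq← = ⊥-elim ∘ p′ ∘ sym ; to = ⊥-elim ∘ r ; from = ⊥-elim ∘ r′ }

module _ {A B : Set} {D : Rel A 0ℓ} {D′ : Rel B 0ℓ} (irr : ∀ x → ¬ D x x) (irr′ : ∀ x → ¬ D′ x x) where

  -- Once the rearrangement at a 0-node is undone, the children are matched in order, and the
  -- relations between the children are united. Leaves of different children agree by the colour of
  -- the node alone.
  ≈⇒iso : (t : Tree A) (u : Tree B) → Reads D t → Reads D′ u → shape t ≈ shape u →
    ∃[ F ] Iso D D′ (leaves t) (leaves u) F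
  ≈⇒isoF : ∀ b (ts : List (Tree A)) (us : List (Tree B)) → All (Reads D) ts →
    AllPairs (CrossT D b) ts →
    All (Reads D′) us → AllPairs (CrossT D′ b) us → Pointwise _≈_ (shapes ts) (shapes us) →
    ∃[ F ] Iso D D′ (leavesF ts) (leavesF us) F
  ≈⇒iso (leaf x) (leaf y) _ _ _ = (λ _ _ → ⊤) , record
    { total = λ _ → y , here refl , tt
    ; onto  = λ _ → x , here refl , tt
    ; same  = λ { (here refl) (here refl) (here refl) (here refl) _ _ → record
        { eq→ = λ _ → refl ; eq← = λ _ → refl ; to = ⊥-elim ∘ irr x ; from = ⊥-elim ∘ irr′ y } }
    }
  ≈⇒iso (node true ts) (node true us) (node rs ap) (node rs′ ap′) (node p refl) =
    ≈⇒isoF true ts us rs ap rs′ ap′ p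
  ≈⇒iso (node false ts) (node false us) (node rs ap) (node rs′ ap′) (node p q)
    with unmap q
    where
    -- The rearrangement concerns shapes; it has to be lifted to the labelled children.
    unmap : ∀ {ss} → ss ↭ shapes us → ∃[ vs ] ss ≡ shapes vs × us ↭ vs
    unmap q with ↭-map-inv shape (subst (_↭ _) (mapF≡map (const tt) us) (↭-sym q))
    ... | vs , e , q′ = vs , trans e (sym (mapF≡map (const tt) vs)) , q′
  ... | vs , refl , q′ =
    let F , i = ≈⇒isoF false ts vs rs ap (All-resp-↭ q′ rs′)
                  (allPairs-↭ {R = CrossT D′ false} (λ {t} {u} → crossT-sym {t = t} {u}) q′ ap′) p
    in F , iso-↭ (leavesF-↭ (↭-sym q′)) i
  ≈⇒isoF b [] [] _ _ _ _ [] = (λ _ _ → ⊤) , record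
    { total = λ () ; onto = λ () ; same = λ () }
  ≈⇒isoF b (t ∷ ts) (u ∷ us) (r ∷ rs) (a ∷ ap) (r′ ∷ rs′) (a′ ∷ ap′) (p ∷ ps)
    with ≈⇒iso t u r r′ p | ≈⇒isoF b ts us rs ap rs′ ap′ ps
  ... | F , i | F′ , i′ = G , record { total = tot ; onto = ont ; same = λ _ _ _ _ → sam }
    where
    G : A → B → Set
    G x y = (x ∈ leaves t × y ∈ leaves u × F x y) ⊎ (x ∈ leavesF ts × y ∈ leavesF us × F′ x y)
    tot : ∀ {x} → x ∈ leaves t ++ leavesF ts → ∃[ y ] y ∈ leaves u ++ leavesF us × G x y
    tot x∈ with ∈-++⁻ (leaves t) x∈
    ... | inj₁ x∈ = let y , y∈ , f = total i x∈ in y , ∈-++⁺ˡ y∈ , inj₁ (x∈ , y∈ , f)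
    ... | inj₂ x∈ = let y , y∈ , f = total i′ x∈ in y , ∈-++⁺ʳ (leaves u) y∈ , inj₂ (x∈ , y∈ , f)
    ont : ∀ {y} → y ∈ leaves u ++ leavesF us → ∃[ x ] x ∈ leaves t ++ leavesF ts × G x y
    ont y∈ with ∈-++⁻ (leaves u) y∈
    ... | inj₁ y∈ = let x , x∈ , f = onto i y∈ in x , ∈-++⁺ˡ x∈ , inj₁ (x∈ , y∈ , f)
    ... | inj₂ y∈ = let x , x∈ , f = onto i′ y∈ in x , ∈-++⁺ʳ (leaves t) x∈ , inj₂ (x∈ , y∈ , f)
    cr : ∀ {x x′ y y′} → x ∈ leaves t → x′ ∈ leavesF ts → y ∈ leaves u → y′ ∈ leavesF us →
      Same D D′ x x′ y y′ × Same D D′ x′ x y′ y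
    cr x∈ x′∈ y∈ y′∈ =
      let _ , v∈ , x′∈v = ∈-leavesF⁻ ts x′∈
          _ , w∈ , y′∈w = ∈-leavesF⁻ us y′∈
      in cross-same b (All.lookup a v∈ x∈ x′∈v) (All.lookup a′ w∈ y∈ y′∈w)
    sam : ∀ {x x′ y y′} → G x y → G x′ y′ → Same D D′ x x′ y y′
    sam (inj₁ (p , q , f)) (inj₁ (p′ , q′ , f′)) = same i p p′ q q′ f f′
    sam (inj₁ (p , q , f)) (inj₂ (p′ , q′ , f′)) = proj₁ (cr p p′ q q′)
    sam (inj₂ (p , q , f)) (inj₁ (p′ , q′ , f′)) = proj₂ (cr p′ p q′ q)
    sam (inj₂ (p , q , f)) (inj₂ (p′ , q′ , f′)) = same i′ p p′ q q′ f f′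

module _ {a r} {A : Set a} {_≺_ : Rel A r} (≺-trans : Transitive _≺_) where

  -- Trees are comparable only when no link joins them, so the comparisons for the insertion sort
  -- are supplied along with the list.
  insert-sorted : ∀ x xs → All (λ y → x ≺ y ⊎ y ≺ x) xs → AllPairs _≺_ xs →
    ∃[ ys ] x ∷ xs ↭ ys × AllPairs _≺_ ys
  insert-sorted x [] _ _ = x ∷ [] , Perm.refl , [] ∷ []
  insert-sorted x (y ∷ xs) (inj₁ x≺y ∷ _) (p ∷ ps) =
    x ∷ y ∷ xs , Perm.refl , (x≺y ∷ All.map (≺-trans x≺y) p) ∷ p ∷ ps
  insert-sorted x (y ∷ xs) (inj₂ y≺x ∷ c) (p ∷ ps) =
    let zs , q , s = insert-sorted x xs c ps
    in y ∷ zs , ↭-trans (Perm.swap x y Perm.refl) (Perm.prep y q) , All-resp-↭ q (y≺x ∷ p) ∷ s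

  sort-comparable : ∀ xs → AllPairs (λ x y → x ≺ y ⊎ y ≺ x) xs → ∃[ ys ] xs ↭ ys × AllPairs _≺_ ys
  sort-comparable [] [] = [] , Perm.refl , []
  sort-comparable (x ∷ xs) (p ∷ ps) =
    let ys , q , s = sort-comparable xs ps
        zs , q′ , s′ = insert-sorted x ys (All-resp-↭ q p) s
    in zs , ↭-trans (Perm.prep x q) q′ , s′

-- Sorting the children of nodes by their labels.

module _ {n} (π : Permutation′ n) where

  private D = D[ π ]

  D-irrefl : ∀ x → ¬ D x x
  D-irrefl x (p , _) = ℕP.<-irrefl refl p

  D-asym : ∀ {x y} → D x y → ¬ D y x
  D-asym (p , _) (q , _) = ℕP.<-asym p q

  D? : ∀ x y → Dec (D x y)
  D? x y = (x FinP.<? y) ×-dec ((π ⟨$⟩ˡ y) FinP.<? (π ⟨$⟩ˡ x))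

  link? : ∀ b x y → Dec (Link D b x y)
  link? true  x y = ¬? (x FinP.≟ y) ×-dec ¬? (D? x y) ×-dec ¬? (D? y x)
  link? false x y = D? x y ⊎-dec D? y x

  π⁻¹-injective : ∀ {x y} → π ⟨$⟩ˡ x ≡ π ⟨$⟩ˡ y → x ≡ y
  π⁻¹-injective e = trans (sym (inverseʳ π)) (trans (cong (π ⟨$⟩ʳ_) e) (inverseʳ π))

  nolink⇒cross : ∀ b {x y} → NoLink {D = D} b x y → x Fin.< y → Cross D b x y
  nolink⇒cross false (p , q) _ = p , q ∘ inj₁ , q ∘ inj₂
  nolink⇒cross true {x} {y} (p , q) x<y with D? x y
  ... | yes d = p , d , D-asym d
  ... | no ¬d = contradiction (p , ¬d , λ (y<x , _) → ℕP.<-asym x<y y<x) q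

  cross-order : ∀ b {x y} → Cross D b x y → x Fin.< y →
    (b ≡ true × π ⟨$⟩ˡ y Fin.< π ⟨$⟩ˡ x) ⊎ (b ≡ false × π ⟨$⟩ˡ x Fin.< π ⟨$⟩ˡ y)
  cross-order true  (_ , (_ , d) , _) _ = inj₁ (refl , d)
  cross-order false {x} {y} (p , ¬d , _) x<y with FinP.<-cmp (π ⟨$⟩ˡ x) (π ⟨$⟩ˡ y)
  ... | tri< q _ _ = inj₂ (refl , q)
  ... | tri≈ _ e _ = contradiction (π⁻¹-injective e) p
  ... | tri> _ _ q = contradiction (x<y , q) ¬d

  -- If x < y < x′, then x and x′ would be related like both are to y.
  force : ∀ b {x x′ y} → Link D b x x′ → NoLink {D = D} b x y → NoLink {D = D} b x′ y →
    x Fin.< y → x′ Fin.< y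
  force b {x} {x′} {y} l nl nl′ x<y with FinP.<-cmp x′ y
  ... | tri< q _ _ = q
  ... | tri≈ _ e _ = contradiction e (proj₁ nl′)
  ... | tri> _ _ y<x′ = ⊥-elim (go b l (cross-order b (nolink⇒cross b nl x<y) x<y)
          (cross-order b (nolink⇒cross b (nolink-sym b nl′) y<x′) y<x′))
    where
    x<x′ = ℕP.<-trans x<y y<x′
    go : ∀ b → Link D b x x′ →
      (b ≡ true × π ⟨$⟩ˡ y Fin.< π ⟨$⟩ˡ x) ⊎ (b ≡ false × π ⟨$⟩ˡ x Fin.< π ⟨$⟩ˡ y) →
      (b ≡ true × π ⟨$⟩ˡ x′ Fin.< π ⟨$⟩ˡ y) ⊎ (b ≡ false × π ⟨$⟩ˡ y Fin.< π ⟨$⟩ˡ x′) → ⊥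
    go true (_ , ¬d , _) (inj₁ (_ , p)) (inj₁ (_ , q)) = ¬d (x<x′ , ℕP.<-trans q p)
    go false (inj₁ (_ , d)) (inj₂ (_ , p)) (inj₂ (_ , q)) = ℕP.<-asym d (ℕP.<-trans p q)
    go false (inj₂ (d , _)) _ _ = ℕP.<-asym d x<x′

  force′ : ∀ b {x y y′} → Link D b y y′ → NoLink {D = D} b x y → NoLink {D = D} b x y′ →
    x Fin.< y → x Fin.< y′
  force′ b {x} {y} {y′} l nl nl′ x<y with FinP.<-cmp x y′
  ... | tri< q _ _ = q
  ... | tri≈ _ e _ = contradiction e (proj₁ nl′)
  ... | tri> _ _ q = contradiction
    (force b (link-sym b l) (nolink-sym b nl′) (nolink-sym b nl) q) (ℕP.<-asym x<y)

  LtT : Rel (Tree (Fin n)) 0ℓ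
  LtT t u = ∀ {x y} → x ∈ leaves t → y ∈ leaves u → x Fin.< y

  -- By `force` and `force′`, an inequality between leaves of the two trees persists along a link
  -- inside either of them, and both trees are connected.
  conn-< : ∀ b {t u} → Conn D b (leaves t) → Conn D b (leaves u) → NoLinkT {D = D} b t u →
    ∀ {x₀ y₀} → x₀ ∈ leaves t → y₀ ∈ leaves u → x₀ Fin.< y₀ → LtT t u
  conn-< b c c′ nl {x₀} {y₀} x₀∈ y₀∈ lt {x} x∈ y∈ =
    c′ (x Fin.<_) (λ y∈ y′∈ p l → force′ b l (nl x∈ y∈) (nl x∈ y′∈) p) y₀∈ y∈
      (c (Fin._< y₀) (λ x∈ x′∈ p l → force b l (nl x∈ y₀∈) (nl x′∈ y₀∈) p) x₀∈ x∈ lt)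

  Component : Bool → Tree (Fin n) → Set
  Component b t = RootNot b t × Proper t

  sort-forest : ∀ b ts → All (Component b) ts → All (Reads D) ts → AllPairs (NoLinkT {D = D} b) ts →
    ∃[ us ] ts ↭ us × AllPairs (CrossT D b) us × AllPairs LtT us
  sort-forest b ts ps rs ap = us , q ,
      AllPairs.map (λ { ((_ , lt) , nl) x∈ y∈ → nolink⇒cross b (nl x∈ y∈) (lt x∈ y∈) })
        (AllPairs.zip (s , allPairs-↭ {R = NoLinkT b} (λ nl x∈ y∈ → nolink-sym b (nl y∈ x∈)) q ap))
          ,
      AllPairs.map (λ { (_ , lt) x∈ y∈ → lt x∈ y∈ }) s
    where
    _≺_ : Rel (Tree (Fin n)) 0ℓ
    t ≺ u = (∃[ x ] x ∈ leaves t) × LtT t u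
    ≺-trans : Transitive _≺_
    ≺-trans (i , lt) ((_ , y∈) , lt′) = i , λ x∈ z∈ → ℕP.<-trans (lt x∈ y∈) (lt′ y∈ z∈)
    compare : ∀ {t u} → Component b t → Reads D t → Component b u → Reads D u →
      NoLinkT {D = D} b t u → t ≺ u ⊎ u ≺ t
    compare {t} {u} (r , p) q (r′ , p′) q′ nl with nonempty p | nonempty p′
    ... | x , x∈ | y , y∈ with FinP.<-cmp x y
    ... | tri< lt _ _ = inj₁
      ((x , x∈) , conn-< b {t} {u} (conn b p q r) (conn b p′ q′ r′) nl x∈ y∈ lt)
    ... | tri≈ _ e _  = contradiction e (proj₁ (nl x∈ y∈))
    ... | tri> _ _ gt = inj₂ ((y , y∈) , conn-< b {u} {t} (conn b p′ q′ r′) (conn b p q r)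
                          (λ a b′ → nolink-sym b (nl b′ a)) y∈ x∈ gt)
    comparable : ∀ {ts} → All (Component b) ts → All (Reads D) ts →
      AllPairs (NoLinkT {D = D} b) ts →
      AllPairs (λ t u → t ≺ u ⊎ u ≺ t) ts
    comparable [] [] [] = []
    comparable {t ∷ ts} (p ∷ ps) (r ∷ rs) (a ∷ ap) =
      All.tabulate (λ {u} u∈ →
        compare {t} {u} p r (All.lookup ps u∈) (All.lookup rs u∈) (All.lookup a u∈))
        ∷ comparable ps rs ap
    sorted = sort-comparable {_≺_ = _≺_} (λ {i j k} → ≺-trans {i} {j} {k}) ts (comparable ps rs ap)
    us = proj₁ sorted
    q = proj₁ (proj₂ sorted)
    s = proj₂ (proj₂ sorted)

  Ascending : List (Fin n) → Set
  Ascending = AllPairs Fin._<_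

  ascendingF : ∀ {ts} → All (Ascending ∘ leaves) ts → AllPairs LtT ts → Ascending (leavesF ts)
  ascendingF [] [] = []
  ascendingF {t ∷ ts} (a ∷ as) (l ∷ ls) = allPairs-++⁺ (leaves t) a (ascendingF as ls)
    λ x∈ y∈ → let u , u∈ , y∈u = ∈-leavesF⁻ ts y∈ in All.lookup l u∈ x∈ y∈u

  Sorting : Tree (Fin n) → Tree (Fin n) → Set
  Sorting t u = Proper u × Reads D u × (∀ b → RootNot b t → RootNot b u) × shape t ≈ shape u ×
    leaves t ↭ leaves u × Ascending (leaves u)

  sort-tree : ∀ t → Proper t → Reads D t → ∃[ u ] Sorting t u
  sort-trees : ∀ {b} ts → All (Component b) ts → All (Reads D) ts → ∃[ us ] Pointwise Sorting ts us
  sort-tree (leaf x) leaf leaf =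
    leaf x , leaf , leaf , (λ _ _ → tt) , leaf , Perm.refl , [] ∷ []
  sort-tree (node b ts) (node l ps) (node rs ap) with sort-trees ts ps rs
  ... | us , S = go b ps ap
    where
    length-Pw : ∀ {ts us} → Pointwise Sorting ts us → length ts ≡ length us
    length-Pw []       = refl
    length-Pw (_ ∷ ps) = cong suc (length-Pw ps)
    comps : ∀ b {ts us} → Pointwise Sorting ts us → All (Component b) ts → All (Component b) us
    comps b [] [] = []
    comps b ((p , _ , r , _) ∷ ss) ((r′ , _) ∷ ps) = (r b r′ , p) ∷ comps b ss ps
    reads : ∀ {ts us} → Pointwise Sorting ts us → All (Reads D) us
    reads [] = []
    reads ((_ , r , _) ∷ ss) = r ∷ reads ss
    asc : ∀ {ts us} → Pointwise Sorting ts us → All (Ascending ∘ leaves) us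
    asc [] = []
    asc ((_ , _ , _ , _ , _ , a) ∷ ss) = a ∷ asc ss
    shp : ∀ {ts us} → Pointwise Sorting ts us → Pointwise _≈_ (shapes ts) (shapes us)
    shp [] = []
    shp ((_ , _ , _ , s , _) ∷ ss) = s ∷ shp ss
    lvs : ∀ {ts us} → Pointwise Sorting ts us → leavesF ts ↭ leavesF us
    lvs [] = Perm.refl
    lvs ((_ , _ , _ , _ , q , _) ∷ ss) = ++⁺ q (lvs ss)
    back : ∀ {t u x} → Sorting t u → x ∈ leaves u → x ∈ leaves t
    back (_ , _ , _ , _ , q , _) = ∈-resp-↭ (↭-sym q)
    crossAll : ∀ b {t u ts us} → Sorting t u → Pointwise Sorting ts us →
      All (CrossT D b t) ts → All (CrossT D b u) us
    crossAll b s [] [] = []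
    crossAll b s (s′ ∷ ss) (c ∷ cs) = (λ x∈ y∈ → c (back s x∈) (back s′ y∈)) ∷ crossAll b s ss cs
    cross : ∀ b {ts us} → Pointwise Sorting ts us → AllPairs (CrossT D b) ts →
      AllPairs (CrossT D b) us
    cross b [] [] = []
    cross b (s ∷ ss) (c ∷ cs) = crossAll b s ss c ∷ cross b ss cs
    l′ : 2 ≤ length us
    l′ = subst (2 ≤_) (length-Pw S) l
    go : ∀ b → All (Component b) ts → AllPairs (CrossT D b) ts → ∃[ u ] Sorting (node b ts) u
    -- Arcs lead to larger labels, so the children of a 1-node are sorted already, and the shape
    -- keeps their order.
    go true ps ap = node true us , node l′ (comps true S ps) , node (reads S) (cross true S ap) ,
      (λ _ r → r) , node (shp S) refl , lvs S ,
      ascendingF (asc S) (AllPairs.map {S = LtT} (λ c x∈ y∈ → proj₁ (proj₁ (proj₂ (c x∈ y∈))))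
        (cross true S ap))
    go false ps ap =
      let vs , q , ap′ , lts = sort-forest false us (comps false S ps) (reads S)
            (AllPairs.map {S = NoLinkT {D = D} false}
              (λ c x∈ y∈ → cross⇒nolink {D = D} false (c x∈ y∈)) (cross false S ap))
      in node false vs ,
         node (subst (2 ≤_) (↭-length q) l′) (All-resp-↭ q (comps false S ps)) ,
         node (All-resp-↭ q (reads S)) ap′ ,
         (λ _ r → r) , node (shp S) (shapes-↭ q) , ↭-trans (lvs S) (leavesF-↭ q) ,
         ascendingF (All-resp-↭ q (asc S)) lts
  sort-trees [] [] [] = [] , []
  sort-trees (t ∷ ts) ((_ , p) ∷ ps) (r ∷ rs) =
    let u , s = sort-tree t p r
        us , ss = sort-trees ts ps rs
    in u ∷ us , s ∷ ss

reads-mapT : ∀ {A B : Set} {D : Rel A 0ℓ} {D′ : Rel B 0ℓ} (f : A → B) →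
  (∀ b {x y} → Cross D b x y → Cross D′ b (f x) (f y)) → ∀ {t} → Reads D t → Reads D′ (mapT f t)
reads-mapF : ∀ {A B : Set} {D : Rel A 0ℓ} {D′ : Rel B 0ℓ} (f : A → B) →
  (∀ b {x y} → Cross D b x y → Cross D′ b (f x) (f y)) →
  ∀ {ts} → All (Reads D) ts → All (Reads D′) (mapF f ts)
reads-mapT f h leaf = leaf
reads-mapT {A} {B} {D} {D′} f h (node {b} rs ap) = node (reads-mapF f h rs) (cross ap)
  where
  crossAll : ∀ {t us} → All (CrossT D b t) us → All (CrossT D′ b (mapT f t)) (mapF f us)
  crossAll [] = []
  crossAll {t} {u ∷ us} (c ∷ cs) = cr ∷ crossAll {t} cs
    where
    cr : CrossT D′ b (mapT f t) (mapT f u)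
    cr x∈ y∈ with ∈-map⁻ f (subst (_ ∈_) (leaves-mapT f t) x∈) | ∈-map⁻ f (subst (_ ∈_) (leaves-mapT f u) y∈)
    ... | _ , x∈ , refl | _ , y∈ , refl = h b (c x∈ y∈)
  cross : ∀ {ts} → AllPairs (CrossT D b) ts → AllPairs (CrossT D′ b) (mapF f ts)
  cross [] = []
  cross {t ∷ _} (c ∷ cs) = crossAll {t} c ∷ cross cs
reads-mapF f h [] = []
reads-mapF f h (r ∷ rs) = reads-mapT f h r ∷ reads-mapF f h rs

-- Subsets given by lists.

∈-irrelevant : ∀ {n} {S : Subset n} {x} (p q : x Sub.∈ S) → p ≡ q
∈-irrelevant Vec.here      Vec.here      = refl
∈-irrelevant (Vec.there p) (Vec.there q) = cong Vec.there (∈-irrelevant p q)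

∉-─ : ∀ {n} (S T : Subset n) {x : Fin n} → x Sub.∈ S Sub.─ T → x Sub.∉ T
∉-─ (s Vec.∷ S) (inside Vec.∷ T) () Vec.here
∉-─ (s Vec.∷ S) (t Vec.∷ T) (Vec.there p) (Vec.there q) = ∉-─ S T p q

module _ {n : ℕ} where

  open DecMem (FinP._≟_ {n}) using (_∈?_)

  ⟦_⟧ : List (Fin n) → Subset n
  ⟦ xs ⟧ = Vec.tabulate λ i → does (i ∈? xs)

  ∈⟦⟧⁺ : ∀ {xs i} → i ∈ xs → i Sub.∈ ⟦ xs ⟧
  ∈⟦⟧⁺ {xs} {i} i∈ = VecP.lookup⇒[]= i _
    (trans (VecP.lookup∘tabulate (λ i → does (i ∈? xs)) i) (dec-true (i ∈? xs) i∈))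

  ∈⟦⟧⁻ : ∀ {xs i} → i Sub.∈ ⟦ xs ⟧ → i ∈ xs
  ∈⟦⟧⁻ {xs} {i} i∈ with i ∈? xs | trans (sym (VecP.lookup∘tabulate (λ i → does (i ∈? xs)) i)) (VecP.[]=⇒lookup i∈)
  ... | yes p | _ = p

  subset-ext : ∀ {S T : Subset n} → (∀ {i} → i Sub.∈ S → i Sub.∈ T) →
    (∀ {i} → i Sub.∈ T → i Sub.∈ S) → S ≡ T
  subset-ext f g = SubP.⊆-antisym f g

  two⇒1<∣∣ : ∀ {S : Subset n} {x y} → x Sub.∈ S → y Sub.∈ S → x ≢ y → 1 < ∣ S ∣
  two⇒1<∣∣ {S} {x} {y} x∈ y∈ x≢y = subst (_< ∣ S ∣) (SubP.∣⁅x⁆∣≡1 x) (SubP.p⊂q⇒∣p∣<∣q∣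
    ((λ z∈ → subst (Sub._∈ S) (sym (SubP.x∈⁅y⁆⇒x≡y x z∈)) x∈) , y , y∈ ,
      λ y∈′ → x≢y (sym (SubP.x∈⁅y⁆⇒x≡y x y∈′))))

  ⊆-singleton : ∀ {S : Subset n} {x} → (∀ {y} → y Sub.∈ S → y ≡ x) → ¬ 1 < ∣ S ∣
  ⊆-singleton {S} {x} h = ℕP.≤⇒≯ (subst (∣ S ∣ ≤_) (SubP.∣⁅x⁆∣≡1 x)
    (SubP.p⊆q⇒∣p∣≤∣q∣ λ y∈ → subst (Sub._∈ ⁅ x ⁆) (sym (h y∈)) (SubP.x∈⁅x⁆ x)))

  subset-missing : ∀ {S T : Subset n} → ¬ S ⊆ T → ∃[ x ] x Sub.∈ S × x Sub.∉ T
  subset-missing {S} {T} h with FinP.any? (λ x → (x SubP.∈? S) ×-dec ¬? (x SubP.∈? T))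
  ... | yes (x , p , q) = x , p , q
  ... | no ¬p = contradiction (λ {x} x∈ → decidable-stable (x SubP.∈? T) λ x∉ → ¬p (x , x∈ , x∉)) h

  ∈-─ : ∀ {S T : Subset n} {x} → x Sub.∈ S → x Sub.∉ T → Nonempty (S Sub.─ T)
  ∈-─ p q = _ , SubP.x∈p∧x∉q⇒x∈p─q p q

  ∈-∩ : ∀ {S T : Subset n} {x} → x Sub.∈ S → x Sub.∈ T → Nonempty (S Sub.∩ T)
  ∈-∩ p q = _ , SubP.x∈p∩q⁺ (p , q)

-- Components, strong modules, and the tree of a cograph.

module _ {n} (π : Permutation′ n) where

  private
    D = D[ π ]
    G = G[ π ]

  NoLinkL : Bool → Rel (List (Fin n)) 0ℓ
  NoLinkL b xs ys = ∀ {x y} → x ∈ xs → y ∈ ys → NoLink {D = D} b x y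

  Piece : Bool → List (Fin n) → Set₁
  Piece b c = Conn D b c × ∃[ x ] x ∈ c

  conn-join : ∀ b {v xs c z} → Conn D b (v ∷ xs) → Conn D b c → z ∈ c → Link D b v z →
    Conn D b (v ∷ c ++ xs)
  conn-join b {v} {xs} {c} {z} k k′ z∈ l Q h x∈ y∈ q = fromV y∈ (toV x∈ q)
    where
    inV : ∀ {x} → x ∈ v ∷ xs → x ∈ v ∷ c ++ xs
    inV (here e)  = here e
    inV (there p) = there (∈-++⁺ʳ c p)
    inC : ∀ {x} → x ∈ c → x ∈ v ∷ c ++ xs
    inC p = there (∈-++⁺ˡ p)
    stepV : ∀ {x y} → x ∈ v ∷ xs → y ∈ v ∷ xs → Q x → Link D b x y → Q y
    stepV p q = h (inV p) (inV q)
    stepC : ∀ {x y} → x ∈ c → y ∈ c → Q x → Link D b x y → Q y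
    stepC p q = h (inC p) (inC q)
    toV : ∀ {x} → x ∈ v ∷ c ++ xs → Q x → Q v
    toV (here refl) q = q
    toV (there p) q with ∈-++⁻ c p
    ... | inj₁ p = h (inC z∈) (here refl) (k′ Q stepC p z∈ q) (link-sym b l)
    ... | inj₂ p = k Q stepV (there p) (here refl) q
    fromV : ∀ {y} → y ∈ v ∷ c ++ xs → Q v → Q y
    fromV (here refl) q = q
    fromV (there p) q with ∈-++⁻ c p
    ... | inj₁ p = k′ Q stepC z∈ p (h (here refl) (inC z∈) q l)
    ... | inj₂ p = k Q stepV (here refl) (there p) q

  -- Components are computed by adding one vertex at a time: the pieces with a link to v are merged
  -- with it into `v ∷ xs`, and the pieces `ds` without such a link stay as they are.
  absorb : ∀ b v cs → All (Piece b) cs → AllPairs (NoLinkL b) cs → v ∉ concat cs →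
    ∃[ xs ] ∃[ ds ] xs ++ concat ds ↭ concat cs × Conn D b (v ∷ xs) × (∀ {d} → d ∈ ds → d ∈ cs) ×
      AllPairs (NoLinkL b) ((v ∷ xs) ∷ ds)
  absorb b v [] _ _ _ =
    [] , [] , Perm.refl , (λ { Q h (here refl) (here refl) q → q }) , (λ ()) , [] ∷ []
  absorb b v (c ∷ cs) ((k , ne) ∷ ps) (a ∷ ap) v∉ with absorb b v cs ps ap (v∉ ∘ ∈-++⁺ʳ c)
  ... | xs , ds , perm , k′ , sub , e ∷ ap′ with Any.any? (link? π b v) c
  ... | yes l = let z , z∈ , lk = find l in
    c ++ xs , ds ,
    ↭-trans (Perm.↭-reflexive (ListP.++-assoc c xs (concat ds))) (++⁺ˡ c perm) ,
    conn-join b k′ k z∈ lk , there ∘ sub ,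
    All.tabulate (λ {d} d∈ → λ where
      (here refl) y∈ → All.lookup e d∈ (here refl) y∈
      (there x∈)  y∈ → Sum.[ (λ x∈ → All.lookup a (sub d∈) x∈ y∈) ,
        (λ x∈ → All.lookup e d∈ (there x∈) y∈) ]′
        (∈-++⁻ c x∈)) ∷ ap′
  ... | no ¬l = xs , c ∷ ds ,
    ↭-trans (shifts xs c) (++⁺ˡ c perm) , k′ ,
    (λ { (here e) → here e ; (there d∈) → there (sub d∈) }) ,
    (new ∷ e) ∷ All.tabulate (λ d∈ → All.lookup a (sub d∈)) ∷ ap′
    where
    new : NoLinkL b (v ∷ xs) c
    new (here refl) y∈ = (λ { refl → v∉ (∈-++⁺ˡ y∈) }) , λ l → ¬l (lose y∈ l)
    new (there x∈)  y∈ = let d , x∈d , d∈ = ∈-concat⁻′ cs (∈-resp-↭ perm (∈-++⁺ˡ x∈))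
                         in nolink-sym b (All.lookup a d∈ y∈ x∈d)

  components : ∀ b xs → Unique xs →
    ∃[ cs ] concat cs ↭ xs × All (Piece b) cs × AllPairs (NoLinkL b) cs
  components b [] _ = [] , Perm.refl , [] , []
  components b (v ∷ xs) (v∉ ∷ u) with components b xs u
  ... | cs , perm , ps , ap
      with absorb b v cs ps ap (λ v∈ → All.lookup v∉ (∈-resp-↭ perm v∈) refl)
  ... | ys , ds , perm′ , k , sub , ap′ = (v ∷ ys) ∷ ds , Perm.prep v (↭-trans perm′ perm) ,
    (k , v , here refl) ∷ All.tabulate (All.lookup ps ∘ sub) , ap′

  link⇒G : ∀ {x y} → Link D false x y → G x y
  link⇒G (inj₁ p) = fwd p
  link⇒G (inj₂ p) = bwd p

  G⇒link : ∀ {x y} → G x y → Link D false x y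
  G⇒link (fwd p) = inj₁ p
  G⇒link (bwd p) = inj₂ p

  link⇒Gᶜ : ∀ {x y} → Link D true x y → (G ᶜ) x y
  link⇒Gᶜ (p , q , r) = p , λ { (fwd d) → q d ; (bwd d) → r d }

  module-link : ∀ b {M} → IsModule G M → ∀ {v x y} → v Sub.∉ M → x Sub.∈ M → y Sub.∈ M →
    Link D b v x → Link D b v y
  module-link false m v∉ x∈ y∈ l with m _ v∉
  ... | inj₁ all  = G⇒link (all _ y∈)
  ... | inj₂ none = contradiction (link⇒G l) (none _ x∈)
  module-link true m v∉ x∈ y∈ (p , q , r) with m _ v∉
  ... | inj₁ all  = contradiction (G⇒link (all _ x∈)) Sum.[ q , r ]′
  ... | inj₂ none = (λ { refl → v∉ y∈ }) , none _ y∈ ∘ fwd , none _ y∈ ∘ bwd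

  nolink-uniform : ∀ b {v} {M : Subset n} → (∀ {x} → x Sub.∈ M → NoLink {D = D} b v x) →
    (∀ m → m Sub.∈ M → G v m) ⊎ (∀ m → m Sub.∈ M → ¬ G v m)
  nolink-uniform false h = inj₂ λ m m∈ g → proj₂ (h m∈) (G⇒link g)
  nolink-uniform true {v} h = inj₁ λ m m∈ → link⇒G (decidable-stable (link? π false v m)
    λ ¬l → proj₂ (h m∈) (proj₁ (h m∈) , ¬l ∘ inj₁ , ¬l ∘ inj₂))

  -- A union of components of S. Besides single children, `descend` needs the union of two.
  IsPart : Bool → List (Fin n) → List (Fin n) → Set
  IsPart b S C = (∀ {x} → x ∈ C → x ∈ S) × (∀ {x y} → x ∈ C → y ∈ S → y ∉ C → NoLink {D = D} b y x)

  open DecMem (FinP._≟_ {n}) using (_∈?_)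

  part-module : ∀ b {S C} → IsModule G ⟦ S ⟧ → IsPart b S C → IsModule G ⟦ C ⟧
  part-module b {S} {C} m (sub , nl) v v∉ with v ∈? S
  ... | yes v∈ = nolink-uniform b λ x∈ → nl (∈⟦⟧⁻ x∈) v∈ (v∉ ∘ ∈⟦⟧⁺)
  ... | no v∉S = Sum.map (λ h m m∈ → h m (up m∈)) (λ h m m∈ → h m (up m∈)) (m v (v∉S ∘ ∈⟦⟧⁻))
    where
    up : ∀ {m} → m Sub.∈ ⟦ C ⟧ → m Sub.∈ ⟦ S ⟧
    up = ∈⟦⟧⁺ ∘ sub ∘ ∈⟦⟧⁻

  -- A module N that overlaps C lies inside S, as S is strong. It has a point z outside C, which is
  -- linked to nothing in C. A link from C ∩ N to a vertex v of C outside N would, N being a module,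
  -- link v to z. So N is closed under the links of C and contains C, against the overlap.
  component-strong : ∀ b {S C} → IsStrong G ⟦ S ⟧ → Conn D b C → IsPart b S C → IsStrong G ⟦ C ⟧
  component-strong b {S} {C} (m , st) k part@(sub , nl) = part-module b m part , no-overlap
    where
    no-overlap : ∀ N → IsModule G N → ¬ Overlap G ⟦ C ⟧ N
    no-overlap N mN ((x , x∈∩) , (y , y∈─) , (z , z∈─)) = y∉N (k (Sub._∈ N) step x∈C y∈C x∈N)
      where
      x∈C = ∈⟦⟧⁻ (proj₁ (SubP.x∈p∩q⁻ ⟦ C ⟧ N x∈∩))
      x∈N = proj₂ (SubP.x∈p∩q⁻ ⟦ C ⟧ N x∈∩)
      y∈C = ∈⟦⟧⁻ (SubP.p─q⊆p ⟦ C ⟧ N y∈─)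
      z∈N = SubP.p─q⊆p N ⟦ C ⟧ z∈─
      y∉N : y Sub.∉ N
      y∉N = ∉-─ ⟦ C ⟧ N y∈─
      z∉C : z ∉ C
      z∉C = ∉-─ N ⟦ C ⟧ z∈─ ∘ ∈⟦⟧⁺
      N⊆S : N ⊆ ⟦ S ⟧
      N⊆S {w} w∈ = decidable-stable (w SubP.∈? ⟦ S ⟧) λ w∉ →
        st N mN (∈-∩ {S = ⟦ S ⟧} {N} (∈⟦⟧⁺ (sub x∈C)) x∈N , ∈-─ (∈⟦⟧⁺ (sub y∈C)) y∉N , ∈-─ w∈ w∉)
      step : ∀ {u v} → u ∈ C → v ∈ C → u Sub.∈ N → Link D b u v → v Sub.∈ N
      step {u} {v} u∈ v∈ u∈N l = decidable-stable (v SubP.∈? N) λ v∉N →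
        proj₂ (nl v∈ (∈⟦⟧⁻ (N⊆S z∈N)) z∉C)
          (link-sym b (module-link b mN v∉N u∈N z∈N (link-sym b l)))

  conn⇒star : ∀ b (R : Rel (Fin n) 0ℓ) {C} {M : Subset n} → (∀ {x y} → Link D b x y → R x y) →
    (∀ {x} → x ∈ C → x Sub.∈ M) →
    Conn D b C → ∀ {x y} → x ∈ C → y ∈ C → (p : x Sub.∈ M) (q : y Sub.∈ M) →
      Star (R ↾ M) (x , p) (y , q)
  conn⇒star b R {M = M} h sub k {x} {y} x∈ y∈ p q =
    let q′ , s = k (λ z → Σ[ q ∈ z Sub.∈ M ] Star (R ↾ M) (x , p) (z , q))
          (λ _ v∈ (_ , s) l → sub v∈ , s ◅◅ (h l ◅ ε)) x∈ y∈ (p , ε)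
    in subst (λ q → Star (R ↾ M) (x , p) (y , q)) (∈-irrelevant q′ q) s

  conn⇒connected : ∀ b (R : Rel (Fin n) 0ℓ) {C} → (∀ {x y} → Link D b x y → R x y) → Conn D b C →
    Connected (R ↾ ⟦ C ⟧)
  conn⇒connected b R h k (x , p) (y , q) = conn⇒star b R h ∈⟦⟧⁺ k (∈⟦⟧⁻ p) (∈⟦⟧⁻ q) p q

  star-stays : ∀ {M : Subset n} {S C} → IsPart false S C → (∀ {x} → x Sub.∈ M → x ∈ S) →
    ∀ {u v} → Star (G ↾ M) u v → proj₁ u ∈ C → proj₁ v ∈ C
  star-stays part h ε u∈ = u∈
  star-stays {C = C} part@(sub , nl) h {u = u} (_◅_ {j = w} g s) u∈ = star-stays part h s
    (decidable-stable (proj₁ w ∈? C) λ w∉ →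
      proj₂ (nl u∈ (h (proj₂ w)) w∉) (link-sym {D = D} false (G⇒link g)))

  conn-↭ : ∀ b {xs ys} → xs ↭ ys → Conn D b xs → Conn D b ys
  conn-↭ b p k Q h x∈ y∈ = k Q (λ x∈ y∈ → h (∈-resp-↭ p x∈) (∈-resp-↭ p y∈))
    (∈-resp-↭ (↭-sym p) x∈) (∈-resp-↭ (↭-sym p) y∈)

  -- Converse to `conn`: the first child of a root of colour b is closed under links of colour b,
  -- and it is not everything.
  conn⇒rootNot : ∀ b {t} → Proper t → Reads D t → Conn D b (leaves t) → RootNot b t
  conn⇒rootNot b {leaf _} _ _ _ = tt
  conn⇒rootNot b {node .b (t ∷ ts)} (node l ((r , p) ∷ ps)) (node rs ap) k refl =
    let x , x∈ = nonempty p
        y , y∈ = other-leaf [] l ((r , p) ∷ ps)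
        y∈t = k (_∈ leaves t) step (∈-++⁺ˡ x∈) (∈-++⁺ʳ (leaves t) y∈) x∈
    in proj₁ (split-nolink b [] {t} {ts} ap y∈t y∈) refl
    where
    step : ∀ {x y} → x ∈ leavesF (t ∷ ts) → y ∈ leavesF (t ∷ ts) → x ∈ leaves t → Link D b x y →
      y ∈ leaves t
    step _ y∈ x∈ l with ∈-++⁻ (leaves t) y∈
    ... | inj₁ y∈t = y∈t
    ... | inj₂ y∈r = contradiction l (proj₂ (split-nolink b [] {t} {ts} ap x∈ y∈r))

  piece-part : ∀ b {xs cs c} → concat cs ↭ xs → AllPairs (NoLinkL b) cs → c ∈ cs → IsPart b xs c
  piece-part b {xs} {cs} {c} perm ap c∈ = (λ x∈ → ∈-resp-↭ perm (∈-concat⁺′ x∈ c∈)) , λ x∈ y∈ y∉ →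
    let d , y∈d , d∈ = ∈-concat⁻′ cs (∈-resp-↭ (↭-sym perm) y∈) in go ap c∈ d∈ x∈ y∈d y∉
    where
    go : ∀ {cs c d} → AllPairs (NoLinkL b) cs → c ∈ cs → d ∈ cs → ∀ {x y} → x ∈ c → y ∈ d → y ∉ c →
      NoLink {D = D} b y x
    go (a ∷ ap) (here refl) (here refl) x∈ y∈ y∉ = contradiction y∈ y∉
    go (a ∷ ap) (here refl) (there d∈)  x∈ y∈ y∉ = nolink-sym b (All.lookup a d∈ x∈ y∈)
    go (a ∷ ap) (there c∈)  (here refl) x∈ y∈ y∉ = All.lookup a c∈ y∈ x∈
    go (a ∷ ap) (there c∈)  (there d∈)  x∈ y∈ y∉ = go ap c∈ d∈ x∈ y∈ y∉

  Built : List (Fin n) → Set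
  Built xs = ∃[ t ] Proper t × Reads D t × leaves t ↭ xs

  -- Strongness is carried along because the hypothesis on cographs speaks only about nodes of the
  -- modular decomposition, that is, about strong modules.
  decompose : ∀ b xs → Unique xs → IsStrong G ⟦ xs ⟧ → ∃[ x ] x ∈ xs →
    (∀ c → Unique c → IsStrong G ⟦ c ⟧ → ∃[ x ] x ∈ c → length c < length xs → Built c) →
    Conn D b xs ⊎ Built xs
  decompose b xs u st (x , x∈) build with components b xs u
  ... | [] , perm , ps , ap with () ← ∈-resp-↭ (↭-sym perm) x∈
  ... | c ∷ [] , perm , (k , _) ∷ [] , ap =
    inj₁ (conn-↭ b (↭-trans (Perm.↭-reflexive (sym (ListP.++-identityʳ c))) perm) k)
  ... | cs@(c₁ ∷ c₂ ∷ _) , perm , ps , ap =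
    let ts , bs = trees cs id
        -- Components are merely unlinked. Sorting them by label turns this into the directed
        -- relation that `Reads` demands.
        us , q , cr , _ = sort-forest π b ts (comps bs ps) (reads bs) (nolinks bs ap)
    in inj₂ (node b us , node (subst (2 ≤_) (trans (sym (length-B bs)) (↭-length q)) (s≤s (s≤s z≤n)))
      (All-resp-↭ q (comps bs ps)) , node (All-resp-↭ q (reads bs)) cr ,
      ↭-trans (leavesF-↭ (↭-sym q)) (↭-trans (lvs bs) perm))
    where
    uniq : ∀ {c} → c ∈ cs → Unique c
    uniq c∈ = unique-concat cs (unique-↭ (↭-sym perm) u) c∈
      where
      unique-↭ : ∀ {xs ys : List (Fin n)} → xs ↭ ys → Unique xs → Unique ys
      unique-↭ = allPairs-↭ {R = _≢_} (λ p → p ∘ sym)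
      unique-concat : ∀ cs → Unique (concat cs) → ∀ {c} → c ∈ cs → Unique c
      unique-concat (c ∷ cs) u (here refl) = allPairs-++ˡ c u
      unique-concat (c ∷ cs) u (there c∈)  = unique-concat cs (allPairs-++ʳ c u) c∈
    shorter : ∀ {c} → c ∈ cs → length c < length xs
    shorter c∈ = subst (_ <_) (↭-length perm) (go cs ps (s≤s (s≤s z≤n)) c∈)
      where
      pos : ∀ {c : List (Fin n)} → ∃[ x ] x ∈ c → 0 < length c
      pos {_ ∷ _} _ = s≤s z≤n
      go : ∀ cs → All (Piece b) cs → 2 ≤ length cs → ∀ {c} → c ∈ cs → length c < length (concat cs)
      go (c ∷ []) _ (s≤s ()) _
      go (c ∷ d ∷ cs) (_ ∷ (_ , ne) ∷ _) _ (here refl) =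
        subst (length c <_) (sym (ListP.length-++ c))
        (ℕP.m<m+n (length c)
          (subst (0 <_) (sym (ListP.length-++ d)) (ℕP.≤-trans (pos ne) (ℕP.m≤m+n _ _))))
      go (c ∷ d ∷ cs) ((_ , ne) ∷ _) _ {e} (there e∈) =
        subst (length e <_) (sym (ListP.length-++ c))
        (ℕP.+-mono-≤ {1} (pos ne) (le (d ∷ cs) e∈))
        where
        le : ∀ cs → e ∈ cs → length e ≤ length (concat cs)
        le (c ∷ cs) (here refl) = subst (length c ≤_) (sym (ListP.length-++ c)) (ℕP.m≤m+n _ _)
        le (c ∷ cs) (there e∈)  =
          subst (length e ≤_) (sym (ListP.length-++ c))
          (ℕP.≤-trans (le cs e∈) (ℕP.m≤n+m _ (length c)))
    data Builts : List (List (Fin n)) → List (Tree (Fin n)) → Set where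
      []  : Builts [] []
      _∷_ : ∀ {c t ds ts} → Proper t × Reads D t × leaves t ↭ c → Builts ds ts →
        Builts (c ∷ ds) (t ∷ ts)
    trees : ∀ ds → (∀ {d} → d ∈ ds → d ∈ cs) → ∃[ ts ] Builts ds ts
    trees [] h = [] , []
    trees (d ∷ ds) h =
      let k , ne = All.lookup ps (h (here refl))
          t , b′ = build d (uniq (h (here refl)))
            (component-strong b st k (piece-part b perm ap (h (here refl)))) ne
                     (shorter (h (here refl)))
          ts , bs = trees ds (h ∘ there)
      in t ∷ ts , b′ ∷ bs
    length-B : ∀ {ds ts} → Builts ds ts → length ts ≡ length ds
    length-B []       = refl
    length-B (_ ∷ bs) = cong suc (length-B bs)
    comps : ∀ {ds ts} → Builts ds ts → All (Piece b) ds → All (Component π b) ts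
    comps [] [] = []
    comps {ts = t ∷ _} ((p , r , q) ∷ bs) ((k , _) ∷ ps) =
      (conn⇒rootNot b {t} p r (conn-↭ b (↭-sym q) k) , p) ∷ comps bs ps
    reads : ∀ {ds ts} → Builts ds ts → All (Reads D) ts
    reads [] = []
    reads ((_ , r , _) ∷ bs) = r ∷ reads bs
    lvs : ∀ {ds ts} → Builts ds ts → leavesF ts ↭ concat ds
    lvs [] = Perm.refl
    lvs ((_ , _ , q) ∷ bs) = ++⁺ q (lvs bs)
    nolink₁ : ∀ {c t ds ts} → leaves t ↭ c → Builts ds ts → All (NoLinkL b c) ds →
      All (NoLinkT {D = D} b t) ts
    nolink₁ q [] [] = []
    nolink₁ {t = t} q ((_ , _ , q′) ∷ bs) (a ∷ as) =
      (λ x∈ y∈ → a (∈-resp-↭ q x∈) (∈-resp-↭ q′ y∈)) ∷ nolink₁ {t = t} q bs as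
    nolinks : ∀ {ds ts} → Builts ds ts → AllPairs (NoLinkL b) ds → AllPairs (NoLinkT {D = D} b) ts
    nolinks [] [] = []
    nolinks {ts = t ∷ _} ((_ , _ , q) ∷ bs) (a ∷ ap) = nolink₁ {t = t} q bs a ∷ nolinks bs ap

  module _ (cograph : IsCograph G) where

    build : ∀ k xs → length xs ≤ k → Unique xs → IsStrong G ⟦ xs ⟧ → ∃[ x ] x ∈ xs → Built xs
    build _ [] _ _ _ (_ , ())
    build _ (x ∷ []) _ _ _ _ = leaf x , leaf , leaf , Perm.refl
    build (suc k) xs@(x ∷ y ∷ _) (s≤s l) u@((x≢y ∷ _) ∷ _) st ne
      with decompose false xs u st ne rec | decompose true xs u st ne rec
      where
      rec : ∀ c → Unique c → IsStrong G ⟦ c ⟧ → ∃[ x ] x ∈ c → length c < length xs → Built c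
      rec c u st ne lt = build k c (ℕP.≤-trans (ℕP.≤-pred lt) l) u st ne
    ... | inj₂ b  | _       = b
    ... | inj₁ _  | inj₂ b  = b
    -- A strong module with two elements, connected both in the graph and in its complement, would
    -- be a prime node.
    ... | inj₁ k₁ | inj₁ k₂ = contradiction
      ( ((x , ∈⟦⟧⁺ {xs = xs} (here refl)) , st) , two⇒1<∣∣ (∈⟦⟧⁺ {xs = xs} (here refl))
        (∈⟦⟧⁺ {xs = xs} (there (here refl))) x≢y)
      λ int → cograph ⟦ xs ⟧
        (int , conn⇒connected false G link⇒G k₁ , conn⇒connected true (G ᶜ) link⇒Gᶜ k₂)

  ⊤-strong : ∀ {xs : List (Fin n)} → (∀ x → x ∈ xs) → IsStrong G ⟦ xs ⟧
  ⊤-strong h = (λ v v∉ → contradiction (∈⟦⟧⁺ (h v)) v∉) ,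
    λ N _ (_ , _ , (z , z∈)) → ∉-─ N _ z∈ (∈⟦⟧⁺ (h z))

-- The 0-nodes of the graph and their children, found in the tree.

module _ {n} (π : Permutation′ n) where

  private
    D = D[ π ]
    G = G[ π ]

  open DecMem (FinP._≟_ {n}) using (_∈?_)

  child-part : ∀ {b ts t} → AllPairs (CrossT D b) ts → t ∈ ts → IsPart π b (leavesF ts) (leaves t)
  child-part {b} {t = t} ap t∈ with ∈-∃++ t∈
  ... | us , vs , refl = ∈-leavesF⁺ t∈ , λ x∈ y∈ y∉ → nolink-sym b (split-nolink b us {t} {vs} ap x∈
    (Sum.[ (λ y∈t → contradiction y∈t y∉) , id ]′ (∈-delete us {t} {vs} y∈)))

  child-strong : ∀ {b ts t} → All (Component π b) ts → All (Reads D) ts → AllPairs (CrossT D b) ts →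
    IsStrong G ⟦ leavesF ts ⟧ → t ∈ ts → IsStrong G ⟦ leaves t ⟧
  child-strong {b} ps rs ap st t∈ = component-strong π b st
    (let r , p = All.lookup ps t∈ in conn b p (All.lookup rs t∈) r) (child-part ap t∈)

  -- Suppose T meets a child t but is neither inside t nor everything. Children are strong, so T
  -- contains t, and it misses a vertex w of another child u. A point y of T outside t is not in u
  -- either, since T would then contain u. Now t ∪ u is a module, being a union of components, and
  -- it overlaps T: x is common, y lies only in T and w only in the union.
  descend : ∀ {b ts} → All (Component π b) ts → All (Reads D) ts → AllPairs (CrossT D b) ts →
    IsStrong G ⟦ leavesF ts ⟧ → ∀ {T} → IsNode G T → T ⊆ ⟦ leavesF ts ⟧ →
    T ≡ ⟦ leavesF ts ⟧ ⊎ (∃[ t ] t ∈ ts × T ⊆ ⟦ leaves t ⟧)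
  descend {b} {ts} ps rs ap st {T} ((x , x∈T) , (mT , stT)) T⊆
    with ∈-leavesF⁻ ts (∈⟦⟧⁻ (T⊆ x∈T))
  ... | t , t∈ , x∈t with T SubP.⊆? ⟦ leaves t ⟧
  ... | yes T⊆t = inj₂ (t , t∈ , T⊆t)
  ... | no T⊈t with ⟦ leavesF ts ⟧ SubP.⊆? T
  ... | yes S⊆T = inj₁ (subset-ext T⊆ S⊆T)
  ... | no S⊈T = ⊥-elim (stT N mN
          ( ∈-∩ {S = T} {N} x∈T (∈⟦⟧⁺ (∈-++⁺ˡ x∈t))
          , ∈-─ y∈T (Sum.[ y∉t , y∉u ]′ ∘ ∈-++⁻ (leaves t) ∘ ∈⟦⟧⁻)
          , ∈-─ (∈⟦⟧⁺ {xs = leaves t ++ leaves u} (∈-++⁺ʳ (leaves t) w∈u)) w∉T))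
    where
    missing = subset-missing T⊈t
    y = proj₁ missing
    y∈T = proj₁ (proj₂ missing)
    y∉t : y ∉ leaves t
    y∉t = proj₂ (proj₂ missing) ∘ ∈⟦⟧⁺
    missing′ = subset-missing S⊈T
    w = proj₁ missing′
    w∈S = ∈⟦⟧⁻ (proj₁ (proj₂ missing′))
    w∉T = proj₂ (proj₂ missing′)
    u = proj₁ (∈-leavesF⁻ ts w∈S)
    u∈ = proj₁ (proj₂ (∈-leavesF⁻ ts w∈S))
    w∈u = proj₂ (proj₂ (∈-leavesF⁻ ts w∈S))
    -- Otherwise T would overlap the strong module v.
    contains : ∀ {v} → v ∈ ts → ∀ {z} → z ∈ leaves v → z Sub.∈ T → ∀ {z′} → z′ Sub.∈ T →
      z′ ∉ leaves v →
      ⟦ leaves v ⟧ ⊆ T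
    contains {v} v∈ z∈v z∈T z′∈T z′∉v {s} s∈ = decidable-stable (s SubP.∈? T) λ s∉ →
      proj₂ (child-strong ps rs ap st v∈) T mT
        (∈-∩ {S = ⟦ leaves v ⟧} {T} (∈⟦⟧⁺ z∈v) z∈T , ∈-─ s∈ s∉ , ∈-─ z′∈T (z′∉v ∘ ∈⟦⟧⁻))
    w∉t : w ∉ leaves t
    w∉t w∈t = w∉T (contains t∈ x∈t x∈T y∈T y∉t (∈⟦⟧⁺ w∈t))
    -- A child u that meets t lies inside t, because u is connected and no link leaves t; but w is
    -- not in t.
    x∉u : x ∉ leaves u
    x∉u x∈u = w∉t (conn b (proj₂ (All.lookup ps u∈)) (All.lookup rs u∈) (proj₁ (All.lookup ps u∈))
      (_∈ leaves t) (λ {_} {q} _ q∈ p∈t l → decidable-stable (q ∈? leaves t) λ q∉ →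
        proj₂ (proj₂ (child-part ap t∈) p∈t (∈-leavesF⁺ u∈ q∈) q∉) (link-sym b l)) x∈u w∈u x∈t)
    y∉u : y ∉ leaves u
    y∉u y∈u = w∉T (contains u∈ y∈u y∈T x∈T x∉u (∈⟦⟧⁺ w∈u))
    N : Subset n
    N = ⟦ leaves t ++ leaves u ⟧
    mN : IsModule G N
    mN = part-module π b (proj₁ st)
      ((λ z∈ → Sum.[ ∈-leavesF⁺ t∈ , ∈-leavesF⁺ u∈ ]′ (∈-++⁻ (leaves t) z∈)) ,
      λ z∈ s∈ s∉ → Sum.[ (λ z∈t → proj₂ (child-part ap t∈) z∈t s∈ (s∉ ∘ ∈-++⁺ˡ))
                       , (λ z∈u → proj₂ (child-part ap u∈) z∈u s∈ (s∉ ∘ ∈-++⁺ʳ (leaves t))) ]′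
                         (∈-++⁻ (leaves t) z∈))

  zeroNodes  : Tree (Fin n) → List (Subset n)
  zeroNodesF : List (Tree (Fin n)) → List (Subset n)
  zeroNodes (leaf x)        = []
  zeroNodes (node true ts)  = zeroNodesF ts
  zeroNodes (node false ts) = ⟦ leavesF ts ⟧ ∷ zeroNodesF ts
  zeroNodesF []       = []
  zeroNodesF (t ∷ ts) = zeroNodes t ++ zeroNodesF ts

  StrongT : Tree (Fin n) → Set
  StrongT t = IsStrong G ⟦ leaves t ⟧

  InternalZero : Tree (Fin n) → Subset n → Set
  InternalZero t S = ZeroNode G S × S ⊆ ⟦ leaves t ⟧

  ⟦⟧-mono : ∀ {xs ys : List (Fin n)} → (∀ {x} → x ∈ xs → x ∈ ys) → ⟦ xs ⟧ ⊆ ⟦ ys ⟧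
  ⟦⟧-mono h = ∈⟦⟧⁺ ∘ h ∘ ∈⟦⟧⁻

  zeroNode-root : ∀ {ts} → Proper (node false ts) → Reads D (node false ts) →
    StrongT (node false ts) →
    ZeroNode G ⟦ leavesF ts ⟧
  zeroNode-root {t ∷ ts} p@(node l ((r , q) ∷ ps)) rd@(node rs ap) st =
    ((((x , ∈⟦⟧⁺ (∈-++⁺ˡ x∈)) , st) , two⇒1<∣∣ (∈⟦⟧⁺ (∈-++⁺ˡ x∈)) (∈⟦⟧⁺ (∈-++⁺ʳ (leaves t) y∈))
      (proj₁ nl)) ,
      λ k → proj₁ (split-nolink false [] {t} {ts} ap
        (star-stays π (child-part ap (here refl)) ∈⟦⟧⁻
          (k (x , ∈⟦⟧⁺ (∈-++⁺ˡ x∈)) (y , ∈⟦⟧⁺ (∈-++⁺ʳ (leaves t) y∈))) x∈)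
        y∈) refl)
    where
    x = proj₁ (nonempty q)
    x∈ = proj₂ (nonempty q)
    other = other-leaf [] {t} {ts} l ((r , q) ∷ ps)
    y = proj₁ other
    y∈ = proj₂ other
    nl = split-nolink false [] {t} {ts} ap x∈ y∈

  ¬oneNode-root : ∀ {t} → Proper t → Reads D t → RootNot false t → ¬ ZeroNode G ⟦ leaves t ⟧
  ¬oneNode-root p r q (_ , ¬k) = ¬k (conn⇒connected π false G (link⇒G π) (conn false p r q))

  -- By `descend`, a 0-node inside the tree is the root set or lies inside a child. A root of colour
  -- `true` is connected and hence excluded. A root of colour `false` is disconnected, and it is
  -- listed only once, as it has a leaf outside each child.
  zeroNodes-listing : ∀ t → Proper t → Reads D t → StrongT t →
    Listing (InternalZero t) (zeroNodes t)
  zeroNodesF-listing : ∀ b ts → All (Component π b) ts → All (Reads D) ts →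
    AllPairs (CrossT D b) ts → All StrongT ts →
    Listing (λ S → ∃[ t ] t ∈ ts × InternalZero t S) (zeroNodesF ts)
  zeroNodes-listing (leaf x) p r st = record
    { unique = [] ; sound = λ () ; complete = λ { {S} (((_ , 1<) , _) , S⊆) →
        contradiction 1< (⊆-singleton λ y∈ → single (∈⟦⟧⁻ (S⊆ y∈))) } }
    where
    single : ∀ {y} → y ∈ x ∷ [] → y ≡ x
    single (here e) = e
  zeroNodes-listing (node b ts) p@(node l ps) r@(node rs ap) st = go b ps ap p r st
    where
    strongs : ∀ b → All (Component π b) ts → AllPairs (CrossT D b) ts → StrongT (node b ts) →
      All StrongT ts
    strongs b ps ap st = All.tabulate (child-strong ps rs ap st)
    up : ∀ {S t} → t ∈ ts → S ⊆ ⟦ leaves t ⟧ → S ⊆ ⟦ leavesF ts ⟧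
    up t∈ S⊆ = ⟦⟧-mono (∈-leavesF⁺ t∈) ∘ S⊆
    below : ∀ {S} → ∃[ t ] t ∈ ts × InternalZero t S → ZeroNode G S × S ⊆ ⟦ leavesF ts ⟧
    below (t , t∈ , z , S⊆) = z , λ x∈ → up t∈ S⊆ x∈
    go : ∀ b → All (Component π b) ts → AllPairs (CrossT D b) ts → Proper (node b ts) →
      Reads D (node b ts) →
      StrongT (node b ts) → Listing (InternalZero (node b ts)) (zeroNodes (node b ts))
    go true ps ap p r st =
      listing-resp below above (zeroNodesF-listing true ts ps rs ap (strongs true ps ap st))
      where
      above : ∀ {S} → InternalZero (node true ts) S → ∃[ t ] t ∈ ts × InternalZero t S
      above (z , S⊆) with descend ps rs ap st (proj₁ (proj₁ z)) S⊆
      ... | inj₁ refl           = contradiction z (¬oneNode-root p r λ ())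
      ... | inj₂ (t , t∈ , S⊆t) = t , t∈ , z , λ x∈ → S⊆t x∈
    go false ps ap p r st = record
      { unique   = All.tabulate notBelow ∷ unique L
      ; sound    = λ where
          (here refl) → zeroNode-root p r st , id
          (there S∈)  → below (sound L S∈)
      ; complete = above
      }
      where
      L = zeroNodesF-listing false ts ps rs ap (strongs false ps ap st)
      above : ∀ {S} → InternalZero (node false ts) S → S ∈ ⟦ leavesF ts ⟧ ∷ zeroNodesF ts
      above (z , S⊆) with descend ps rs ap st (proj₁ (proj₁ z)) S⊆
      ... | inj₁ eq             = here eq
      ... | inj₂ (t , t∈ , S⊆t) = there (complete L (t , t∈ , z , S⊆t))
      notBelow : ∀ {S} → S ∈ zeroNodesF ts → ⟦ leavesF ts ⟧ ≢ S
      notBelow S∈ refl with sound L S∈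
      ... | t , t∈ , _ , S⊆ with ∈-∃++ t∈
      ... | us , vs , refl with other-leaf us l ps
      ... | y , y∈ = proj₁ (split-nolink false us {t} {vs} ap
              (∈⟦⟧⁻ (S⊆ (∈⟦⟧⁺ (∈-insert us {t} {vs} (inj₂ y∈))))) y∈) refl
  zeroNodesF-listing b [] ps rs ap sts = record
    { unique = [] ; sound = λ () ; complete = λ () }
  zeroNodesF-listing b (t ∷ ts) ((q , p) ∷ ps) (r ∷ rs) (a ∷ ap) (st ∷ sts) = record
    { unique   = UniqueP.++⁺ (unique L) (unique L′) λ (S∈ , S∈′) →
        let (((((x , x∈) , _) , _) , _) , S⊆) = sound L S∈
            u , u∈ , _ , S⊆′ = sound L′ S∈′
        in cross⇒≢ b (All.lookup a u∈ (∈⟦⟧⁻ (S⊆ x∈)) (∈⟦⟧⁻ (S⊆′ x∈))) refl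
    ; sound    = snd
    ; complete = λ where
        (_ , here refl , z) → ∈-++⁺ˡ (complete L z)
        (u , there u∈ , z)  → ∈-++⁺ʳ (zeroNodes t) (complete L′ (u , u∈ , z))
    }
    where
    L  = zeroNodes-listing t p r st
    L′ = zeroNodesF-listing b ts ps rs ap sts
    snd : ∀ {S} → S ∈ zeroNodes t ++ zeroNodesF ts → ∃[ u ] u ∈ t ∷ ts × InternalZero u S
    snd S∈ with ∈-++⁻ (zeroNodes t) S∈
    ... | inj₁ S∈ = t , here refl , sound L S∈
    ... | inj₂ S∈ with sound L′ S∈
    ... | u , u∈ , z = u , there u∈ , z

  children : List (Tree (Fin n)) → List (Subset n)
  children = map (λ t → ⟦ leaves t ⟧)

  children-listing : ∀ ts → Proper (node false ts) → Reads D (node false ts) →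
    StrongT (node false ts) →
    Listing (Child G ⟦ leavesF ts ⟧) (children ts)
  children-listing ts p@(node l ps) r@(node rs ap) st = record
    { unique   = uniq ps ap
    ; sound    = λ C∈ → let t , t∈ , e = ∈-map⁻ (λ t → ⟦ leaves t ⟧) C∈
                        in subst (Child G ⟦ leavesF ts ⟧) (sym e) (ofZero z (isComp t∈))
    ; complete = cmp
    }
    where
    z : ZeroNode G ⟦ leavesF ts ⟧
    z = zeroNode-root p r st
    uniq : ∀ {ts} → All (Component π false) ts → AllPairs (CrossT D false) ts → Unique (children ts)
    uniq [] [] = []
    uniq {t ∷ ts} ((_ , p) ∷ ps) (a ∷ ap) = AllP.map⁺ (All.tabulate λ {u} u∈ e →
      let x , x∈ = nonempty p
      in cross⇒≢ {D = D} false (All.lookup a u∈ x∈ (∈⟦⟧⁻ (subst (x Sub.∈_) e (∈⟦⟧⁺ x∈)))) refl) ∷ uniq ps ap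
    isComp : ∀ {t} → t ∈ ts → IsComponent G ⟦ leavesF ts ⟧ ⟦ leaves t ⟧
    isComp {t} t∈ = (x , sub (∈⟦⟧⁺ x∈)) , λ v → mk⇔
      (λ v∈ → sub v∈ , conn⇒star π false G (link⇒G π) (sub ∘ ∈⟦⟧⁺) k x∈ (∈⟦⟧⁻ v∈) _ _)
      (λ (v∈ , s) → ∈⟦⟧⁺ (star-stays π (child-part ap t∈) ∈⟦⟧⁻ s x∈))
      where
      p′ = proj₂ (All.lookup ps t∈)
      k = conn false p′ (All.lookup rs t∈) (proj₁ (All.lookup ps t∈))
      x = proj₁ (nonempty p′)
      x∈ = proj₂ (nonempty p′)
      sub : ⟦ leaves t ⟧ ⊆ ⟦ leavesF ts ⟧
      sub = ⟦⟧-mono (∈-leavesF⁺ t∈)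
    cmp : ∀ {C} → Child G ⟦ leavesF ts ⟧ C → C ∈ children ts
    -- The set is disconnected, so its children can only be components.
    cmp (ofOne (_ , k , _) _) = contradiction k (proj₂ z)
    cmp (ofPrime (_ , k , _) _ _) = contradiction k (proj₂ z)
    cmp {C} (ofZero _ ((u , u∈) , h)) with ∈-leavesF⁻ ts (∈⟦⟧⁻ u∈)
    ... | t , t∈ , u∈t =
      subst (_∈ children ts) (subset-ext from′ to′) (∈-map⁺ (λ t → ⟦ leaves t ⟧) t∈)
      where
      sub : ⟦ leaves t ⟧ ⊆ ⟦ leavesF ts ⟧
      sub = ⟦⟧-mono (∈-leavesF⁺ t∈)
      k = conn false (proj₂ (All.lookup ps t∈)) (All.lookup rs t∈) (proj₁ (All.lookup ps t∈))
      from′ : ∀ {i} → i Sub.∈ ⟦ leaves t ⟧ → i Sub.∈ C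
      from′ {i} i∈ = Equivalence.from (h i) (sub i∈ ,
        conn⇒star π false G (link⇒G π) (sub ∘ ∈⟦⟧⁺) k u∈t (∈⟦⟧⁻ i∈) u∈ (sub i∈))
      to′ : ∀ {i} → i Sub.∈ C → i Sub.∈ ⟦ leaves t ⟧
      to′ {i} i∈ = ∈⟦⟧⁺ (star-stays π (child-part ap t∈) ∈⟦⟧⁻ (proj₂ (Equivalence.to (h i) i∈)) u∈t)

-- Isomorphisms as functions and as relations between lists.

module _ {A B X Y : Set} {D : Rel A 0ℓ} {D′ : Rel B 0ℓ} {xs : List A} {ys : List B} (e : X → A) (e′ : Y → B)
  (e-inj : ∀ {x x′} → e x ≡ e x′ → x ≡ x′) (e′-inj : ∀ {y y′} → e′ y ≡ e′ y′ → y ≡ y′)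
  (e-in : ∀ x → e x ∈ xs) (e′-in : ∀ y → e′ y ∈ ys)
  (e-onto : ∀ {a} → a ∈ xs → ∃[ x ] e x ≡ a) (e′-onto : ∀ {b} → b ∈ ys → ∃[ y ] e′ y ≡ b) where

  -- Used with `proj₁` for the subdigraphs induced by two sets of leaves, and with `id` for digraphs
  -- on all of `Fin n`.
  ≅⇒iso : (D on e) ≅ (D′ on e′) → ∃[ F ] Iso D D′ xs ys F
  ≅⇒iso (f , iso) = (λ a b → ∃[ x ] e x ≡ a × e′ (f x) ≡ b) , record
    { total = λ a∈ → let x , p = e-onto a∈ in e′ (f x) , e′-in _ , x , p , refl
    ; onto  = λ b∈ → let y , q = e′-onto b∈
                         x , p = IsOrderIsomorphism.surjective iso y
                     in e x , e-in x , x , refl , trans (cong e′ (p refl)) q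
    ; same  = λ { _ _ _ _ (x , refl , refl) (x′ , refl , refl) → record
        { eq→  = λ p → cong (e′ ∘ f) (e-inj p)
        ; eq←  = λ p → cong e (IsOrderIsomorphism.injective iso (e′-inj p))
        ; to   = IsOrderIsomorphism.mono iso
        ; from = IsOrderIsomorphism.cancel iso } }
    }

  iso⇒≅ : ∀ {F} → Iso D D′ xs ys F → (D on e) ≅ (D′ on e′)
  iso⇒≅ {F} i = f , record
    { isOrderMonomorphism = record
      { isOrderHomomorphism = record { cong = cong f ; mono = λ {x} {x′} → to (s x x′) }
      ; injective = λ {x} {x′} p → e-inj (eq← (s x x′) (cong e′ p))
      ; cancel    = λ {x} {x′} → from (s x x′)
      }
    ; surjective = surj
    }
    where
    img : ∀ x → ∃[ y ] F (e x) (e′ y)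
    img x = let b , b∈ , g = total i (e-in x)
                y , p = e′-onto b∈
            in y , subst (F (e x)) (sym p) g
    f : X → Y
    f = proj₁ ∘ img
    s : ∀ x x′ → Same D D′ (e x) (e x′) (e′ (f x)) (e′ (f x′))
    s x x′ = same i (e-in x) (e-in x′) (e′-in _) (e′-in _) (proj₂ (img x)) (proj₂ (img x′))
    surj : ∀ y → ∃[ x ] ∀ {x′} → x′ ≡ x → f x′ ≡ y
    surj y = let a , a∈ , g = onto i (e′-in y)
                 x , p = e-onto a∈
             in x , λ { refl → e′-inj (eq→ (same i (e-in x) a∈ (e′-in _) (e′-in y) (proj₂ (img x)) g) p) }

≅-id : {A : Set} {D E : Rel A 0ℓ} → (∀ {x y} → D x y → E x y) → (∀ {x y} → E x y → D x y) → D ≅ E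
≅-id f g = id , record
  { isOrderMonomorphism = record
    { isOrderHomomorphism = record { cong = id ; mono = f } ; injective = id ; cancel = g }
  ; surjective = λ y → y , id }

-- Counting the shapes equivalent to that of a tree.

length-concat-const : ∀ {A B : Set} (f : A → List B) (xs : List A) {L} →
  (∀ {x} → x ∈ xs → length (f x) ≡ L) →
  length (concat (map f xs)) ≡ length xs * L
length-concat-const f []       h = refl
length-concat-const f (x ∷ xs) h = trans (ListP.length-++ (f x))
  (cong₂ _+_ (h (here refl)) (length-concat-const f xs (h ∘ there)))

module _ {A B : Set} {R : A → B → Set} {τ} (ps : List (A × Fin τ))
  (coherent : ∀ {p q y} → p ∈ ps → q ∈ ps → proj₂ p ≡ proj₂ q → R (proj₁ p) y → R (proj₁ q) y)
  (separated : ∀ {p q y} → p ∈ ps → q ∈ ps → R (proj₁ p) y → R (proj₁ q) y → proj₂ p ≡ proj₂ q)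
  (rep : ∀ j → ∃[ x ] (x , j) ∈ ps)
  (N : A → ℕ) (card : ∀ {p} → p ∈ ps → HasCard (R (proj₁ p)) (N (proj₁ p)))
  where

  private
    types = map proj₂ ps

    OfType : Fin τ → B → Set
    OfType j = R (proj₁ (rep j))

    ofType-card : ∀ j → HasCard (OfType j) (N (proj₁ (rep j)))
    ofType-card j = card (proj₂ (rep j))

    same-card : ∀ {p} → p ∈ ps → N (proj₁ (rep (proj₂ p))) ≡ N (proj₁ p)
    same-card {p} p∈ = card-unique (card r∈) (proj₁ c ,
      listing-resp (coherent p∈ r∈ refl) (coherent r∈ p∈ refl) (proj₁ (proj₂ c)) , proj₂ (proj₂ c))
      where
      c = card p∈
      r∈ = proj₂ (rep (proj₂ p))

    toTypes : ∀ {qs ys} → (∀ {q} → q ∈ qs → q ∈ ps) → Pointwise R (map proj₁ qs) ys →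
      Pointwise OfType (map proj₂ qs) ys
    toTypes {[]} h [] = []
    toTypes {q ∷ qs} h (r ∷ rs) =
      coherent (h (here refl)) (proj₂ (rep (proj₂ q))) refl r ∷ toTypes (h ∘ there) rs

    fromTypes : ∀ {qs ys} → (∀ {q} → q ∈ qs → q ∈ ps) → Pointwise OfType (map proj₂ qs) ys →
      Pointwise R (map proj₁ qs) ys
    fromTypes {[]} h [] = []
    fromTypes {q ∷ qs} h (r ∷ rs) =
      coherent (proj₂ (rep (proj₂ q))) (h (here refl)) refl r ∷ fromTypes (h ∘ there) rs

    types-unique : ∀ {v w ys} → Pointwise OfType v ys → Pointwise OfType w ys → v ≡ w
    types-unique [] [] = refl
    types-unique (_∷_ {x = i} r rs) (_∷_ {x = j} s ss) =
      cong₂ _∷_ (separated (proj₂ (rep i)) (proj₂ (rep j)) r s) (types-unique rs ss)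

    product-types : ∀ {qs} → (∀ {q} → q ∈ qs → q ∈ ps) →
      product (map (N ∘ proj₁ ∘ rep) (map proj₂ qs)) ≡ product (map N (map proj₁ qs))
    product-types {[]} h = refl
    product-types {q ∷ qs} h = cong₂ _*_ (same-card (h (here refl))) (product-types (h ∘ there))

  -- A rearranged list determines its word of types, since entries related to the same y have the
  -- same type. Over a fixed word the entries are chosen independently. The number of choices is a
  -- product over the letters, hence the same for all words, which are permutations of one another.
  rearrangements-card : ∀ k (m : Fin τ → ℕ) → length types ≡ k → (∀ j → occ j types ≡ m j) →
    HasCard (λ zs → ∃[ ys ] Pointwise R (map proj₁ ps) ys × ys ↭ zs)
      (multinomial k m * product (map N (map proj₁ ps)))
  rearrangements-card k m len e with ↭-card k types m len e
  ... | ws , L , l = concat (map f ws) , record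
    { unique   = UniqueP.concat⁺ (AllP.map⁺ (All.tabulate λ {w} _ → unique (cart w)))
      (disjoint (unique L))
    ; sound    = snd
    ; complete = cmp
    } , trans (length-concat-const f ws λ {w} w∈ → trans (proj₂ (proj₂ (cart-card w)))
          (trans (ActP.product-↭ (PermP.map⁺ (N ∘ proj₁ ∘ rep) (sound L w∈))) (product-types id)))
        (cong (_* product (map N (map proj₁ ps))) l)
    where
    cart-card : ∀ w → HasCard (Pointwise OfType w) (product (map (N ∘ proj₁ ∘ rep) w))
    cart-card w = cartesian-card w (All.tabulate λ {j} _ → ofType-card j)
    f : List (Fin τ) → List (List B)
    f w = proj₁ (cart-card w)
    cart : ∀ w → Listing (Pointwise OfType w) (f w)
    cart w = proj₁ (proj₂ (cart-card w))
    disjoint : ∀ {ws} → Unique ws → AllPairs (λ xs ys → ∀ {z} → ¬ (z ∈ xs × z ∈ ys)) (map f ws)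
    disjoint [] = []
    disjoint {v ∷ ws} (v∉ ∷ u) = AllP.map⁺ (All.tabulate λ {w} w∈ (z∈ , z∈′) →
      All.lookup v∉ w∈ (types-unique (sound (cart v) z∈) (sound (cart w) z∈′))) ∷ disjoint u
    snd : ∀ {zs} → zs ∈ concat (map f ws) → ∃[ ys ] Pointwise R (map proj₁ ps) ys × ys ↭ zs
    snd zs∈ with ∈-concat⁻′ (map f ws) zs∈
    ... | _ , z∈ , l∈ with ∈-map⁻ f l∈
    ... | w , w∈ , refl =
      let ys , pw , q = pointwise-↭ (↭-sym (sound L w∈)) (sound (cart w) z∈) in ys , fromTypes id pw , q
    cmp : ∀ {zs} → (∃[ ys ] Pointwise R (map proj₁ ps) ys × ys ↭ zs) → zs ∈ concat (map f ws)
    cmp (ys , pw , q) = let w , q′ , pw′ = pointwise-↭ʳ (toTypes id pw) q in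
      ∈-concat⁺′ (complete (cart w) pw′) (∈-map⁺ f (complete L (↭-sym q′)))

module _ {A C : Set} {P : C → Set} {τ : ℕ} (c : A → C) (label : ∃ P → Fin τ)
  (label-irrelevant : ∀ {x} (p q : P x) → label (x , p) ≡ label (x , q)) where

  -- The field `type` of `IsoClasses` depends on a proof of being a child. Each tree is therefore
  -- labelled through a chosen proof, and `label-irrelevant` allows any other to be used in its
  -- place.
  labelled : ∀ xs → All (P ∘ c) xs → List (A × Fin τ)
  labelled []       []       = []
  labelled (x ∷ xs) (p ∷ ps) = (x , label (c x , p)) ∷ labelled xs ps

  labelled-proj₁ : ∀ xs ps → map proj₁ (labelled xs ps) ≡ xs
  labelled-proj₁ []       []       = refl
  labelled-proj₁ (x ∷ xs) (p ∷ ps) = cong (x ∷_) (labelled-proj₁ xs ps)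

  ∈-labelled : ∀ xs ps {q} → q ∈ labelled xs ps →
    Σ[ p ∈ P (c (proj₁ q)) ] label (c (proj₁ q) , p) ≡ proj₂ q × proj₁ q ∈ xs
  ∈-labelled (x ∷ xs) (p ∷ ps) (here refl) = p , refl , here refl
  ∈-labelled (x ∷ xs) (p ∷ ps) (there q∈)  = let p′ , e , x∈ = ∈-labelled xs ps q∈ in p′ , e , there x∈

  labelled-∈ : ∀ xs ps {x} → x ∈ xs → (p : P (c x)) → (x , label (c x , p)) ∈ labelled xs ps
  labelled-∈ (x ∷ xs) (p ∷ ps) (here refl) p′ = here (cong (x ,_) (label-irrelevant p′ p))
  labelled-∈ (x ∷ xs) (p ∷ ps) (there x∈)  p′ = there (labelled-∈ xs ps x∈ p′)

  withLabel : Fin τ → ∀ xs → All (P ∘ c) xs → List C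
  withLabel j [] [] = []
  withLabel j (x ∷ xs) (p ∷ ps) with j FinP.≟ label (c x , p)
  ... | yes _ = c x ∷ withLabel j xs ps
  ... | no _  = withLabel j xs ps

  occ-labelled : ∀ j xs ps → occ j (map proj₂ (labelled xs ps)) ≡ length (withLabel j xs ps)
  occ-labelled j [] [] = refl
  occ-labelled j (x ∷ xs) (p ∷ ps) with j FinP.≟ label (c x , p)
  ... | yes _ = cong suc (occ-labelled j xs ps)
  ... | no _  = occ-labelled j xs ps

  withLabel-sound : ∀ j xs ps {y} → y ∈ withLabel j xs ps →
    y ∈ map c xs × Σ[ p ∈ P y ] label (y , p) ≡ j
  withLabel-sound j (x ∷ xs) (p ∷ ps) y∈ with j FinP.≟ label (c x , p) | y∈
  ... | yes e | here refl = here refl , p , sym e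
  ... | yes e | there y∈′ = let y∈ , h = withLabel-sound j xs ps y∈′ in there y∈ , h
  ... | no _  | y∈′       = let y∈ , h = withLabel-sound j xs ps y∈′ in there y∈ , h

  withLabel-complete : ∀ j xs ps {y} → y ∈ map c xs → (p : P y) → label (y , p) ≡ j →
    y ∈ withLabel j xs ps
  withLabel-complete j (x ∷ xs) (p ∷ ps) y∈ p′ e with j FinP.≟ label (c x , p) | y∈
  ... | yes _ | here refl = here refl
  ... | no ¬e | here refl = contradiction (trans (sym e) (label-irrelevant p′ p)) ¬e
  ... | yes _ | there y∈′ = there (withLabel-complete j xs ps y∈′ p′ e)
  ... | no _  | there y∈′ = withLabel-complete j xs ps y∈′ p′ e

  withLabel-unique : ∀ j xs ps → Unique (map c xs) → Unique (withLabel j xs ps)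
  withLabel-unique j [] [] u = []
  withLabel-unique j (x ∷ xs) (p ∷ ps) (x∉ ∷ u) with j FinP.≟ label (c x , p)
  ... | yes _ = All.tabulate (λ y∈ → All.lookup x∉ (proj₁ (withLabel-sound j xs ps y∈))) ∷
    withLabel-unique j xs ps u
  ... | no _  = withLabel-unique j xs ps u

  withLabel-listing : ∀ j xs ps → Listing P (map c xs) →
    Listing (λ y → Σ[ p ∈ P y ] label (y , p) ≡ j) (withLabel j xs ps)
  withLabel-listing j xs ps L = record
    { unique   = withLabel-unique j xs ps (unique L)
    ; sound    = proj₂ ∘ withLabel-sound j xs ps
    ; complete = λ (p , e) → withLabel-complete j xs ps (complete L p) p e
    }

pointwise-shapes⁺ : ∀ {A : Set} {ts : List (Tree A)} {us} → Pointwise (λ t s → shape t ≈ s) ts us →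
  Pointwise _≈_ (shapes ts) us
pointwise-shapes⁺ []       = []
pointwise-shapes⁺ (r ∷ rs) = r ∷ pointwise-shapes⁺ rs

pointwise-shapes⁻ : ∀ {A : Set} (ts : List (Tree A)) {us} → Pointwise _≈_ (shapes ts) us →
  Pointwise (λ t s → shape t ≈ s) ts us
pointwise-shapes⁻ []       []       = []
pointwise-shapes⁻ (t ∷ ts) (r ∷ rs) = r ∷ pointwise-shapes⁻ ts rs

module _ {n} (π : Permutation′ n) where

  private
    D = D[ π ]
    G = G[ π ]

  private
    inj : ∀ {S : Subset n} {x x′ : ∃ (Sub._∈ S)} → proj₁ x ≡ proj₁ x′ → x ≡ x′
    inj {x = _ , p} {_ , q} refl = cong (_ ,_) (∈-irrelevant p q)

  restrict-iso⇒≈ : ∀ {t u} → Proper t → Reads D t → Proper u → Reads D u →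
    D ↾ ⟦ leaves t ⟧ ≅ D ↾ ⟦ leaves u ⟧ → shape t ≈ shape u
  restrict-iso⇒≈ {t} {u} p r p′ r′ i =
    iso⇒≈ {_<_ = λ _ _ → ⊥} {_<′_ = λ _ _ → ⊥} false (λ ()) (λ ()) t u p r p′ r′
      (proj₂ (≅⇒iso {D = D} {D} {leaves t} {leaves u} proj₁ proj₁ inj inj (∈⟦⟧⁻ ∘ proj₂)
        (∈⟦⟧⁻ ∘ proj₂)
        (λ a∈ → (_ , ∈⟦⟧⁺ a∈) , refl) (λ a∈ → (_ , ∈⟦⟧⁺ a∈) , refl) i)) (λ ()) (λ ())

  ≈⇒restrict-iso : ∀ {t u} → Reads D t → Reads D u → shape t ≈ shape u →
    D ↾ ⟦ leaves t ⟧ ≅ D ↾ ⟦ leaves u ⟧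
  ≈⇒restrict-iso {t} {u} r r′ s =
    iso⇒≅ {D = D} {D} {leaves t} {leaves u} proj₁ proj₁ inj inj (∈⟦⟧⁻ ∘ proj₂) (∈⟦⟧⁻ ∘ proj₂)
      (λ a∈ → (_ , ∈⟦⟧⁺ a∈) , refl) (λ a∈ → (_ , ∈⟦⟧⁺ a∈) , refl)
      (proj₂ (≈⇒iso (D-irrefl π) (D-irrefl π) t u r r′ s))

  -- What the theorem assumes about one 0-node. The weight is a function of the vertex set, so that
  -- the product over the tree and the product over the given enumeration are products over permuted
  -- lists.
  record ZeroData (w : Subset n → ℕ) (S : Subset n) : Set where
    field
      k : ℕ
      τ : ℕ
      m : Fin τ → ℕ
      children-enum : Enumeration (Subsets n) (Child G S) k
      classes : IsoClasses D (Child G S) τ m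
      weight : w S ≡ multinomial k m

  module _ (w : Subset n → ℕ) (zeroData : ∀ {S} → ZeroNode G S → ZeroData w S) where

    weight : Tree (Fin n) → ℕ
    weight t = product (map w (zeroNodes π t))

    product-weights : ∀ ts → product (map weight ts) ≡ product (map w (zeroNodesF π ts))
    product-weights []       = refl
    product-weights (t ∷ ts) = trans (cong (weight t *_) (product-weights ts))
      (trans (sym (ActP.product-++ (map w (zeroNodes π t)) _))
        (cong product (sym (ListP.map-++ w (zeroNodes π t) (zeroNodesF π ts)))))

    card-node : ∀ {b N} {ts : List (Tree (Fin n))} {P : List Shape → Set} → HasCard P N →
      (∀ {us} → P us → node b (shapes ts) ≈ node b us) →
      (∀ {us} → node b (shapes ts) ≈ node b us → P us) → HasCard (shape (node b ts) ≈_) N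
    card-node {b} {ts = ts} {P} (xs , L , l) f g = map (node b) xs , record
      { unique   = UniqueP.map⁺ (λ e → proj₂ (node-injective e)) (unique L)
      ; sound    = λ s∈ → snd (∈-map⁻ (node b) s∈)
      ; complete = cmp
      } , trans (ListP.length-map (node b) xs) l
      where
      snd : ∀ {s} → ∃[ us ] us ∈ xs × s ≡ node b us → node b (shapes ts) ≈ s
      snd (us , us∈ , refl) = f (sound L us∈)
      cmp : ∀ {s} → node b (shapes ts) ≈ s → s ∈ map (node b) xs
      cmp e@(node _ _) = ∈-map⁺ (node b) (complete L (g e))

    -- Two children have the same isomorphism type iff their shapes are equivalent, by
    -- `restrict-iso⇒≈` and `≈⇒restrict-iso`. This gives the coherence and separation that the count
    -- of rearrangements asks for.
    zeroNode-card : ∀ ts {S} → All (Component π false) ts → All (Reads D) ts →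
      Listing (Child G S) (children π ts) →
      ZeroData w S → All (λ t → HasCard (shape t ≈_) (weight t)) ts →
      HasCard (shape (node false ts) ≈_) (w S * product (map w (zeroNodesF π ts)))
    zeroNode-card ts {S} ps rs L zd cards = card-node {ts = ts}
      (subst (HasCard _) product-eq (rearrangements-card qs coherent separated rep weight
        (λ q∈ → All.lookup cards (proj₂ (proj₂ (q-child q∈)))) k m len occs))
      (λ (ys , pw , q) → node (forth pw) q)
      (λ { (node {us = us} pw q) → us , back pw , q })
      where
      open ZeroData zd renaming (weight to w≡)
      open IsoClasses classes
      C : Tree (Fin n) → Subset n
      C t = ⟦ leaves t ⟧
      cs : All (Child G S ∘ C) ts
      cs = All.tabulate λ t∈ → sound L (∈-map⁺ C t∈)
      irr : ∀ {x} (p q : Child G S x) → type (x , p) ≡ type (x , q)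
      irr {x} p q = Equivalence.from (same-type (x , p) (x , q)) (≅-id id id)
      qs = labelled C type irr ts cs
      q-child : ∀ {q} → q ∈ qs → Σ[ p ∈ Child G S (C (proj₁ q)) ]
        type (C (proj₁ q) , p) ≡ proj₂ q × proj₁ q ∈ ts
      q-child = ∈-labelled C type irr ts cs
      pr : ∀ {q} → q ∈ qs → Proper (proj₁ q)
      pr q∈ = proj₂ (All.lookup ps (proj₂ (proj₂ (q-child q∈))))
      rd : ∀ {q} → q ∈ qs → Reads D (proj₁ q)
      rd q∈ = All.lookup rs (proj₂ (proj₂ (q-child q∈)))
      coherent : ∀ {p q y} → p ∈ qs → q ∈ qs → proj₂ p ≡ proj₂ q → shape (proj₁ p) ≈ y →
        shape (proj₁ q) ≈ y
      coherent p∈ q∈ e s = ≈-trans (≈-sym (restrict-iso⇒≈ (pr p∈) (rd p∈) (pr q∈) (rd q∈)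
        (Equivalence.to (same-type _ _)
          (trans (proj₁ (proj₂ (q-child p∈))) (trans e (sym (proj₁ (proj₂ (q-child q∈))))))))) s
      separated : ∀ {p q y} → p ∈ qs → q ∈ qs → shape (proj₁ p) ≈ y → shape (proj₁ q) ≈ y →
        proj₂ p ≡ proj₂ q
      separated p∈ q∈ s s′ = trans (sym (proj₁ (proj₂ (q-child p∈)))) (trans
        (Equivalence.from (same-type _ _) (≈⇒restrict-iso (rd p∈) (rd q∈) (≈-trans s (≈-sym s′))))
        (proj₁ (proj₂ (q-child q∈))))
      rep : ∀ j → ∃[ x ] (x , j) ∈ qs
      rep j with inhabited j
      ... | (c , pc) , e with ∈-map⁻ C (complete L pc)
      ... | t , t∈ , refl = t , subst (λ j → (t , j) ∈ qs) e (labelled-∈ C type irr ts cs t∈ pc)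
      len : length (map proj₂ qs) ≡ k
      len = trans (ListP.length-map proj₂ qs) (trans (sym (ListP.length-map proj₁ qs))
        (trans (cong length (labelled-proj₁ C type irr ts cs)) (trans (sym (ListP.length-map C ts))
        (card-unique (_ , L , refl) (enumeration⇒card children-enum)))))
      occs : ∀ j → occ j (map proj₂ qs) ≡ m j
      occs j = trans (occ-labelled C type irr j ts cs)
        (card-unique (_ , withLabel-listing C type irr j ts cs L , refl)
          (enumeration⇒card (size j)))
      product-eq : multinomial k m * product (map weight (map proj₁ qs)) ≡ w S * product
        (map w (zeroNodesF π ts))
      product-eq = cong₂ _*_ (sym w≡)
        (trans (cong (product ∘ map weight) (labelled-proj₁ C type irr ts cs)) (product-weights ts))
      forth : ∀ {us} → Pointwise (λ t s → shape t ≈ s) (map proj₁ qs) us →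
        Pointwise _≈_ (shapes ts) us
      forth {us} pw = pointwise-shapes⁺
        (subst (λ ts → Pointwise (λ t s → shape t ≈ s) ts us) (labelled-proj₁ C type irr ts cs) pw)
      back : ∀ {us} → Pointwise _≈_ (shapes ts) us →
        Pointwise (λ t s → shape t ≈ s) (map proj₁ qs) us
      back pw = subst (λ ts → Pointwise (λ t s → shape t ≈ s) ts _)
        (sym (labelled-proj₁ C type irr ts cs)) (pointwise-shapes⁻ ts pw)

    -- At a 1-node the children keep their places and vary independently, so it contributes no
    -- factor of its own; a 0-node contributes its multinomial coefficient.
    shapes-card : ∀ t → Proper t → Reads D t → StrongT π t → HasCard (shape t ≈_) (weight t)
    shapes-cards : ∀ b ts → All (Component π b) ts → All (Reads D) ts → All (StrongT π) ts →
      All (λ t → HasCard (shape t ≈_) (weight t)) ts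
    shapes-card (leaf x) _ _ _ = leaf tt ∷ [] , record
      { unique = [] ∷ [] ; sound = λ { (here refl) → leaf } ; complete = λ { leaf → here refl } } ,
        refl
    shapes-card (node true ts) p@(node l ps) r@(node rs ap) st = card-node {ts = ts}
      (subst (HasCard _) (product-weights ts)
        (cartesian-card ts (shapes-cards true ts ps rs
          (All.tabulate (child-strong π ps rs ap st)))))
      (λ pw → node (pointwise-shapes⁺ pw) refl) (λ { (node pw refl) → pointwise-shapes⁻ ts pw })
    shapes-card (node false ts) p@(node l ps) r@(node rs ap) st =
      zeroNode-card ts ps rs (children-listing π ts p r st) (zeroData (zeroNode-root π p r st))
        (shapes-cards false ts ps rs (All.tabulate (child-strong π ps rs ap st)))
    shapes-cards b [] [] [] [] = []
    shapes-cards b (t ∷ ts) ((_ , p) ∷ ps) (r ∷ rs) (st ∷ sts) =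
      shapes-card t p r st ∷ shapes-cards b ts ps rs sts

-- Permutations and labelled trees.

allFin-ascending : ∀ n → AllPairs Fin._<_ (allFin n)
allFin-ascending n = AllPairsP.tabulate⁺-< id

ascending-unique : ∀ {n} {xs ys : List (Fin n)} → AllPairs Fin._<_ xs → AllPairs Fin._<_ ys →
  (∀ {x} → x ∈ xs → x ∈ ys) → (∀ {x} → x ∈ ys → x ∈ xs) → xs ≡ ys
ascending-unique {xs = []} {[]} _ _ _ _ = refl
ascending-unique {xs = []} {y ∷ ys} _ _ _ g with () ← g (here refl)
ascending-unique {xs = x ∷ xs} {[]} _ _ f _ with () ← f (here refl)
ascending-unique {xs = x ∷ xs} {y ∷ ys} (p ∷ ps) (q ∷ qs) f g with f (here refl) | g (here refl)
... | there x∈ | there y∈ = contradiction (All.lookup p y∈) (ℕP.<-asym (All.lookup q x∈))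
... | there x∈ | here refl = contradiction (All.lookup q x∈) (ℕP.<-irrefl refl)
... | here refl | _ = cong (x ∷_) (ascending-unique ps qs (tail p f) (tail q g))
  where
  tail : ∀ {n} {x : Fin n} {xs ys} → All (x Fin.<_) xs → (∀ {z} → z ∈ x ∷ xs → z ∈ x ∷ ys) → ∀ {z} →
    z ∈ xs → z ∈ ys
  tail p f z∈ with f (there z∈)
  ... | here refl = contradiction (All.lookup p z∈) (ℕP.<-irrefl refl)
  ... | there z∈′ = z∈′

increasing⇒≤ : ∀ {n} (h : Fin n → Fin n) → (∀ {i j} → i Fin.< j → h i Fin.< h j) → ∀ i →
  toℕ i ≤ toℕ (h i)
increasing⇒≤ h mono i = go (toℕ i) i refl
  where
  go : ∀ k i → toℕ i ≡ k → k ≤ toℕ (h i)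
  go zero    i       e = z≤n
  go (suc k) (suc i) e =
    ℕP.≤-<-trans (go k (inject₁ i) (trans (FinP.toℕ-inject₁ i) (ℕP.suc-injective e)))
    (mono (s≤s (ℕP.≤-reflexive (FinP.toℕ-inject₁ i))))

module _ {n : ℕ} where

  ʳ≈⇒ˡ≡ : (σ ρ : Permutation′ n) → σ FPerm.≈ ρ → ∀ i → σ ⟨$⟩ˡ i ≡ ρ ⟨$⟩ˡ i
  ʳ≈⇒ˡ≡ σ ρ e i = trans (sym (inverseˡ ρ))
    (cong (ρ ⟨$⟩ˡ_) (trans (sym (e (σ ⟨$⟩ˡ i))) (inverseʳ σ)))

  D-resp-≈ : (σ ρ : Permutation′ n) → σ FPerm.≈ ρ → ∀ {x y} → D[ σ ] x y → D[ ρ ] x y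
  D-resp-≈ σ ρ e (p , q) = p , subst₂ Fin._<_ (ʳ≈⇒ˡ≡ σ ρ e _) (ʳ≈⇒ˡ≡ σ ρ e _) q

  -- If σ and ρ have the same inversions, then ρ⁻¹σ and its inverse are both strictly increasing. A
  -- strictly increasing map of `Fin n` nowhere falls below the identity, so both are the identity.
  inversions-injective : (σ ρ : Permutation′ n) → (∀ {x y} → D[ σ ] x y → D[ ρ ] x y) →
    (∀ {x y} → D[ ρ ] x y → D[ σ ] x y) → σ FPerm.≈ ρ
  inversions-injective σ ρ f g i = sym (trans (cong (ρ ⟨$⟩ʳ_) (sym fixed)) (inverseʳ ρ))
    where
    mono : (σ ρ : Permutation′ n) → (∀ {x y} → D[ σ ] x y → D[ ρ ] x y) →
      (∀ {x y} → D[ ρ ] x y → D[ σ ] x y) →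
      ∀ {i j} → i Fin.< j → ρ ⟨$⟩ˡ (σ ⟨$⟩ʳ i) Fin.< ρ ⟨$⟩ˡ (σ ⟨$⟩ʳ j)
    mono σ ρ f g {i} {j} i<j with FinP.<-cmp (σ ⟨$⟩ʳ i) (σ ⟨$⟩ʳ j)
    ... | tri≈ _ e _ = contradiction i<j (ℕP.<-irrefl (cong toℕ
            (trans (sym (inverseˡ σ)) (trans (cong (σ ⟨$⟩ˡ_) e) (inverseˡ σ)))))
    ... | tri> _ _ gt = proj₂ (f (gt , subst₂ Fin._<_ (sym (inverseˡ σ)) (sym (inverseˡ σ)) i<j))
    ... | tri< lt ne _ with FinP.<-cmp (ρ ⟨$⟩ˡ (σ ⟨$⟩ʳ i)) (ρ ⟨$⟩ˡ (σ ⟨$⟩ʳ j))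
    ...   | tri< lt′ _ _ = lt′
    ...   | tri≈ _ e _ = contradiction (π⁻¹-injective ρ e) ne
    ...   | tri> _ _ gt =
      contradiction (subst₂ Fin._<_ (inverseˡ σ) (inverseˡ σ) (proj₂ (g (lt , gt)))) (ℕP.<-asym i<j)
    h h′ : Fin n → Fin n
    h i = ρ ⟨$⟩ˡ (σ ⟨$⟩ʳ i)
    h′ i = σ ⟨$⟩ˡ (ρ ⟨$⟩ʳ i)
    h′h : h′ (h i) ≡ i
    h′h = trans (cong (σ ⟨$⟩ˡ_) (inverseʳ ρ)) (inverseˡ σ)
    fixed : h i ≡ i
    fixed = FinP.toℕ-injective (ℕP.≤-antisym
      (subst (λ j → toℕ (h i) ≤ toℕ j) h′h (increasing⇒≤ h′ (mono ρ σ g f) (h i)))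
      (increasing⇒≤ h (mono σ ρ f g) i))

  -- The permutation with one-line notation l: the k-th position carries the k-th entry.
  listPermutation : (l : List (Fin n)) → l ↭ allFin n →
    ∃[ σ ] AllPairs (λ x y → σ ⟨$⟩ˡ x Fin.< σ ⟨$⟩ˡ y) l
  listPermutation l p =
    σ , subst (AllPairs _) (ListP.tabulate-lookup l)
    (AllPairsP.tabulate⁺-< {f = lookup l} λ {i} {j} i<j →
      subst₂ ℕ._<_ (sym (pos i)) (sym (pos j)) i<j)
    where
    mem : ∀ x → x ∈ l
    mem x = ∈-resp-↭ (↭-sym p) (∈-allFin x)
    index : Fin n → Fin (length l)
    index x = Any.index (mem x)
    lookup-index : ∀ x → lookup l (index x) ≡ x
    lookup-index x = sym (AnyP.lookup-index (mem x))
    l-unique : Unique l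
    l-unique = allPairs-↭ {R = _≢_} (λ p → p ∘ sym) (↭-sym p) (UniqueP.allFin⁺ n)
    index-lookup : ∀ i → index (lookup l i) ≡ i
    index-lookup i = lookup-injective l-unique _ i (lookup-index (lookup l i))
    len : length l ≡ n
    len = trans (↭-length p) (ListP.length-tabulate id)
    σ : Permutation′ n
    σ = cast-id (sym len) ∘ₚ permutation (lookup l) index lookup-index index-lookup
    pos : ∀ i → toℕ (σ ⟨$⟩ˡ lookup l i) ≡ toℕ i
    pos i = trans (FinP.toℕ-cast _ (index (lookup l i))) (cong toℕ (index-lookup i))

-- With the children of 1-nodes reversed, the leaves appear in the second
-- of the two orders that make up a permutation.
mirror  : ∀ {A : Set} → Tree A → List A
mirrorF : ∀ {A : Set} → List (Tree A) → List A
mirrorR : ∀ {A : Set} → List (Tree A) → List A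
mirror (leaf x)        = x ∷ []
mirror (node false ts) = mirrorF ts
mirror (node true ts)  = mirrorR ts
mirrorF []       = []
mirrorF (t ∷ ts) = mirror t ++ mirrorF ts
mirrorR []       = []
mirrorR (t ∷ ts) = mirrorR ts ++ mirror t

mirror-↭  : ∀ {A : Set} (t : Tree A) → mirror t ↭ leaves t
mirrorF-↭ : ∀ {A : Set} (ts : List (Tree A)) → mirrorF ts ↭ leavesF ts
mirrorR-↭ : ∀ {A : Set} (ts : List (Tree A)) → mirrorR ts ↭ leavesF ts
mirror-↭ (leaf x)        = Perm.refl
mirror-↭ (node false ts) = mirrorF-↭ ts
mirror-↭ (node true ts)  = mirrorR-↭ ts
mirrorF-↭ []       = Perm.refl
mirrorF-↭ (t ∷ ts) = ++⁺ (mirror-↭ t) (mirrorF-↭ ts)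
mirrorR-↭ []       = Perm.refl
mirrorR-↭ (t ∷ ts) = ↭-trans (++-comm (mirrorR ts) (mirror t)) (++⁺ (mirror-↭ t) (mirrorR-↭ ts))

module _ {A : Set} {_<₁_ _<₂_ : Rel A 0ℓ} (asym₁ : ∀ {x y} → x <₁ y → ¬ y <₁ x) (asym₂ : ∀ {x y} → x <₂ y → ¬ y <₂ x) where

  Inversion : Rel A 0ℓ
  Inversion x y = x <₁ y × y <₂ x

  -- Leaves of different children of a node stand in the same order in `leaves` and `mirror` at a
  -- 0-node, and in opposite orders at a 1-node. So the inversions between the two orders are the
  -- arcs that the colours prescribe.
  reads-inversions : ∀ t → AllPairs _<₁_ (leaves t) → AllPairs _<₂_ (mirror t) → Reads Inversion t
  reads-inversionsF : ∀ ts → AllPairs _<₁_ (leavesF ts) → AllPairs _<₂_ (mirrorF ts) →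
    All (Reads Inversion) ts × AllPairs (CrossT Inversion false) ts
  reads-inversionsR : ∀ ts → AllPairs _<₁_ (leavesF ts) → AllPairs _<₂_ (mirrorR ts) →
    All (Reads Inversion) ts × AllPairs (CrossT Inversion true) ts
  reads-inversions (leaf x) _ _ = leaf
  reads-inversions (node false ts) p q = let r , c = reads-inversionsF ts p q in node r c
  reads-inversions (node true ts)  p q = let r , c = reads-inversionsR ts p q in node r c
  reads-inversionsF [] _ _ = [] , []
  reads-inversionsF (t ∷ ts) p q =
    let r , c = reads-inversionsF ts (allPairs-++ʳ (leaves t) p) (allPairs-++ʳ (mirror t) q)
    in reads-inversions t (allPairs-++ˡ (leaves t) p) (allPairs-++ˡ (mirror t) q) ∷ r ,
       All.tabulate (λ u∈ x∈ y∈ → cross x∈ (∈-leavesF⁺ u∈ y∈)) ∷ c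
    where
    cross : ∀ {x y} → x ∈ leaves t → y ∈ leavesF ts → Cross Inversion false x y
    cross x∈ y∈ =
      let lt₁ = allPairs-++-cross (leaves t) p x∈ y∈
          lt₂ = allPairs-++-cross (mirror t) q (∈-resp-↭ (↭-sym (mirror-↭ t)) x∈)
            (∈-resp-↭ (↭-sym (mirrorF-↭ ts)) y∈)
      in (λ { refl → asym₁ lt₁ lt₁ }) , (λ (_ , gt) → asym₂ lt₂ gt) , λ (gt , _) → asym₁ lt₁ gt
  reads-inversionsR [] _ _ = [] , []
  reads-inversionsR (t ∷ ts) p q =
    let r , c = reads-inversionsR ts (allPairs-++ʳ (leaves t) p) (allPairs-++ˡ (mirrorR ts) q)
    in reads-inversions t (allPairs-++ˡ (leaves t) p) (allPairs-++ʳ (mirrorR ts) q) ∷ r ,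
       All.tabulate (λ u∈ x∈ y∈ → cross x∈ (∈-leavesF⁺ u∈ y∈)) ∷ c
    where
    cross : ∀ {x y} → x ∈ leaves t → y ∈ leavesF ts → Cross Inversion true x y
    cross x∈ y∈ =
      let lt₁ = allPairs-++-cross (leaves t) p x∈ y∈
          lt₂ = allPairs-++-cross (mirrorR ts) q (∈-resp-↭ (↭-sym (mirrorR-↭ ts)) y∈)
            (∈-resp-↭ (↭-sym (mirror-↭ t)) x∈)
      in (λ { refl → asym₁ lt₁ lt₁ }) , (lt₁ , lt₂) , λ (gt , _) → asym₁ lt₁ gt

module _ {A : Set} {D D′ : Rel A 0ℓ} (irr : ∀ x → ¬ D x x) where

  -- Two leaves are separated at their lowest common node, and its colour together with the order of
  -- its children decides the arcs between them.
  reads-determine  : ∀ {t} → Reads D t → Reads D′ t → ∀ {x y} → x ∈ leaves t → y ∈ leaves t →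
    D x y → D′ x y
  reads-determineF : ∀ {b ts} → All (Reads D) ts → AllPairs (CrossT D b) ts → All (Reads D′) ts →
    AllPairs (CrossT D′ b) ts →
    ∀ {x y} → x ∈ leavesF ts → y ∈ leavesF ts → D x y → D′ x y
  reads-determine {leaf z} _ _ (here refl) (here refl) d = contradiction d (irr z)
  reads-determine (node rs ap) (node rs′ ap′) = reads-determineF rs ap rs′ ap′
  reads-determineF {b} {t ∷ ts} (r ∷ rs) (a ∷ ap) (r′ ∷ rs′) (a′ ∷ ap′) x∈ y∈ d
    with ∈-++⁻ (leaves t) x∈ | ∈-++⁻ (leaves t) y∈
  ... | inj₁ x∈ | inj₁ y∈ = reads-determine r r′ x∈ y∈ d
  ... | inj₂ x∈ | inj₂ y∈ = reads-determineF rs ap rs′ ap′ x∈ y∈ d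
  ... | inj₁ x∈ | inj₂ y∈ = let u , u∈ , y∈u = ∈-leavesF⁻ ts y∈ in
    go b (All.lookup a u∈ x∈ y∈u) (All.lookup a′ u∈ x∈ y∈u) d
    where
    go : ∀ b {x y} → Cross D b x y → Cross D′ b x y → D x y → D′ x y
    go true  _ (_ , d′ , _) _ = d′
    go false (_ , ¬d , _) _ d = contradiction d ¬d
  ... | inj₂ x∈ | inj₁ y∈ = let u , u∈ , x∈u = ∈-leavesF⁻ ts x∈ in contradiction d (no-back b (All.lookup a u∈ y∈ x∈u))
    where
    no-back : ∀ b {x y} → Cross D b x y → ¬ D y x
    no-back true  = proj₂ ∘ proj₂
    no-back false = proj₂ ∘ proj₂

≅-trans : ∀ {A B C : Set} {D : Rel A 0ℓ} {E : Rel B 0ℓ} {F : Rel C 0ℓ} → D ≅ E → E ≅ F → D ≅ F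
≅-trans (f , i) (g , j) = g ∘ f , Compose.isOrderIsomorphism trans i j

≅-flip : ∀ {A B : Set} {D : Rel A 0ℓ} {E : Rel B 0ℓ} → D ≅ E → (- D) ≅ (- E)
≅-flip (f , i) = f , record
  { isOrderMonomorphism = record
    { isOrderHomomorphism = record { cong = cong f ; mono = I.mono }
    ; injective = I.injective
    ; cancel    = I.cancel }
  ; surjective = I.surjective }
  where module I = IsOrderIsomorphism i

≅⇒Iso : ∀ {n} {D E : Rel (Fin n) 0ℓ} → D ≅ E → ∃[ F ] Iso D E (allFin n) (allFin n) F
≅⇒Iso = ≅⇒iso id id id id ∈-allFin ∈-allFin (λ _ → _ , refl) (λ _ → _ , refl)

Iso⇒≅ : ∀ {n} {D E : Rel (Fin n) 0ℓ} {F} → Iso D E (allFin n) (allFin n) F → D ≅ E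
Iso⇒≅ = iso⇒≅ id id id id ∈-allFin ∈-allFin (λ _ → _ , refl) (λ _ → _ , refl)

≅-sym : ∀ {n} {D E : Rel (Fin n) 0ℓ} → D ≅ E → E ≅ D
≅-sym i = Iso⇒≅ (iso-sym (proj₂ (≅⇒Iso i)))

-- The map is σ itself, from positions to labels. Positions i < j with σ j < σ i are labels in which
-- the larger one comes first, so the arc appears reversed.
D[flip] : ∀ {n} (σ : Permutation′ n) → D[ FPerm.flip σ ] ≅ (- D[ σ ])
D[flip] σ = (σ ⟨$⟩ʳ_) , record
  { isOrderMonomorphism = record
    { isOrderHomomorphism = record
      { cong = cong (σ ⟨$⟩ʳ_)
      ; mono = λ (p , q) → q , subst₂ Fin._<_ (sym (inverseˡ σ)) (sym (inverseˡ σ)) p }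
    ; injective = λ e → trans (sym (inverseˡ σ)) (trans (cong (σ ⟨$⟩ˡ_) e) (inverseˡ σ))
    ; cancel = λ (q , p) → subst₂ Fin._<_ (inverseˡ σ) (inverseˡ σ) p , q }
  ; surjective = λ y → σ ⟨$⟩ˡ y , λ { refl → inverseʳ σ } }

shape-id : (s : Shape) → shape s ≡ s
shapes-id : (ss : List Shape) → shapes ss ≡ ss
shape-id (leaf tt)   = refl
shape-id (node b ss) = cong (node b) (shapes-id ss)
shapes-id []       = refl
shapes-id (s ∷ ss) = cong₂ _∷_ (shape-id s) (shapes-id ss)

module _ {n : ℕ} where

  -- The children of 0-nodes are ordered by their labels, like those of 1-nodes.
  Labelled : Shape → Permutation′ n → Set
  Labelled s σ = ∃[ t ] shape t ≡ s × leaves t ≡ allFin n × Proper t × Reads D[ σ ] t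

  -- The labels are written into the shape from left to right, which sorts the children of every
  -- node. The positions are then read from `mirror`.
  shape⇒permutation : ∀ {s} → Proper s → length (leaves s) ≡ n → ∃[ σ ] Labelled s σ
  shape⇒permutation {s} p len with fill s (allFin n) (trans (ListP.length-tabulate id) (sym len))
  ... | t , e , l with listPermutation (mirror t) (↭-trans (mirror-↭ t) (Perm.↭-reflexive l))
  ... | σ , a = σ , t , e′ , l , proper-unshape t (subst Proper (sym e′) p) ,
    reads-inversions (λ p → ℕP.<-asym p) (λ p → ℕP.<-asym p) t
      (subst (AllPairs Fin._<_) (sym l) (allFin-ascending n)) a
    where e′ = trans e (shape-id s)

  -- The identity is an isomorphism that preserves labels, so `iso⇒≈` with `o = true` leaves no
  -- freedom to rearrange.
  labelled-injective : ∀ {s u σ ρ} → Labelled s σ → Labelled u ρ → σ FPerm.≈ ρ → s ≡ u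
  labelled-injective {σ = σ} {ρ} (t , refl , l , p , r) (v , refl , l′ , p′ , r′) e = ≈[true]⇒≡
    (iso⇒≈ {F = _≡_} {Fin._<_} {Fin._<_} true (λ { _ refl refl lt → lt }) (λ p → ℕP.<-asym p) t v p
      r p′ r′ iso
      (λ _ → subst (AllPairs Fin._<_) (sym l) (allFin-ascending n))
      (λ _ → subst (AllPairs Fin._<_) (sym l′) (allFin-ascending n)))
    where
    iso : Iso D[ σ ] D[ ρ ] (leaves t) (leaves v) _≡_
    iso = record
      { total = λ {x} _ → x , subst (x ∈_) (sym l′) (∈-allFin x) , refl
      ; onto  = λ {x} _ → x , subst (x ∈_) (sym l) (∈-allFin x) , refl
      ; same  = λ { _ _ _ _ refl refl → record
          { eq→ = id ; eq← = id ; to = D-resp-≈ σ ρ e ; from = D-resp-≈ ρ σ (sym ∘ e) } }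
      }

  labelled-functional : ∀ {s σ ρ} → Labelled s σ → Labelled s ρ → σ FPerm.≈ ρ
  labelled-functional {σ = σ} {ρ} (u , refl , l , _ , r) (v , e , l′ , _ , r′)
    with shape-leaves-injective v u e (trans l′ (sym l))
  ... | refl = inversions-injective σ ρ
    (reads-determine (D-irrefl σ) r r′ (mem _) (mem _))
      (reads-determine (D-irrefl ρ) r′ r (mem _) (mem _))
    where
    mem : ∀ x → x ∈ leaves u
    mem x = subst (x ∈_) (sym l) (∈-allFin x)

module _ {n} (π : Permutation′ n) {t : Tree (Fin n)} (p : Proper t) (r : Reads D[ π ] t) (l : leaves t ↭ allFin n) where

  labelled⇒represents : ∀ {s σ} → shape t ≈ s → Labelled s σ → Represents D[ π ] σ
  labelled⇒represents {σ = σ} e (u , refl , l′ , p′ , r′) =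
    Iso⇒≅ (iso-↭ (Perm.↭-reflexive l′) (iso-sym (iso-↭ l (iso-sym
      (proj₂ (≈⇒iso (D-irrefl π) (D-irrefl σ) t u r r′ e))))))

  -- The image of the tree of π under the isomorphism reads `D[ σ ]`, but its labels need not ascend
  -- at 0-nodes. Sorting repairs this and changes the shape only up to equivalence.
  represents⇒labelled : ∀ {σ} → Represents D[ π ] σ → ∃[ s ] shape t ≈ s × Labelled s σ
  represents⇒labelled {σ} (f , i) with sort-tree σ (mapT f t) (proper-mapT f p) (reads-mapT f cross r)
    where
    module I = IsOrderIsomorphism i
    cross : ∀ b {x y} → Cross D[ π ] b x y → Cross D[ σ ] b (f x) (f y)
    cross true  (p , q , r) = p ∘ I.injective , I.mono q , r ∘ I.cancel
    cross false (p , q , r) = p ∘ I.injective , q ∘ I.cancel , r ∘ I.cancel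
  ... | u , p′ , r′ , _ , e , q , a = shape u , subst (_≈ shape u) (shape-mapT f t) e , u , refl ,
      ascending-unique a (allFin-ascending n) (λ {x} _ → ∈-allFin x) (λ {x} _ → mem x) , p′ , r′
    where
    mem : ∀ x → x ∈ leaves u
    mem x with IsOrderIsomorphism.surjective i x
    ... | y , h = ∈-resp-↭ q (subst₂ _∈_ (h refl) (sym (leaves-mapT f t))
            (∈-map⁺ f (∈-resp-↭ (↭-sym l) (∈-allFin y))))

  represents-enumeration : ∀ {N} → HasCard (shape t ≈_) N →
    Enumeration (Sym n) (Represents D[ π ]) N
  represents-enumeration (ss , L , refl) = enumeration (Sym n) (proj₁ ∘ perm)
    (λ {i} {j} e → lookup-injective (unique L) i j
      (labelled-injective {σ = proj₁ (perm i)} {proj₁ (perm j)} (proj₂ (perm i)) (proj₂ (perm j))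
      e))
    (λ i → labelled⇒represents {σ = proj₁ (perm i)} (sound L (∈-lookup i)) (proj₂ (perm i)))
    λ σ rep → let s , e , lab = represents⇒labelled {σ} rep
                  s∈ = complete L e
              in Any.index s∈ , labelled-functional {σ = proj₁ (perm (Any.index s∈))} {σ} (proj₂ (perm (Any.index s∈)))
                   (subst (λ s → Labelled s σ) (AnyP.lookup-index s∈) lab)
    where
    perm : ∀ i → ∃[ σ ] Labelled (lookup ss i) σ
    perm i = shape⇒permutation (proper-≈ e (proper-shape p)) (trans (sym (size-≈ e)) len)
      where
      e : shape t ≈ lookup ss i
      e = sound L (∈-lookup i)
      proper-shape : ∀ {t : Tree (Fin n)} → Proper t → Proper (shape t)
      proper-shape = proper-mapT (const tt)
      len : length (leaves (shape t)) ≡ n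
      len = trans (cong length (leaves-mapT (const tt) t))
        (trans (ListP.length-map (const tt) (leaves t))
        (trans (↭-length l) (ListP.length-tabulate id)))

-- The number of represented permutations and the size of the geo-equivalence class.

product-tabulate : ∀ {n} (f : Fin n → ℕ) → product (tabulate f) ≡ ∏ f
product-tabulate {zero}  f = refl
product-tabulate {suc n} f = cong (f zero *_) (product-tabulate (f ∘ suc))

module _ (n : ℕ) (π : Permutation′ n) (cograph : IsCograph G[ π ])
  (r : ℕ) (M : Enumeration (Subsets n) (ZeroNode G[ π ]) r) (k : Fin r → ℕ)
  (childEnum : ∀ i → Enumeration (Subsets n) (Child G[ π ] (elem (Subsets n) M i)) (k i))
  (τ : Fin r → ℕ) (m : ∀ i → Fin (τ i) → ℕ)
  (classes : ∀ i → IsoClasses D[ π ] (Child G[ π ] (elem (Subsets n) M i)) (τ i) (m i)) where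

  zeroNode : Fin r → Subset n
  zeroNode = elem (Subsets n) M

  factor : Fin r → ℕ
  factor i = multinomial (k i) (m i)

  index? : (S : Subset n) → Dec (∃[ i ] zeroNode i ≡ S)
  index? S = FinP.any? λ i → VecP.≡-dec BoolP._≟_ (zeroNode i) S

  weightOf : {S : Subset n} → Dec (∃[ i ] zeroNode i ≡ S) → ℕ
  weightOf (yes (i , _)) = factor i
  -- A default for sets that are not 0-nodes; the product is taken over 0-nodes only.
  weightOf (no _)        = 1

  nodeWeight : Subset n → ℕ
  nodeWeight S = weightOf (index? S)

  nodeWeight-zeroNode : ∀ i → nodeWeight (zeroNode i) ≡ factor i
  nodeWeight-zeroNode i with index? (zeroNode i)
  ... | yes (j , e) = cong factor (elem-injective (Subsets n) M e)
  ... | no ¬p       = contradiction (i , refl) ¬p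

  zeroData : ∀ {S} → ZeroNode G[ π ] S → ZeroData π nodeWeight S
  zeroData {S} z with elem-surjective (Subsets n) M S z
  ... | i , refl = record
    { k = k i ; τ = τ i ; m = m i ; children-enum = childEnum i ; classes = classes i ;
      weight = nodeWeight-zeroNode i }

  -- Every proper tree has a leaf, so a tree exists only for n > 0.
  represents-count : ∀ {n′} → n ≡ suc n′ → Enumeration (Sym n) (Represents D[ π ]) (∏ factor)
  represents-count refl = subst (Enumeration (Sym n) (Represents D[ π ])) count
    (represents-enumeration π p rd l (shapes-card π nodeWeight zeroData t p rd st))
    where
    strong = ⊤-strong π {allFin n} ∈-allFin
    built = build π cograph (length (allFin n)) (allFin n) ℕP.≤-refl (UniqueP.allFin⁺ n) strong
      (zero , ∈-allFin zero)
    t = proj₁ built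
    p = proj₁ (proj₂ built)
    rd = proj₁ (proj₂ (proj₂ built))
    l = proj₂ (proj₂ (proj₂ built))
    mem : ∀ x → x ∈ leaves t
    mem x = PermP.∈-resp-↭ (↭-sym l) (∈-allFin x)
    st = ⊤-strong π {leaves t} mem
    count : weight π nodeWeight zeroData t ≡ ∏ factor
    count = begin
      product (map nodeWeight (zeroNodes π t))     ≡⟨ ActP.product-↭ (PermP.map⁺ nodeWeight
        (listing-↭ (listing-resp proj₁ (λ z → z , λ {x} _ → ∈⟦⟧⁺ (mem x))
          (zeroNodes-listing π t p rd st))
          (enumeration⇒listing M))) ⟩
      product (map nodeWeight (tabulate zeroNode))     ≡⟨ cong product
        (ListP.map-tabulate zeroNode nodeWeight) ⟩
      product (tabulate (nodeWeight ∘ zeroNode))       ≡⟨ product-tabulate (nodeWeight ∘ zeroNode) ⟩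
      ∏ (nodeWeight ∘ zeroNode)                        ≡⟨ ∏-cong nodeWeight-zeroNode ⟩
      ∏ factor                                     ∎
      where open ≡-Reasoning

module _ {c ℓ p q} (S : Setoid c ℓ) {P : Pred (Setoid.Carrier S) p} {Q : Pred (Setoid.Carrier S) q} where
  private module S = Setoid S

  enumeration-resp : ∀ {N} → (∀ x → P x → Q x) → (∀ x → Q x → P x) → Enumeration S P N →
    Enumeration S Q N
  enumeration-resp f g e =
    enumeration S (elem S e) (elem-injective S e) (λ i → f _ (elem-sound S e i))
    λ x q → elem-surjective S e x (g x q)

  enumeration-⊎ : ∀ {M N} → Enumeration S P M → Enumeration S Q N →
    (∀ {x y} → x S.≈ y → P x → ¬ Q y) →
    Enumeration S (λ x → P x ⊎ Q x) (M + N)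
  enumeration-⊎ {M} {N} e e′ disjoint =
    enumeration S (f ∘ splitAt M) inj (λ i → s (splitAt M i)) surj
    where
    f : Fin M ⊎ Fin N → S.Carrier
    f = [ elem S e , elem S e′ ]′
    f-injective : ∀ x y → f x S.≈ f y → x ≡ y
    f-injective (inj₁ i) (inj₁ j) h = cong inj₁ (elem-injective S e h)
    f-injective (inj₂ i) (inj₂ j) h = cong inj₂ (elem-injective S e′ h)
    f-injective (inj₁ i) (inj₂ j) h =
      contradiction (elem-sound S e′ j) (disjoint h (elem-sound S e i))
    f-injective (inj₂ i) (inj₁ j) h =
      contradiction (elem-sound S e′ i) (disjoint (S.sym h) (elem-sound S e j))
    inj : ∀ {i j} → f (splitAt M i) S.≈ f (splitAt M j) → i ≡ j
    inj {i} {j} h = trans (sym (FinP.join-splitAt M N i))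
      (trans (cong (Fin.join M N) (f-injective (splitAt M i) (splitAt M j) h))
        (FinP.join-splitAt M N j))
    s : ∀ x → P (f x) ⊎ Q (f x)
    s (inj₁ i) = inj₁ (elem-sound S e i)
    s (inj₂ j) = inj₂ (elem-sound S e′ j)
    surj : ∀ x → P x ⊎ Q x → ∃[ i ] f (splitAt M i) S.≈ x
    surj x (inj₁ p) = let i , h = elem-surjective S e x p in
      i ↑ˡ N , subst (λ y → f y S.≈ x) (sym (FinP.splitAt-↑ˡ M i N)) h
    surj x (inj₂ q) = let j , h = elem-surjective S e′ x q in
      M ↑ʳ j , subst (λ y → f y S.≈ x) (sym (FinP.splitAt-↑ʳ M N j)) h

represents-reverse⇒ : ∀ {n} (π σ : Permutation′ n) → (- D[ π ]) ≅ D[ σ ] →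
  Represents D[ π ] (FPerm.flip σ)
represents-reverse⇒ π σ h = ≅-trans (≅-flip h) (≅-sym (D[flip] σ))

represents-reverse⇐ : ∀ {n} (π σ : Permutation′ n) → Represents D[ π ] (FPerm.flip σ) →
  (- D[ π ]) ≅ D[ σ ]
represents-reverse⇐ π σ h = ≅-flip (≅-trans h (D[flip] σ))

enumeration-flip : ∀ {n N} {p} {P : Pred (Permutation′ n) p} → Enumeration (Sym n) P N →
  Enumeration (Sym n) (P ∘ FPerm.flip) N
enumeration-flip {n} e = enumeration (Sym n) (FPerm.flip ∘ elem (Sym n) e)
  (λ {i} {j} h → elem-injective (Sym n) e
    (ʳ≈⇒ˡ≡ (FPerm.flip (elem (Sym n) e i)) (FPerm.flip (elem (Sym n) e j)) h))
  (elem-sound (Sym n) e)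
  λ σ p → let i , h = elem-surjective (Sym n) e (FPerm.flip σ) p
          in i , ʳ≈⇒ˡ≡ (elem (Sym n) e i) (FPerm.flip σ) h

corollary7 : ∀ {c ℓ₁ ℓ₂ ℓ₃} (K : OrderedField c ℓ₁ ℓ₂ ℓ₃)
    (n : ℕ) (π : Permutation′ n) →
    let G = G[ π ]
        D = D[ π ]
    in
    IsCograph G →
    (t r : ℕ)
    (N : Enumeration (Subsets n) (OneNode G) t)
    (M : Enumeration (Subsets n) (ZeroNode G) r) →
    let ChildOfM = λ (i : Fin r) → Child G (proj₁ (Bijection.to M i)) in
    (k : Fin r → ℕ) →
    (∀ i → Enumeration (Subsets n) (ChildOfM i) (k i)) →
    (τ : Fin r → ℕ) (m : ∀ i → Fin (τ i) → ℕ) →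
    (∀ i → IsoClasses D (ChildOfM i) (τ i) (m i)) →
    let nD = ∏ (λ i → multinomial (k i) (m i)) in
    Enumeration (Sym n) (Represents D) nD
    × (¬ (D ≅ - D) → Enumeration (Sym n) (Geometry.GeoClass K π) (2 * nD))
    × (D ≅ - D → Enumeration (Sym n) (Geometry.GeoClass K π) nD)
corollary7 K n π cograph t r N M k childEnum τ m classes = E , twice , once
  where
  open Geometry K using (GeoClass)
  open GeoIsomorphisms K using (∼⇒iso; iso⇒∼)
  nD = ∏ (λ i → multinomial (k i) (m i))
  D = D[ π ]

  ≈⇒≅ : ∀ (σ ρ : Permutation′ n) → σ FPerm.≈ ρ → D[ σ ] ≅ D[ ρ ]
  ≈⇒≅ σ ρ e = ≅-id (D-resp-≈ σ ρ e) (D-resp-≈ ρ σ (sym ∘ e))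

  count : ∀ n (π : Permutation′ n) → IsCograph G[ π ] → ∀ r
    (M : Enumeration (Subsets n) (ZeroNode G[ π ]) r) (k : Fin r → ℕ) →
    (∀ i → Enumeration (Subsets n) (Child G[ π ] (proj₁ (Bijection.to M i))) (k i)) →
    (τ : Fin r → ℕ) (m : ∀ i → Fin (τ i) → ℕ) →
    (∀ i → IsoClasses D[ π ] (Child G[ π ] (proj₁ (Bijection.to M i))) (τ i) (m i)) →
    Enumeration (Sym n) (Represents D[ π ]) (∏ (λ i → multinomial (k i) (m i)))
  count (suc n) π cograph r M k ce τ m cl = represents-count (suc n) π cograph r M k ce τ m cl refl
  -- For n = 0 there are no nodes; the empty product counts the one empty permutation.
  count zero π _ zero _ _ _ _ _ _ =
    enumeration (Sym 0) (λ _ → π) (λ {i} {j} _ → single i j) (λ _ → ≅-id id id)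
    λ _ _ → zero , λ ()
    where
    single : (i j : Fin 1) → i ≡ j
    single zero zero = refl
  count zero π _ (suc r) M _ _ _ _ _
    with () ← proj₁ (proj₁ (proj₁ (proj₁ (elem-sound (Subsets 0) M zero))))

  E : Enumeration (Sym n) (Represents D) nD
  E = count n π cograph r M k childEnum τ m classes

  E′ : Enumeration (Sym n) (λ σ → (- D) ≅ D[ σ ]) nD
  E′ = enumeration-resp (Sym n) (represents-reverse⇐ π) (represents-reverse⇒ π) (enumeration-flip E)

  class⇒ : ∀ σ → GeoClass π σ → D ≅ D[ σ ] ⊎ (- D) ≅ D[ σ ]
  class⇒ σ h with ∼⇒iso h
  ... | false , i = inj₁ (≅-sym i)
  ... | true  , i = inj₂ (≅-sym i)

  class⇐ : ∀ σ → D ≅ D[ σ ] ⊎ (- D) ≅ D[ σ ] → GeoClass π σ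
  class⇐ σ (inj₁ i) = iso⇒∼ false (≅-sym i)
  class⇐ σ (inj₂ i) = iso⇒∼ true (≅-sym i)

  twice : ¬ (D ≅ - D) → Enumeration (Sym n) (GeoClass π) (2 * nD)
  twice D≇-D = enumeration-resp (Sym n) class⇐ class⇒ (subst (Enumeration (Sym n) _)
    (cong (nD +_) (sym (ℕP.+-identityʳ nD)))
    (enumeration-⊎ (Sym n) E E′ λ {σ} {ρ} e i j → D≇-D (≅-trans i (≅-trans (≈⇒≅ σ ρ e) (≅-sym j)))))

  once : D ≅ - D → Enumeration (Sym n) (GeoClass π) nD
  once D≅-D = enumeration-resp (Sym n) (λ σ → class⇐ σ ∘ inj₁)
    (λ σ → [ id , ≅-trans D≅-D ]′ ∘ class⇒ σ) E
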